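{- Let $m,n\ge 2$ be integers with $\frac1m+\frac1n<\frac12$ (a hyperbolic type $\{m,n\}$). Then there exists a chiral map of type $\{m,n\}$ whose (orientation-preserving) automorphism group is an alternating group $A_k$ for some degree $k$.
   Context: A map is a cellular embedding of a connected graph in a closed surface. An orientably-regular map is a map on an orientable surface whose group of orientation-preserving automorphisms acts transitively on arcs (directed edges). Such a map is determined by its orientation-preserving automorphism group $G=\langle r,s\rangle$, where $r$ and $s$ are the one-step rotations about a face and an incident vertex, so that $rs$ is an involution; it is denoted $\mathcal{M}(G:r,s)$ and has type $\{m,n\}$ when $r$ has order $m$ and $s$ has order $n$. The map is reflexible if there is a group automorphism of $G$ sending $r\mapsto r^{ -1}$ and $s\mapsto s^{ -1}$, and chiral otherwise. "Automorphism group" of the chiral map means $G$. -}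

module Defs where

open import Level using (0ℓ)
open import Data.Nat using (ℕ; zero; suc; _<_)
open import Data.Fin using (Fin)
open import Data.Fin.Permutation
  using (Permutation′; _⟨$⟩ʳ_; id; flip; _∘ₚ_; transpose; _≈_)
open import Data.List using (List; []; _∷_; length)
open import Data.Product using (Σ; ∃; ∃-syntax; Σ-syntax; _×_; _,_; proj₁; proj₂)
open import Relation.Binary.PropositionalEquality using (_≡_; _≢_)
open import Relation.Nullary using (¬_)

Perm : ℕ → Set
Perm k = Permutation′ k

Transp : ℕ → Set
Transp k = Σ (Fin k) λ i → Σ (Fin k) λ j → i ≢ j

prodT : ∀ {k} → List (Transp k) → Perm k
prodT []                  = id
prodT ((i , j , _) ∷ ts)  = transpose i j ∘ₚ prodT ts

data Even : ℕ → Set where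
  even-zero : Even 0
  even-ss   : ∀ {n} → Even n → Even (suc (suc n))

IsEven : ∀ {k} → Perm k → Set
IsEven {k} p = ∃[ ts ] (Even (length ts) × prodT ts ≈ p)

Alt : ℕ → Set
Alt k = Σ (Perm k) IsEven

_^ₚ_ : ∀ {k} → Perm k → ℕ → Perm k
p ^ₚ zero  = id
p ^ₚ suc n = p ∘ₚ (p ^ₚ n)

HasOrder : ∀ {k} → Perm k → ℕ → Set
HasOrder p n = (0 < n) × (p ^ₚ n ≈ id) × (∀ j → 0 < j → j < n → ¬ (p ^ₚ j ≈ id))

data Word : Set where
  e    : Word
  gr   : Word
  gs   : Word
  _·_  : Word → Word → Word
  inv  : Word → Word

eval : ∀ {k} → Perm k → Perm k → Word → Perm k
eval r s e       = id
eval r s gr      = r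
eval r s gs      = s
eval r s (u · v) = eval r s u ∘ₚ eval r s v
eval r s (inv u) = flip (eval r s u)

GeneratesAlt : ∀ {k} → Perm k → Perm k → Set
GeneratesAlt {k} r s =
  IsEven r × IsEven s × (∀ (p : Perm k) → IsEven p → ∃[ w ] (eval r s w ≈ p))

record AltAut (k : ℕ) : Set where
  field
    φ        : Alt k → Alt k
    φ-cong   : ∀ (x y : Alt k) → proj₁ x ≈ proj₁ y → proj₁ (φ x) ≈ proj₁ (φ y)
    φ-hom    : ∀ (x y : Alt k) (xy : Alt k) → proj₁ xy ≈ (proj₁ x ∘ₚ proj₁ y) →
               proj₁ (φ xy) ≈ (proj₁ (φ x) ∘ₚ proj₁ (φ y))
    φ-inj    : ∀ (x y : Alt k) → proj₁ (φ x) ≈ proj₁ (φ y) → proj₁ x ≈ proj₁ y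
    φ-surj   : ∀ (y : Alt k) → Σ[ x ∈ Alt k ] (proj₁ (φ x) ≈ proj₁ y)

-- The orientably-regular map M(A_k ; r, s) of type {m,n}:
-- A_k = ⟨r,s⟩, r of order m, s of order n, rs an involution.
IsAltMapOfType : (k m n : ℕ) → Perm k → Perm k → Set
IsAltMapOfType k m n r s =
  GeneratesAlt r s × HasOrder r m × HasOrder s n × HasOrder (r ∘ₚ s) 2

Reflexible : ∀ {k} (r s : Perm k) → IsEven r → IsEven s → Set
Reflexible {k} r s er es = ∃[ a ] (proj₁ (AltAut.φ a (r , er)) ≈ flip r
                                 × proj₁ (AltAut.φ a (s , es)) ≈ flip s)

ChiralAltMap : (k m n : ℕ) → Set
ChiralAltMap k m n = Σ (Perm k) λ r → Σ (Perm k) λ s →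
  Σ (IsAltMapOfType k m n r s) λ M →
    ¬ Reflexible r s (proj₁ (proj₁ M)) (proj₁ (proj₂ (proj₁ M)))

{-# OPTIONS --safe #-}

-- A map of type {m, n} is given by a permutation r of order m and an involution t such that σ = r t has order n; then s = t r⁻¹.
-- Put τ = rʲ t r⁻ʲ. If all orbits of ⟨t, τ⟩ have sizes compatible with some K ≡ 1 (mod 3), except for one path
-- y₁ – y₂ – y₃ of length three, then (t τ)ᴷ is a 3-cycle. If moreover y₁ is linked to r y₁ by images of the pairs
-- {y₁, y₂} and {y₂, y₃} under the group, then the group contains 3-cycles through any two points and is the alternating group.
-- Reflexibility would carry a relation between r and t to the mirror image, where the word for the 3-cycle again gives a
-- 3-cycle; so the map is chiral as soon as the 3-cycle commutes with some conjugate of itself on one side but not on the other.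
--
-- All of this is checked near the path and is not disturbed by gluing further polygons (tiles) to two fixed points of t,
-- the ports, which lie on the two nontrivial cycles of σ: a tile lengthens both cycles by c, so n becomes n + c. An m-gon in
-- which ℓ pairs of adjacent points are interchanged by t is a tile with c = m - ℓ. Two such polygons joined by four
-- transpositions serve as the base for type {m, m - ℓ}. By duality this settles all types with m ≥ 20; for m < 20 there
-- remain finitely many pairs, from which the others arise by gluing, and these are given by explicit permutations.

module Submission where

open import Defs
import Data.Bool.Properties as BoolP
import Data.Fin.Permutation.Components as PC
import Data.Fin.Permutation.Transposition.List as TL
import Data.Fin.Properties as FinP
open import Data.Fin.Patterns
open import Data.Bool using (Bool; true; false; not; _∧_; _∨_; if_then_else_) renaming (T to True)
open import Data.Bool.ListAction using (any; all; and)
open import Data.Bool.Properties using (T-∧; T-∨)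
open import Data.Empty using (⊥; ⊥-elim)
open import Data.Fin using (Fin; toℕ; fromℕ<)
open import Data.Fin.Permutation using (_⟨$⟩ʳ_; _⟨$⟩ˡ_; flip; _∘ₚ_; transpose; _≈_; permutation; inverseˡ; inverseʳ) renaming (id to idₚ)
open import Data.List using (List; []; _∷_; _++_; length; map; downFrom)
open import Data.List.Membership.Propositional using (_∈_)
open import Data.List.Properties using (length-map; length-++)
open import Data.List.Relation.Unary.All using (All; []; _∷_)
open import Data.List.Relation.Unary.Any using (here; there; satisfied)
open import Data.List.Relation.Unary.Any.Properties using (any⁻)
open import Data.Maybe using (Maybe; just; nothing)
open import Data.Nat using (ℕ; zero; suc; _+_; _*_; _<_; _≤_; z≤n; s≤s; _∸_; _≡ᵇ_; _<ᵇ_; _%_; _/_; NonZero; s≤s⁻¹; _≤ᵇ_; >-nonZero)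
open import Data.Nat.DivMod using (m≡m%n+[m/n]*n; m%n<n)
open import Data.Nat.Properties using (+-comm; +-suc; *-comm; +-assoc; ≤-trans; ≤-refl; m≤m+n; m≤n+m; m∸n+n≡m; m+[n∸m]≡n; ≤-<-connex; n≤1+n; <⇒≤; +-cancelʳ-<; m<n⇒0<n∸m; +-monoʳ-<; ≤-reflexive; m∸n≤m; <-trans; m+n∸m≡n; suc-injective; +-cancelʳ-≡; +-identityʳ; <-irrefl; m≢1+n+m; *-monoˡ-≤; <⇒≱; +-monoʳ-≤; ≡ᵇ⇒≡; ≡⇒≡ᵇ; <ᵇ⇒<; <⇒<ᵇ; m<1+n⇒m<n∨m≡n; ≮⇒≥; +-mono-<; n≮0; m≤n⇒m<n∨m≡n; ≤ᵇ⇒≤; m+n≤o⇒m≤o∸n; m+n∸n≡m; ∸-monoˡ-≤; m≤n⇒∃[o]m+o≡n; +-cancelˡ-≡; +-cancelʳ-≤; +-mono-≤; +-monoˡ-≤; ≰⇒>; _≤?_; ≤⇒≤ᵇ; _<?_; ≤-total; *-monoʳ-≤) renaming (_≟_ to _≟ⁿ_)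
open import Data.Nat.Solver using (module +-*-Solver)
open import Data.Product using (Σ; ∃-syntax; _×_; _,_; proj₁; proj₂)
open import Data.Product.Function.NonDependent.Propositional using (_×-↔_)
open import Data.Product.Properties using (,-injectiveʳ)
open import Data.Sum using (_⊎_; inj₁; inj₂; [_,_]′)
open import Data.Sum.Function.Propositional using (_⊎-↔_)
open import Data.Sum.Properties using (inj₁-injective; inj₂-injective)
open import Data.Unit using (⊤; tt)
open import Function using (_∘_; _↔_; Inverse; mk↔ₛ′; Equivalence)
open import Function.Construct.Composition using (_↔-∘_)
open import Function.Construct.Identity using (↔-id)
open import Function.Construct.Symmetry using (↔-sym)
open import Relation.Binary using (DecidableEquality)
open import Relation.Binary.PropositionalEquality using (_≡_; _≢_; refl; sym; trans; cong; cong₂; subst; subst₂; ≢-sym)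
open import Relation.Nullary using (¬_; Dec; yes; no)
open import Relation.Nullary.Decidable using (map′; recompute; from-yes)

-- Both r and t must be even, so every tile is glued on twice, once at each of two ports: two equal
-- copies contribute an even permutation whatever the tile is. This is why σ is given two long
-- cycles, and why the base consists of two polygons.
--
-- The value j = 2 for polygons comes from the pairs of adjacent points interchanged by t. They are
-- consecutive, and r² carries each pair to the next; so t and τ agree on all of them but the first,
-- and τ acts alone just behind the last. One small exponent K therefore serves for any number of
-- pairs.
--
-- Each gluing creates two-element orbits of t τ, so K has to be even besides being 1 modulo 3; K =
-- 4 suffices for the polygonal base. A triangle leaves no room for a port whose translates by r and
-- r⁻¹ are both fixed by t, since it would then be a component of its own. For m = 3 the ports are
-- weaker, gluing also creates orbits of length five, and 10 must divide K.
--
-- Chirality is tested by commutation of 3-cycles because this depends only on how two triples of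
-- points meet, and so can be read off near the path.

it : {X : Set} → (X → X) → ℕ → X → X
it f zero    x = x
it f (suc n) x = f (it f n x)

module _ {X : Set} (f : X → X) where
  it-+ : ∀ a b x → it f (a + b) x ≡ it f a (it f b x)
  it-+ zero    b x = refl
  it-+ (suc a) b x = cong f (it-+ a b x)

  it-shift : ∀ a x → it f (suc a) x ≡ it f a (f x)
  it-shift zero    x = refl
  it-shift (suc a) x = cong f (it-shift a x)

  it-comm : ∀ a b x → it f a (it f b x) ≡ it f b (it f a x)
  it-comm a b x = trans (sym (it-+ a b x)) (trans (cong (λ c → it f c x) (+-comm a b)) (it-+ b a x))

  it-* : ∀ a b x → it f b x ≡ x → it f (a * b) x ≡ x
  it-* zero    b x p = refl
  it-* (suc a) b x p = trans (it-+ b (a * b) x) (trans (cong (it f b) (it-* a b x p)) p)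

  it-injective : (∀ {x y} → f x ≡ f y → x ≡ y) → ∀ a {x y} → it f a x ≡ it f a y → x ≡ y
  it-injective inj zero    p = p
  it-injective inj (suc a) p = it-injective inj a (inj p)

it-cong : {X : Set} {f g : X → X} → (∀ x → f x ≡ g x) → ∀ a x → it f a x ≡ it g a x
it-cong eq zero    x = refl
it-cong {f = f} eq (suc a) x = trans (cong f (it-cong eq a x)) (eq _)

it-inverse : {X : Set} {f g : X → X} → (∀ x → f (g x) ≡ x) → ∀ a x → it f a (it g a x) ≡ x
it-inverse eq zero x = refl
it-inverse {f = f} {g} eq (suc a) x =
  trans (it-shift f a (g (it g a x))) (trans (cong (it f a) (eq (it g a x))) (it-inverse eq a x))

-- Bijections, and the words acting by them

record Bij (X : Set) : Set where
  field
    to from : X → X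
    to-from : ∀ x → to (from x) ≡ x
    from-to : ∀ x → from (to x) ≡ x

  to-injective : ∀ {x y} → to x ≡ to y → x ≡ y
  to-injective {x} {y} p = trans (sym (from-to x)) (trans (cong from p) (from-to y))

open Bij

module _ {X : Set} where
  idᵇ : Bij X
  idᵇ = record { to = λ x → x ; from = λ x → x ; to-from = λ _ → refl ; from-to = λ _ → refl }

  invᵇ : Bij X → Bij X
  invᵇ f = record { to = from f ; from = to f ; to-from = from-to f ; from-to = to-from f }

  _⨾_ : Bij X → Bij X → Bij X
  f ⨾ g = record
    { to = λ x → to g (to f x) ; from = λ x → from f (from g x)
    ; to-from = λ x → trans (cong (to g) (to-from f _)) (to-from g x)
    ; from-to = λ x → trans (cong (from f) (from-to g _)) (from-to f x) }

  involutionᵇ : (t : X → X) → (∀ x → t (t x) ≡ x) → Bij X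
  involutionᵇ t eq = record { to = t ; from = t ; to-from = eq ; from-to = eq }

  -- Here `gs` stands for whichever second bijection is supplied: the same words are evaluated at
  -- (r, t), at (r, s) and at the mirror images of both pairs.
  ⟦_⟧ : Word → Bij X → Bij X → Bij X
  ⟦ e ⟧     R T = idᵇ
  ⟦ gr ⟧    R T = R
  ⟦ gs ⟧    R T = T
  ⟦ u · v ⟧ R T = ⟦ u ⟧ R T ⨾ ⟦ v ⟧ R T
  ⟦ inv u ⟧ R T = invᵇ (⟦ u ⟧ R T)

powʷ : Word → ℕ → Word
powʷ w zero    = e
powʷ w (suc n) = powʷ w n · w

⟦powʷ⟧ : {X : Set} (R T : Bij X) (w : Word) → ∀ n x → to (⟦ powʷ w n ⟧ R T) x ≡ it (to (⟦ w ⟧ R T)) n x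
⟦powʷ⟧ R T w zero    x = refl
⟦powʷ⟧ R T w (suc n) x = cong (to (⟦ w ⟧ R T)) (⟦powʷ⟧ R T w n x)

⟦powʷ⟧⁻ : {X : Set} (R T : Bij X) (w : Word) → ∀ n x → from (⟦ powʷ w n ⟧ R T) x ≡ it (from (⟦ w ⟧ R T)) n x
⟦powʷ⟧⁻ R T w zero    x = refl
⟦powʷ⟧⁻ R T w (suc n) x =
  trans (⟦powʷ⟧⁻ R T w n _) (sym (it-shift (from (⟦ w ⟧ R T)) n x))

-- Three-cycles

record Is3 {X : Set} (f : X → X) (a b c : X) : Set where
  field
    a≢b : a ≢ b
    b≢c : b ≢ c
    a≢c : a ≢ c
    fa  : f a ≡ b
    fb  : f b ≡ c
    fc  : f c ≡ a
    fix : ∀ x → x ≢ a → x ≢ b → x ≢ c → f x ≡ x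

module _ {X : Set} where
  open Is3

  is3-rotate : ∀ {f : X → X} {a b c} → Is3 f a b c → Is3 f b c a
  is3-rotate p = record
    { a≢b = b≢c p ; b≢c = ≢-sym (a≢c p) ; a≢c = ≢-sym (a≢b p)
    ; fa = fb p ; fb = fc p ; fc = fa p ; fix = λ x u v w → fix p x w u v }

  is3-cong : ∀ {f g : X → X} {a b c} → (∀ x → f x ≡ g x) → Is3 f a b c → Is3 g a b c
  is3-cong eq p = record
    { a≢b = a≢b p ; b≢c = b≢c p ; a≢c = a≢c p
    ; fa = trans (sym (eq _)) (fa p) ; fb = trans (sym (eq _)) (fb p) ; fc = trans (sym (eq _)) (fc p)
    ; fix = λ x u v w → trans (sym (eq x)) (fix p x u v w) }

  is3-inverse : ∀ (F : Bij X) {a b c} → Is3 (to F) a b c → Is3 (from F) c b a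
  is3-inverse F {a} {b} {c} p = record
    { a≢b = ≢-sym (b≢c p) ; b≢c = ≢-sym (a≢b p) ; a≢c = ≢-sym (a≢c p)
    ; fa = back (fb p) ; fb = back (fa p) ; fc = back (fc p)
    ; fix = λ x u v w → back (fix p x w v u) }
    where
    back : ∀ {x y} → to F x ≡ y → from F y ≡ x
    back q = trans (cong (from F) (sym q)) (from-to F _)

  is3-conj : ∀ (F G : Bij X) {a b c} → Is3 (to F) a b c →
             Is3 (λ x → to G (to F (from G x))) (to G a) (to G b) (to G c)
  is3-conj F G {a} {b} {c} p = record
    { a≢b = a≢b p ∘ to-injective G ; b≢c = b≢c p ∘ to-injective G ; a≢c = a≢c p ∘ to-injective G
    ; fa = step (fa p) ; fb = step (fb p) ; fc = step (fc p)
    ; fix = λ x u v w → trans (cong (to G) (fix p _ (other u) (other v) (other w))) (to-from G x) }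
    where
    step : ∀ {x y} → to F x ≡ y → to G (to F (from G (to G x))) ≡ to G y
    step q = cong (to G) (trans (cong (to F) (from-to G _)) q)
    other : ∀ {x y} → x ≢ to G y → from G x ≢ y
    other u q = u (trans (sym (to-from G _)) (cong (to G) q))

  module _ (_≟_ : DecidableEquality X) where
    is3-unique : ∀ {f g : X → X} {a b c} → Is3 f a b c → Is3 g a b c → ∀ x → f x ≡ g x
    is3-unique {a = a} {b} {c} p q x with x ≟ a | x ≟ b | x ≟ c
    ... | yes refl | _ | _ = trans (fa p) (sym (fa q))
    ... | no _ | yes refl | _ = trans (fb p) (sym (fb q))
    ... | no _ | no _ | yes refl = trans (fc p) (sym (fc q))
    ... | no u | no v | no w = trans (fix p x u v w) (sym (fix q x u v w))

  Among : X → X → X → X → Set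
  Among a b c x = x ≡ a ⊎ x ≡ b ⊎ x ≡ c

  module _ (_≟_ : DecidableEquality X) where
    among? : ∀ a b c x → Dec (Among a b c x)
    among? a b c x with x ≟ a | x ≟ b | x ≟ c
    ... | yes p | _ | _ = yes (inj₁ p)
    ... | no _ | yes p | _ = yes (inj₂ (inj₁ p))
    ... | no _ | no _ | yes p = yes (inj₂ (inj₂ p))
    ... | no u | no v | no w = no λ { (inj₁ p) → u p ; (inj₂ (inj₁ p)) → v p ; (inj₂ (inj₂ p)) → w p }

    is3-fix : ∀ {f : X → X} {a b c} → Is3 f a b c → ∀ x → ¬ Among a b c x → f x ≡ x
    is3-fix p x u = fix p x (u ∘ inj₁) (u ∘ inj₂ ∘ inj₁) (u ∘ inj₂ ∘ inj₂)

    is3-among : ∀ {f : X → X} {a b c} → Is3 f a b c → ∀ x → Among a b c x → Among a b c (f x)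
    is3-among p x (inj₁ refl) = inj₂ (inj₁ (fa p))
    is3-among p x (inj₂ (inj₁ refl)) = inj₂ (inj₂ (fb p))
    is3-among p x (inj₂ (inj₂ refl)) = inj₁ (fc p)

    is3-moves : ∀ {f : X → X} {a b c} → Is3 f a b c → ∀ x → Among a b c x → f x ≢ x
    is3-moves p x (inj₁ refl) q = a≢b p (trans (sym q) (fa p))
    is3-moves p x (inj₂ (inj₁ refl)) q = b≢c p (trans (sym q) (fb p))
    is3-moves p x (inj₂ (inj₂ refl)) q = a≢c p (trans (sym (fc p)) q)

    is3-disjoint-commute : ∀ {f g : X → X} {a b c a′ b′ c′} → Is3 f a b c → Is3 g a′ b′ c′ →
      (∀ x → Among a b c x → ¬ Among a′ b′ c′ x) → ∀ x → f (g x) ≡ g (f x)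
    is3-disjoint-commute {f} {g} {a} {b} {c} {a′} {b′} {c′} p q d x with among? a b c x
    ... | yes u = trans (cong f (is3-fix q x (d x u))) (sym (is3-fix q (f x) (d (f x) (is3-among p x u))))
    ... | no u with among? a′ b′ c′ x
    ...   | yes v = trans (is3-fix p (g x) (λ w → d (g x) w (is3-among q x v))) (cong g (sym (is3-fix p x u)))
    ...   | no v = trans (cong f (is3-fix q x v)) (trans (is3-fix p x u) (sym (trans (cong g (is3-fix p x u)) (is3-fix q x v))))

    -- If f and g commuted, f would fix `g z`, which lies outside its support; hence `g (f z)` would
    -- equal `g z`, and f would fix z, although z is in the support.
    is3-clash : ∀ {f g : X → X} {a b c} → Is3 f a b c → (z : X) → Among a b c z → ¬ Among a b c (g z) →
      ((x y : X) → g x ≡ g y → x ≡ y) → ¬ (∀ x → f (g x) ≡ g (f x))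
    is3-clash {f} {g} p z u v inj comm = is3-moves p z u (inj (f z) z (trans (sym (comm z)) (is3-fix p (g z) v)))

-- The group generated by R and T contains every even permutation

module _ {X : Set} (_≟_ : DecidableEquality X) where
  Tr : Set
  Tr = Σ X λ a → Σ X λ b → a ≢ b

  swp : X → X → X → X
  swp a b x with x ≟ a
  ... | yes _ = b
  ... | no _ with x ≟ b
  ...   | yes _ = a
  ...   | no _ = x

  swaps : List Tr → X → X
  swaps []                 x = x
  swaps ((a , b , _) ∷ ts) x = swaps ts (swp a b x)

  swp-left : ∀ a b → swp a b a ≡ b
  swp-left a b with a ≟ a
  ... | yes _ = refl
  ... | no q = ⊥-elim (q refl)

  swp-right : ∀ a b → swp a b b ≡ a
  swp-right a b with b ≟ a
  ... | yes p = p
  ... | no _ with b ≟ b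
  ...   | yes _ = refl
  ...   | no q = ⊥-elim (q refl)

  swp-other : ∀ a b x → x ≢ a → x ≢ b → swp a b x ≡ x
  swp-other a b x u v with x ≟ a
  ... | yes p = ⊥-elim (u p)
  ... | no _ with x ≟ b
  ...   | yes p = ⊥-elim (v p)
  ...   | no _ = refl

  swp-involutive : ∀ a b x → swp a b (swp a b x) ≡ x
  swp-involutive a b x = go (x ≟ a) (x ≟ b)
    where
    go : Dec (x ≡ a) → Dec (x ≡ b) → swp a b (swp a b x) ≡ x
    go (yes refl) _ = trans (cong (swp a b) (swp-left a b)) (swp-right a b)
    go (no _) (yes refl) = trans (cong (swp a b) (swp-right a b)) (swp-left a b)
    go (no u) (no v) = trans (cong (swp a b) (swp-other a b x u v)) (swp-other a b x u v)

  swaps-++ : ∀ us vs x → swaps (us ++ vs) x ≡ swaps vs (swaps us x)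
  swaps-++ []       vs x = refl
  swaps-++ (u ∷ us) vs x = swaps-++ us vs _

  EvenF : (X → X) → Set
  EvenF f = ∃[ ts ] (Even (length ts) × (∀ x → swaps ts x ≡ f x))

module Generation {X : Set} (_≟_ : DecidableEquality X) (R T : Bij X) where

  In3 : X → X → X → Set
  In3 a b c = ∃[ w ] Is3 (to (⟦ w ⟧ R T)) a b c

  In3-rotate : ∀ {a b c} → In3 a b c → In3 b c a
  In3-rotate (w , p) = w , is3-rotate p

  In3-reverse : ∀ {a b c} → In3 a b c → In3 c b a
  In3-reverse (w , p) = inv w , is3-inverse (⟦ w ⟧ R T) p

  In3-conj : ∀ {a b c} → In3 a b c → ∀ g → let h = to (⟦ g ⟧ R T) in In3 (h a) (h b) (h c)
  In3-conj (w , p) g = (inv g · w) · g , is3-conj (⟦ w ⟧ R T) (⟦ g ⟧ R T) p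

  In3-conj′ : ∀ {a b c a′ b′ c′} → In3 a b c → ∀ g → let h = to (⟦ g ⟧ R T) in
    h a ≡ a′ → h b ≡ b′ → h c ≡ c′ → In3 a′ b′ c′
  In3-conj′ p g refl refl refl = In3-conj p g

  open Is3

  -- In the generic case, conjugating (a b z) by (b c z′) gives (a c z), and conjugating (a b z) by
  -- this gives (c b a). If z = z′, the first conjugation already gives (a c b); if z = c or z′ = a,
  -- one of the given cycles is the required one.
  In3-join : ∀ {a b c z z′} → In3 a b z → In3 b c z′ → a ≢ c → In3 a b c
  In3-join {a} {b} {c} {z} {z′} P@(w , p) Q@(v , q) a≢c′ with z ≟ c | z′ ≟ a | z ≟ z′
  ... | yes refl | _ | _ = P
  ... | no _ | yes refl | _ = In3-rotate (In3-rotate Q)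
  ... | no _ | no _ | yes refl =
    In3-rotate (In3-rotate (In3-reverse (In3-conj′ P v (fix q a (a≢b p) a≢c′ (a≢c p)) (fa q) (fc q))))
  ... | no z≢c | no z′≢a | no z≢z′ = In3-reverse (In3-conj′ P u (fa r) (fix r b (≢-sym (a≢b p)) (a≢b q) (b≢c p)) (fc r))
    where
    S : In3 a c z
    S = In3-conj′ P v (fix q a (a≢b p) a≢c′ (≢-sym z′≢a)) (fa q) (fix q z (≢-sym (b≢c p)) z≢c z≢z′)
    u = proj₁ S
    r = proj₂ S

  -- The third point of the cycle is left free. `In3-join` makes the relation transitive, and
  -- conjugation makes it invariant under the group; once there is a single class, every 3-cycle
  -- lies in the group.
  _~_ : X → X → Set
  x ~ y = x ≡ y ⊎ ∃[ z ] In3 x y z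

  ~-refl : ∀ {x} → x ~ x
  ~-refl = inj₁ refl

  ~-sym : ∀ {x y} → x ~ y → y ~ x
  ~-sym (inj₁ p) = inj₁ (sym p)
  ~-sym (inj₂ (z , p)) = inj₂ (z , In3-rotate (In3-reverse p))

  ~-trans : ∀ {x y z} → x ~ y → y ~ z → x ~ z
  ~-trans (inj₁ refl) q = q
  ~-trans (inj₂ p) (inj₁ refl) = inj₂ p
  ~-trans {x} {y} {z} (inj₂ (_ , p)) (inj₂ (_ , q)) with x ≟ z
  ... | yes eq = inj₁ eq
  ... | no ne = inj₂ (y , In3-rotate (In3-rotate (In3-reverse (In3-join p q ne))))

  ~-resp : ∀ g {x y} → x ~ y → to (⟦ g ⟧ R T) x ~ to (⟦ g ⟧ R T) y
  ~-resp g (inj₁ refl) = inj₁ refl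
  ~-resp g (inj₂ (z , p)) = inj₂ (_ , In3-conj p g)

  module _ (all~ : ∀ x y → x ~ y) where
    In3-all : ∀ a b c → a ≢ b → b ≢ c → a ≢ c → In3 a b c
    In3-all a b c u v w with all~ a b | all~ b c
    ... | inj₁ p | _ = ⊥-elim (u p)
    ... | inj₂ _ | inj₁ q = ⊥-elim (v q)
    ... | inj₂ (_ , p) | inj₂ (_ , q) = In3-join p q w

    private
      swp₂ = swp _≟_

    path3 : ∀ i j l → i ≢ j → j ≢ l → i ≢ l → Is3 (λ x → swp₂ j l (swp₂ i j x)) i l j
    path3 i j l u v w = record
      { a≢b = w ; b≢c = ≢-sym v ; a≢c = u
      ; fa = trans (cong (swp₂ j l) (swp-left _≟_ i j)) (swp-left _≟_ j l)
      ; fb = trans (cong (swp₂ j l) (swp-other _≟_ i j l (≢-sym w) (≢-sym v))) (swp-right _≟_ j l)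
      ; fc = trans (cong (swp₂ j l) (swp-right _≟_ i j)) (swp-other _≟_ j l i u w)
      ; fix = λ x a b c → trans (cong (swp₂ j l) (swp-other _≟_ i j x a c)) (swp-other _≟_ j l x c b) }

    swp-sym : ∀ a b x → swp₂ a b x ≡ swp₂ b a x
    swp-sym a b x = go (x ≟ a) (x ≟ b)
      where
      go : Dec (x ≡ a) → Dec (x ≡ b) → swp₂ a b x ≡ swp₂ b a x
      go (yes refl) _ = trans (swp-left _≟_ a b) (sym (swp-right _≟_ b a))
      go (no _) (yes refl) = trans (swp-right _≟_ a b) (sym (swp-left _≟_ b a))
      go (no u) (no v) = trans (swp-other _≟_ a b x u v) (sym (swp-other _≟_ b a x v u))

    adjacent-word : ∀ i j l → i ≢ j → j ≢ l → ∃[ w ] (∀ x → to (⟦ w ⟧ R T) x ≡ swp₂ j l (swp₂ i j x))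
    adjacent-word i j l u v with i ≟ l
    ... | yes refl = e , λ x → sym (trans (swp-sym j i _) (swp-involutive _≟_ i j x))
    ... | no w = let (g , p) = In3-all i l j w (≢-sym v) u in g , is3-unique _≟_ p (path3 i j l u v w)

    -- Two transpositions without a common point are linked by inserting (j k) twice between them.
    pair-word : ∀ i j k l → i ≢ j → k ≢ l → ∃[ w ] (∀ x → to (⟦ w ⟧ R T) x ≡ swp₂ k l (swp₂ i j x))
    pair-word i j k l u v with j ≟ k
    ... | yes refl = adjacent-word i j l u v
    ... | no ne with adjacent-word i j k u ne | adjacent-word j k l ne v
    ...   | (w₁ , p₁) | (w₂ , p₂) = w₁ · w₂ , λ x → trans (p₂ _)
            (cong (swp₂ k l) (trans (cong (swp₂ j k) (p₁ x)) (swp-involutive _≟_ j k _)))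

    even-word : ∀ ts → Even (length ts) → ∃[ w ] (∀ x → to (⟦ w ⟧ R T) x ≡ swaps _≟_ ts x)
    even-word [] ev = e , λ _ → refl
    even-word ((i , j , u) ∷ (k , l , v) ∷ ts) (even-ss ev) =
      let (w₁ , p₁) = pair-word i j k l u v
          (w₂ , p₂) = even-word ts ev
      in w₁ · w₂ , λ x → trans (p₂ _) (cong (swaps _≟_ ts) (p₁ x))

powᵇ : {X : Set} → Bij X → ℕ → Bij X
powᵇ F n = record
  { to = it (to F) n ; from = it (from F) n
  ; to-from = it-inverse (to-from F) n ; from-to = it-inverse (from-to F) n }

-- Parity

even-+ : ∀ {a b} → Even a → Even b → Even (a + b)
even-+ even-zero    q = q
even-+ (even-ss p)  q = even-ss (even-+ p q)

even-double : ∀ a → Even (a + a)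
even-double zero    = even-zero
even-double (suc a) = subst Even (cong suc (sym (+-suc a a))) (even-ss (even-double a))

prodT-++ : ∀ {k} (us vs : List (Transp k)) → prodT (us ++ vs) ≈ (prodT us ∘ₚ prodT vs)
prodT-++ []       vs i = refl
prodT-++ (u ∷ us) vs i = prodT-++ us vs _

IsEven-∘ : ∀ {k} {p q : Perm k} → IsEven p → IsEven q → IsEven (p ∘ₚ q)
IsEven-∘ {p = p} {q} (us , a , b) (vs , c , d) =
  us ++ vs , subst Even (sym (length-++ us)) (even-+ a c) ,
  λ i → trans (prodT-++ us vs i) (trans (cong (prodT vs ⟨$⟩ʳ_) (b i)) (d _))

IsEven-id : ∀ {k} → IsEven {k} idₚ
IsEven-id = [] , even-zero , λ _ → refl

mirrorT : ∀ {k} → List (Transp k) → List (Transp k)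
mirrorT []                 = []
mirrorT ((i , j , p) ∷ ts) = mirrorT ts ++ ((j , i , ≢-sym p) ∷ [])

mirrorT-length : ∀ {k} (ts : List (Transp k)) → length (mirrorT ts) ≡ length ts
mirrorT-length [] = refl
mirrorT-length (t ∷ ts) = trans (length-++ (mirrorT ts)) (trans (+-comm _ 1) (cong suc (mirrorT-length ts)))

prodT-mirror : ∀ {k} (ts : List (Transp k)) i → prodT (mirrorT ts) ⟨$⟩ʳ i ≡ prodT ts ⟨$⟩ˡ i
prodT-mirror [] i = refl
prodT-mirror ((a , b , p) ∷ ts) i =
  trans (prodT-++ (mirrorT ts) _ i) (cong (PC.transpose b a) (prodT-mirror ts i))

IsEven-flip : ∀ {k} {p : Perm k} → IsEven p → IsEven (flip p)
IsEven-flip {p = p} (ts , a , b) = mirrorT ts , subst Even (sym (mirrorT-length ts)) a , λ i →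
  trans (prodT-mirror ts i)
    (trans (sym (inverseˡ p)) (cong (p ⟨$⟩ˡ_) (trans (sym (b _)) (inverseʳ (prodT ts)))))

-- Automorphisms of the alternating group commute with the evaluation of words

module _ {k : ℕ} (r s : Perm k) (er : IsEven r) (es : IsEven s) where
  eval-even : ∀ w → IsEven (eval r s w)
  eval-even e       = IsEven-id
  eval-even gr      = er
  eval-even gs      = es
  eval-even (u · v) = IsEven-∘ {p = eval r s u} {eval r s v} (eval-even u) (eval-even v)
  eval-even (inv u) = IsEven-flip {p = eval r s u} (eval-even u)

  altʷ : Word → Alt k
  altʷ w = eval r s w , eval-even w

  module _ (a : AltAut k)
           (φr : proj₁ (AltAut.φ a (r , er)) ≈ flip r) (φs : proj₁ (AltAut.φ a (s , es)) ≈ flip s) where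
    open AltAut a

    -- The image of the identity is idempotent, and in a group only the identity is.
    φ-e : ∀ i → proj₁ (φ (altʷ e)) ⟨$⟩ʳ i ≡ i
    φ-e i = trans (sym (inverseˡ f)) (trans (cong (f ⟨$⟩ˡ_) (sym (φ-hom (altʷ e) (altʷ e) (altʷ e) (λ _ → refl) i))) (inverseˡ f))
      where f = proj₁ (φ (altʷ e))

    φ-word : ∀ w → proj₁ (φ (altʷ w)) ≈ eval (flip r) (flip s) w
    φ-word e       i = φ-e i
    φ-word gr      i = φr i
    φ-word gs      i = φs i
    φ-word (u · v) i = trans (φ-hom (altʷ u) (altʷ v) (altʷ (u · v)) (λ _ → refl) i)
      (trans (φ-word v _) (cong (eval (flip r) (flip s) v ⟨$⟩ʳ_) (φ-word u i)))
    φ-word (inv u) i = trans (sym (inverseˡ f)) (cong (f ⟨$⟩ˡ_) step)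
      where
      f = eval (flip r) (flip s) u
      step : f ⟨$⟩ʳ (proj₁ (φ (altʷ (inv u))) ⟨$⟩ʳ i) ≡ i
      step = trans (sym (φ-word u _))
        (trans (sym (φ-hom (altʷ (inv u)) (altʷ u) (altʷ e) (λ i → sym (inverseʳ (eval r s u))) i)) (φ-e i))

    -- Reflexibility is exploited through this relation alone: two words commute at (r, s) if and
    -- only if they commute at the inverse generators. The converse below uses injectivity of the
    -- automorphism.
    mirror-commute : ∀ u v → eval r s (u · v) ≈ eval r s (v · u) →
      eval (flip r) (flip s) (u · v) ≈ eval (flip r) (flip s) (v · u)
    mirror-commute u v p i = trans (sym (φ-word (u · v) i))
      (trans (φ-cong (altʷ (u · v)) (altʷ (v · u)) p i) (φ-word (v · u) i))

    mirror-commute⁻ : ∀ u v → eval (flip r) (flip s) (u · v) ≈ eval (flip r) (flip s) (v · u) →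
      eval r s (u · v) ≈ eval r s (v · u)
    mirror-commute⁻ u v p = φ-inj (altʷ (u · v)) (altʷ (v · u))
      (λ i → trans (φ-word (u · v) i) (trans (p i) (sym (φ-word (v · u) i))))

-- Interchanging the two generators

swapʷ : Word → Word
swapʷ e       = e
swapʷ gr      = gs
swapʷ gs      = gr
swapʷ (u · v) = swapʷ u · swapʷ v
swapʷ (inv u) = inv (swapʷ u)

swapʷ-eval : ∀ {k} (r s : Perm k) w → (∀ i → eval s r (swapʷ w) ⟨$⟩ʳ i ≡ eval r s w ⟨$⟩ʳ i)
                                  × (∀ i → eval s r (swapʷ w) ⟨$⟩ˡ i ≡ eval r s w ⟨$⟩ˡ i)
swapʷ-eval r s e       = (λ _ → refl) , (λ _ → refl)
swapʷ-eval r s gr      = (λ _ → refl) , (λ _ → refl)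
swapʷ-eval r s gs      = (λ _ → refl) , (λ _ → refl)
swapʷ-eval r s (u · v) =
  (λ i → trans (cong (eval s r (swapʷ v) ⟨$⟩ʳ_) (proj₁ (swapʷ-eval r s u) i)) (proj₁ (swapʷ-eval r s v) _)) ,
  (λ i → trans (cong (eval s r (swapʷ u) ⟨$⟩ˡ_) (proj₂ (swapʷ-eval r s v) i)) (proj₂ (swapʷ-eval r s u) _))
swapʷ-eval r s (inv u) = proj₂ (swapʷ-eval r s u) , proj₁ (swapʷ-eval r s u)

^ₚ-it : ∀ {k} (p : Perm k) n i → p ^ₚ n ⟨$⟩ʳ i ≡ it (p ⟨$⟩ʳ_) n i
^ₚ-it p zero    i = refl
^ₚ-it p (suc n) i = trans (^ₚ-it p n _) (sym (it-shift (p ⟨$⟩ʳ_) n i))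

-- Duality of maps, which exchanges faces and vertices. The product s r is conjugate to r s by r,
-- hence again an involution.
ChiralAltMap-sym : ∀ {k m n} → ChiralAltMap k m n → ChiralAltMap k n m
ChiralAltMap-sym {k} (r , s , ((er , es , gen) , or , os , (0<2 , rs² , rs≢)) , chi) =
  s , r , ((es , er , λ p ev → swapʷ (proj₁ (gen p ev)) , λ i →
    trans (proj₁ (swapʷ-eval r s (proj₁ (gen p ev))) i) (proj₂ (gen p ev) i)) ,
    os , or , (0<2 , sr² , sr≢)) , λ { (a , p , q) → chi (a , q , p) }
  where
  sr² : ((s ∘ₚ r) ^ₚ 2) ≈ idₚ
  sr² i = trans (cong (λ z → r ⟨$⟩ʳ (s ⟨$⟩ʳ (r ⟨$⟩ʳ (s ⟨$⟩ʳ z)))) (sym (inverseʳ r)))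
    (trans (cong (r ⟨$⟩ʳ_) (rs² (r ⟨$⟩ˡ i))) (inverseʳ r))
  sr≢ : ∀ j → 0 < j → j < 2 → ¬ ((s ∘ₚ r) ^ₚ j) ≈ idₚ
  sr≢ (suc zero) a b p = rs≢ 1 a b λ i → trans (sym (inverseˡ r)) (trans (cong (r ⟨$⟩ˡ_) (p (r ⟨$⟩ʳ i))) (inverseˡ r))
  sr≢ (suc (suc j)) a (s≤s (s≤s ())) p

-- Transport along X ↔ Fin k

decEq : {X : Set} {k : ℕ} → X ↔ Fin k → DecidableEquality X
decEq f x y = map′ (λ p → trans (sym (Inverse.strictlyInverseʳ f x)) (trans (cong (Inverse.from f) p) (Inverse.strictlyInverseʳ f y)))
  (cong (Inverse.to f)) (Inverse.to f x FinP.≟ Inverse.to f y)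

module Finite {X : Set} {k : ℕ} (fin : X ↔ Fin k) where
  enc : X → Fin k
  enc = Inverse.to fin
  dec : Fin k → X
  dec = Inverse.from fin
  enc-dec : ∀ i → enc (dec i) ≡ i
  enc-dec = Inverse.strictlyInverseˡ fin
  dec-enc : ∀ x → dec (enc x) ≡ x
  dec-enc = Inverse.strictlyInverseʳ fin

  _≟_ : DecidableEquality X
  _≟_ = decEq fin

  perm : Bij X → Perm k
  perm F = permutation (λ i → enc (to F (dec i))) (λ i → enc (from F (dec i)))
    (λ i → trans (cong (enc ∘ to F) (dec-enc _)) (trans (cong enc (to-from F _)) (enc-dec i)))
    (λ i → trans (cong (enc ∘ from F) (dec-enc _)) (trans (cong enc (from-to F _)) (enc-dec i)))

  eval-perm : ∀ A B w → (∀ i → eval (perm A) (perm B) w ⟨$⟩ʳ i ≡ enc (to (⟦ w ⟧ A B) (dec i)))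
                      × (∀ i → eval (perm A) (perm B) w ⟨$⟩ˡ i ≡ enc (from (⟦ w ⟧ A B) (dec i)))
  eval-perm A B e       = (λ i → sym (enc-dec i)) , (λ i → sym (enc-dec i))
  eval-perm A B gr      = (λ _ → refl) , (λ _ → refl)
  eval-perm A B gs      = (λ _ → refl) , (λ _ → refl)
  eval-perm A B (u · v) =
    (λ i → trans (cong (eval (perm A) (perm B) v ⟨$⟩ʳ_) (proj₁ (eval-perm A B u) i))
             (trans (proj₁ (eval-perm A B v) _) (cong (enc ∘ to (⟦ v ⟧ A B)) (dec-enc _)))) ,
    (λ i → trans (cong (eval (perm A) (perm B) u ⟨$⟩ˡ_) (proj₂ (eval-perm A B v) i))
             (trans (proj₂ (eval-perm A B u) _) (cong (enc ∘ from (⟦ u ⟧ A B)) (dec-enc _))))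
  eval-perm A B (inv u) = proj₂ (eval-perm A B u) , proj₁ (eval-perm A B u)

  enc-injective : ∀ {x y} → enc x ≡ enc y → x ≡ y
  enc-injective p = trans (sym (dec-enc _)) (trans (cong dec p) (dec-enc _))

  dec-injective : ∀ {i j} → dec i ≡ dec j → i ≡ j
  dec-injective p = trans (sym (enc-dec _)) (trans (cong enc p) (enc-dec _))

  transpose-enc : ∀ a b x → PC.transpose (enc a) (enc b) (enc x) ≡ enc (swp _≟_ a b x)
  transpose-enc a b x with enc x FinP.≟ enc a
  ... | yes _ = refl
  ... | no _ with enc x FinP.≟ enc b
  ...   | yes _ = refl
  ...   | no _ = refl

  transpose-dec : ∀ i j l → swp _≟_ (dec i) (dec j) (dec l) ≡ dec (PC.transpose i j l)
  transpose-dec i j l = enc-injective (trans (sym (transpose-enc (dec i) (dec j) (dec l)))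
    (trans (cong₃ (enc-dec i) (enc-dec j) (enc-dec l)) (sym (enc-dec _))))
    where
    cong₃ : ∀ {a b c a′ b′ c′} → a ≡ a′ → b ≡ b′ → c ≡ c′ → PC.transpose a b c ≡ PC.transpose a′ b′ c′
    cong₃ refl refl refl = refl

  encT : Tr _≟_ → Transp k
  encT (a , b , p) = enc a , enc b , p ∘ enc-injective

  decT : Transp k → Tr _≟_
  decT (i , j , p) = dec i , dec j , p ∘ dec-injective

  prodT-enc : ∀ ts x → prodT (map encT ts) ⟨$⟩ʳ enc x ≡ enc (swaps _≟_ ts x)
  prodT-enc []                 x = refl
  prodT-enc ((a , b , _) ∷ ts) x = trans (cong (prodT (map encT ts) ⟨$⟩ʳ_) (transpose-enc a b x)) (prodT-enc ts _)

  swaps-dec : ∀ ts i → swaps _≟_ (map decT ts) (dec i) ≡ dec (prodT ts ⟨$⟩ʳ i)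
  swaps-dec []                 i = refl
  swaps-dec ((a , b , _) ∷ ts) i = trans (cong (swaps _≟_ (map decT ts)) (transpose-dec a b i)) (swaps-dec ts _)

  perm-even : ∀ F → EvenF _≟_ (to F) → IsEven (perm F)
  perm-even F (ts , ev , p) = map encT ts , subst Even (sym (length-map encT ts)) ev , λ i →
    trans (cong (prodT (map encT ts) ⟨$⟩ʳ_) (sym (enc-dec i))) (trans (prodT-enc ts (dec i)) (cong enc (p (dec i))))

  perm-it : ∀ F n x → it (perm F ⟨$⟩ʳ_) n (enc x) ≡ enc (it (to F) n x)
  perm-it F zero    x = refl
  perm-it F (suc n) x = trans (cong (perm F ⟨$⟩ʳ_) (perm-it F n x)) (cong (enc ∘ to F) (dec-enc _))

  perm-order : ∀ F n → 0 < n → (∀ x → it (to F) n x ≡ x) →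
    (∃[ x ] (∀ j → 0 < j → j < n → it (to F) j x ≢ x)) → HasOrder (perm F) n
  perm-order F n 0<n p (x , q) = 0<n ,
    (λ i → trans (^ₚ-it (perm F) n i) (trans (cong (it (perm F ⟨$⟩ʳ_) n) (sym (enc-dec i)))
             (trans (perm-it F n (dec i)) (trans (cong enc (p (dec i))) (enc-dec i))))) ,
    λ j a b c → q j a b (enc-injective (trans (sym (perm-it F j x)) (trans (sym (^ₚ-it (perm F) j (enc x))) (c (enc x)))))

-- Words in r and t, read as words in r and s = t ∘ r⁻¹

trʷ : Word → Word
trʷ e       = e
trʷ gr      = gr
trʷ gs      = gr · gs
trʷ (u · v) = trʷ u · trʷ v
trʷ (inv u) = inv (trʷ u)

module _ {X : Set} (R T : Bij X) where
  trʷ-eval : ∀ w → (∀ x → to (⟦ trʷ w ⟧ R (invᵇ R ⨾ T)) x ≡ to (⟦ w ⟧ R T) x)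
                 × (∀ x → from (⟦ trʷ w ⟧ R (invᵇ R ⨾ T)) x ≡ from (⟦ w ⟧ R T) x)
  trʷ-eval e       = (λ _ → refl) , (λ _ → refl)
  trʷ-eval gr      = (λ _ → refl) , (λ _ → refl)
  trʷ-eval gs      = (λ x → cong (to T) (from-to R x)) , (λ x → from-to R _)
  trʷ-eval (u · v) =
    (λ x → trans (proj₁ (trʷ-eval v) _) (cong (to (⟦ v ⟧ R T)) (proj₁ (trʷ-eval u) x))) ,
    (λ x → trans (proj₂ (trʷ-eval u) _) (cong (from (⟦ u ⟧ R T)) (proj₂ (trʷ-eval v) x)))
  trʷ-eval (inv u) = proj₂ (trʷ-eval u) , proj₁ (trʷ-eval u)

  -- Replacing r, s by their inverses replaces r, t by r⁻¹, t up to conjugation by r.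
  trʷ-mirror : (∀ x → from T x ≡ to T x) → ∀ w →
      (∀ x → to (⟦ trʷ w ⟧ (invᵇ R) (invᵇ (invᵇ R ⨾ T))) x ≡ to R (to (⟦ w ⟧ (invᵇ R) T) (from R x)))
    × (∀ x → from (⟦ trʷ w ⟧ (invᵇ R) (invᵇ (invᵇ R ⨾ T))) x ≡ to R (from (⟦ w ⟧ (invᵇ R) T) (from R x)))
  trʷ-mirror τ e       = (λ x → sym (to-from R x)) , (λ x → sym (to-from R x))
  trʷ-mirror τ gr      = (λ x → sym (to-from R _)) , (λ x → cong (to R) (sym (to-from R x)))
  trʷ-mirror τ gs      = (λ x → cong (to R) (τ _)) , (λ x → cong (to R) (sym (τ _)))
  trʷ-mirror τ (u · v) =
    (λ x → trans (proj₁ (trʷ-mirror τ v) _) (cong (to R ∘ to (⟦ v ⟧ (invᵇ R) T))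
             (trans (cong (from R) (proj₁ (trʷ-mirror τ u) x)) (from-to R _)))) ,
    (λ x → trans (proj₂ (trʷ-mirror τ u) _) (cong (to R ∘ from (⟦ u ⟧ (invᵇ R) T))
             (trans (cong (from R) (proj₂ (trʷ-mirror τ v) x)) (from-to R _))))
  trʷ-mirror τ (inv u) = proj₂ (trʷ-mirror τ u) , proj₁ (trʷ-mirror τ u)

-- Two 3-cycles commute exactly when their supports are disjoint or equal. For (a b c) and its
-- conjugate by h, the second alternative of `Commuting` makes the two cycles identical; `Clashing`
-- finds a point of both supports whose successor in the conjugate leaves the support of (a b c).
Commuting Clashing : {X : Set} → (X → X) → X → X → X → Set
Commuting h a b c = (¬ Among a b c (h a) × ¬ Among a b c (h b) × ¬ Among a b c (h c))
                  ⊎ (h a ≡ a × h b ≡ b × h c ≡ c)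
Clashing h a b c = (Among a b c (h a) × ¬ Among a b c (h b))
                 ⊎ (Among a b c (h b) × ¬ Among a b c (h c))
                 ⊎ (Among a b c (h c) × ¬ Among a b c (h a))

module _ {X : Set} (_≟_ : DecidableEquality X) (F H : Bij X) {a b c : X} (p : Is3 (to F) a b c) where
  private
    g : X → X
    g x = to H (to F (from H x))
    q = is3-conj F H p

  commuting : Commuting (to H) a b c → ∀ x → to F (g x) ≡ g (to F x)
  commuting (inj₁ (u , v , w)) = is3-disjoint-commute _≟_ p q λ
    { x y (inj₁ refl) → u y ; x y (inj₂ (inj₁ refl)) → v y ; x y (inj₂ (inj₂ refl)) → w y }
  commuting (inj₂ (u , v , w)) x =
    trans (cong (to F) (eq x)) (sym (eq (to F x)))
    where
    eq : ∀ x → g x ≡ to F x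
    eq = is3-unique _≟_ q (subst (λ z → Is3 (to F) (to H a) z (to H c)) (sym v)
           (subst₂ (λ y z → Is3 (to F) y b z) (sym u) (sym w) p))

  clashing : Clashing (to H) a b c → ¬ (∀ x → to F (g x) ≡ g (to F x))
  clashing d = go d
    where
    ginj : ∀ x y → g x ≡ g y → x ≡ y
    ginj x y = to-injective (invᵇ H) ∘ to-injective F ∘ to-injective H
    clash : ∀ {z z′} → g z ≡ z′ → Among a b c z → ¬ Among a b c z′ → ¬ (∀ x → to F (g x) ≡ g (to F x))
    clash refl u v = is3-clash _≟_ p _ u v ginj
    go : Clashing (to H) a b c → ¬ (∀ x → to F (g x) ≡ g (to F x))
    go (inj₁ (u , v)) = clash (Is3.fa q) u v
    go (inj₂ (inj₁ (u , v))) = clash (Is3.fb q) u v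
    go (inj₂ (inj₂ (u , v))) = clash (Is3.fc q) u v

-- Sufficient conditions for a chiral map with alternating group

record Core (m n : ℕ) : Set₁ where
  field
    X    : Set
    k    : ℕ
    fin  : X ↔ Fin k
    R    : Bij X
    t    : X → X
    t-involutive : ∀ x → t (t x) ≡ x

  _≟_ : DecidableEquality X
  _≟_ = decEq fin

  r : X → X
  r = to R
  r⁻ : X → X
  r⁻ = from R
  σ : X → X
  σ = λ x → r (t x)

  field
    m>0     : 0 < m
    n>0     : 0 < n
    r-order : ∀ x → it r m x ≡ x
    r-exact : ∃[ x ] (∀ j → 0 < j → j < m → it r j x ≢ x)
    σ-order : ∀ x → it σ n x ≡ x
    σ-exact : ∃[ x ] (∀ j → 0 < j → j < n → it σ j x ≢ x)
    r-even  : EvenF _≟_ r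
    t-even  : EvenF _≟_ t
    j q     : ℕ

  τ : X → X
  τ = λ x → it r j (t (it r⁻ j x))

  field
    y₁ y₂ y₃ : X
    y₁≢y₂ : y₁ ≢ y₂
    y₂≢y₃ : y₂ ≢ y₃
    ty₁ : t y₁ ≡ y₂
    ty₃ : t y₃ ≡ y₃
    τy₁ : τ y₁ ≡ y₁
    τy₂ : τ y₂ ≡ y₃
    -- The exponent is stored in the form 1 + 3 q, so on the 3-cycle y₁, y₂, y₃ the power agrees
    -- with t τ.
    off : ∀ x → ¬ Among y₁ y₂ y₃ x → it (λ x → t (τ x)) (suc (q * 3)) x ≡ x
    -- Stating this for an arbitrary invariant equivalence relation allows it to be verified in a
    -- small base and then applied to a relation pulled back along an embedding.
    linked : ∀ (_∼_ : X → X → Set) → (∀ {x} → x ∼ x) → (∀ {x y} → x ∼ y → y ∼ x) →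
      (∀ {x y z} → x ∼ y → y ∼ z → x ∼ z) → (∀ {x y} → x ∼ y → r x ∼ r y) →
      (∀ {x y} → x ∼ y → t x ∼ t y) → y₁ ∼ y₂ → y₂ ∼ y₃ → y₁ ∼ r y₁
    connected : ∀ (P : X → Set) → (∀ x → P x → P (r x)) → (∀ x → P x → P (t x)) → P y₁ → ∀ x → P x

  ȳ : X → X
  ȳ = it r⁻ j

  T : Bij X
  T = involutionᵇ t t-involutive

  field
    H : Word
    -- In the mirror image the 3-cycle runs backwards through the points r⁻ʲ y, as `Wʷ-mirror`
    -- shows.
    chiral : (Commuting (to (⟦ H ⟧ R T)) y₁ y₂ y₃ × Clashing (to (⟦ H ⟧ (invᵇ R) T)) (ȳ y₃) (ȳ y₂) (ȳ y₁))
           ⊎ (Clashing (to (⟦ H ⟧ R T)) y₁ y₂ y₃ × Commuting (to (⟦ H ⟧ (invᵇ R) T)) (ȳ y₃) (ȳ y₂) (ȳ y₁))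

module FromCore {m n : ℕ} (C : Core m n) where
  open Core C
  open Finite fin hiding (_≟_)

  S : Bij X
  S = invᵇ R ⨾ T

  r⁻-r : ∀ x → it r⁻ j (it r j x) ≡ x
  r⁻-r = it-inverse (from-to R) j
  r-r⁻ : ∀ x → it r j (it r⁻ j x) ≡ x
  r-r⁻ = it-inverse (to-from R) j

  τ-involutive : ∀ x → τ (τ x) ≡ x
  τ-involutive x = trans (cong (it r j ∘ t) (r⁻-r _)) (trans (cong (it r j) (t-involutive _)) (r-r⁻ x))

  U : Bij X
  U = involutionᵇ τ τ-involutive ⨾ T

  K : ℕ
  K = suc (q * 3)

  u₁ : to U y₁ ≡ y₂
  u₁ = trans (cong t τy₁) ty₁
  u₂ : to U y₂ ≡ y₃
  u₂ = trans (cong t τy₂) ty₃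
  u₃ : to U y₃ ≡ y₁
  u₃ = trans (cong t (trans (cong τ (sym τy₂)) (τ-involutive y₂))) (trans (cong t (sym ty₁)) (t-involutive y₁))

  U³ : ∀ x → Among y₁ y₂ y₃ x → it (to U) 3 x ≡ x
  U³ x (inj₁ refl) = trans (cong (to U ∘ to U) u₁) (trans (cong (to U) u₂) u₃)
  U³ x (inj₂ (inj₁ refl)) = trans (cong (to U ∘ to U) u₂) (trans (cong (to U) u₃) u₁)
  U³ x (inj₂ (inj₂ refl)) = trans (cong (to U ∘ to U) u₃) (trans (cong (to U) u₁) u₂)

  W³ : Is3 (it (to U) K) y₁ y₂ y₃
  W³ = record
    { a≢b = y₁≢y₂ ; b≢c = y₂≢y₃
    ; a≢c = λ p → y₁≢y₂ (trans p (trans (sym ty₃) (trans (cong t (sym p)) ty₁)))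
    ; fa = trans (power (inj₁ refl)) u₁ ; fb = trans (power (inj₂ (inj₁ refl))) u₂ ; fc = trans (power (inj₂ (inj₂ refl))) u₃
    ; fix = λ x a b c → off x λ { (inj₁ p) → a p ; (inj₂ (inj₁ p)) → b p ; (inj₂ (inj₂ p)) → c p } }
    where
    power : ∀ {x} → Among y₁ y₂ y₃ x → it (to U) K x ≡ to U x
    power {x} p = cong (to U) (it-* (to U) q 3 x (U³ x p))

  τʷ Wʷ : Word
  τʷ = (inv (powʷ gr j) · gs) · powʷ gr j
  Wʷ = powʷ (τʷ · gs) K

  Wʷ-eval : ∀ x → to (⟦ Wʷ ⟧ R T) x ≡ it (to U) K x
  Wʷ-eval x = trans (⟦powʷ⟧ R T (τʷ · gs) K x) (it-cong (λ x → cong t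
    (trans (⟦powʷ⟧ R T gr j _) (cong (it r j ∘ t) (⟦powʷ⟧⁻ R T gr j x)))) K x)

  Wʷ-is3 : Is3 (to (⟦ Wʷ ⟧ R T)) y₁ y₂ y₃
  Wʷ-is3 = is3-cong (λ x → sym (Wʷ-eval x)) W³

  -- With r⁻¹ in place of r, the word for t τ evaluates to the conjugate of its inverse by r⁻ʲ,
  -- because t and τ are involutions.
  Wʷ-mirror : ∀ x → to (⟦ Wʷ ⟧ (invᵇ R) T) x ≡ it r⁻ j (it (from U) K (it r j x))
  Wʷ-mirror x = trans (⟦powʷ⟧ (invᵇ R) T (τʷ · gs) K x) (trans (it-cong (λ x → cong t
    (trans (⟦powʷ⟧ (invᵇ R) T gr j _) (cong (it r⁻ j ∘ t) (⟦powʷ⟧⁻ (invᵇ R) T gr j x)))) K x) (go K x))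
    where
    go : ∀ a x → it (λ x → t (it r⁻ j (t (it r j x)))) a x ≡ it r⁻ j (it (from U) a (it r j x))
    go zero x = sym (r⁻-r x)
    go (suc a) x = trans (cong (λ z → t (it r⁻ j (t (it r j z)))) (go a x))
      (trans (cong (λ z → t (it r⁻ j (t z))) (r-r⁻ _)) (sym (r⁻-r _)))

  Wʷ-mirror-is3 : Is3 (to (⟦ Wʷ ⟧ (invᵇ R) T)) (ȳ y₃) (ȳ y₂) (ȳ y₁)
  Wʷ-mirror-is3 = is3-cong (λ x → sym (Wʷ-mirror x))
    (is3-conj (invᵇ (powᵇ U K)) (powᵇ (invᵇ R) j) (is3-inverse (powᵇ U K) W³))

  open Generation _≟_ R T

  -- The class of y₁ is closed under r, since y₁ ~ x implies r y₁ ~ r x and y₁ ~ r y₁ by `linked`;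
  -- it is closed under t since t y₁ = y₂ ~ y₁. By transitivity of the action it contains every
  -- point.
  all~ : ∀ x y → x ~ y
  all~ x y = ~-trans (~-sym (reach x)) (reach y)
    where
    y₁~y₂ : y₁ ~ y₂
    y₁~y₂ = inj₂ (y₃ , Wʷ , Wʷ-is3)
    y₂~y₃ : y₂ ~ y₃
    y₂~y₃ = inj₂ (y₁ , Wʷ , is3-rotate Wʷ-is3)
    step : y₁ ~ r y₁
    step = linked _~_ ~-refl ~-sym ~-trans (~-resp gr) (~-resp gs) y₁~y₂ y₂~y₃
    reach : ∀ x → y₁ ~ x
    reach = connected (y₁ ~_) (λ x p → ~-trans step (~-resp gr p))
      (λ x p → ~-trans y₁~y₂ (subst (_~ t x) ty₁ (~-resp gs p))) ~-refl

  generates : ∀ p → IsEven p → ∃[ w ] (eval (perm R) (perm S) w ≈ p)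
  generates p (ts , ev , q) =
    let (w , f) = even-word all~ (map decT ts) (subst Even (sym (length-map decT ts)) ev) in
    trʷ w , λ i → trans (proj₁ (eval-perm R S (trʷ w)) i) (trans (cong enc (trans (proj₁ (trʷ-eval R T w) _)
      (trans (f (dec i)) (swaps-dec ts i)))) (trans (enc-dec _) (q i)))

  s-order : ∀ x → it (to S) n x ≡ x
  s-order x = trans (cong (it (to S) n) (sym (σ-order x))) (it-inverse (λ x → trans (cong t (from-to R _)) (t-involutive x)) n x)

  s-exact : ∃[ x ] (∀ j → 0 < j → j < n → it (to S) j x ≢ x)
  s-exact = proj₁ σ-exact , λ j a b p → proj₂ σ-exact j a b (trans (cong (it σ j) (sym p))
    (it-inverse (λ x → trans (cong r (t-involutive _)) (to-from R x)) j _))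

  r-evenₚ : IsEven (perm R)
  r-evenₚ = perm-even R r-even

  s-evenₚ : IsEven (perm S)
  s-evenₚ = let (us , a , b) = IsEven-∘ {p = flip (perm R)} {perm T} (IsEven-flip {p = perm R} r-evenₚ) (perm-even T t-even)
    in us , a , λ i → trans (b i) (cong (enc ∘ t) (dec-enc _))

  rs-order : HasOrder (perm R ∘ₚ perm S) 2
  rs-order = s≤s z≤n , (λ i → trans (rs _) (trans (cong (enc ∘ t) (trans (cong dec (rs i)) (dec-enc _)))
               (trans (cong enc (t-involutive _)) (enc-dec i)))) ,
    λ { (suc zero) a b p → y₁≢y₂ (sym (trans (sym ty₁) (trans (cong t (sym (dec-enc y₁)))
          (enc-injective (trans (sym (rs (enc y₁))) (p (enc y₁)))))))
      ; (suc (suc j)) a (s≤s (s≤s ())) p }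
    where
    rs : ∀ i → (perm R ∘ₚ perm S) ⟨$⟩ʳ i ≡ enc (t (dec i))
    rs i = cong (enc ∘ t) (trans (cong r⁻ (dec-enc _)) (from-to R _))

  -- The conjugate of the 3-cycle by H. A reflection would make it commute with `Wʷ` either both in
  -- the map and in its mirror image or in neither.
  Gʷ : Word
  Gʷ = (inv H · Wʷ) · H

  commute-from : ∀ {A B : Bij X} u v → eval (perm A) (perm B) (u · v) ≈ eval (perm A) (perm B) (v · u) →
    ∀ x → to (⟦ v ⟧ A B) (to (⟦ u ⟧ A B) x) ≡ to (⟦ u ⟧ A B) (to (⟦ v ⟧ A B) x)
  commute-from {A} {B} u v p x = subst (λ z → to (⟦ v ⟧ A B) (to (⟦ u ⟧ A B) z) ≡ to (⟦ u ⟧ A B) (to (⟦ v ⟧ A B) z)) (dec-enc x)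
    (enc-injective (trans (sym (proj₁ (eval-perm A B (u · v)) (enc x))) (trans (p (enc x)) (proj₁ (eval-perm A B (v · u)) (enc x)))))

  commute-to : ∀ {A B : Bij X} u v →
    (∀ x → to (⟦ v ⟧ A B) (to (⟦ u ⟧ A B) x) ≡ to (⟦ u ⟧ A B) (to (⟦ v ⟧ A B) x)) →
    eval (perm A) (perm B) (u · v) ≈ eval (perm A) (perm B) (v · u)
  commute-to {A} {B} u v p i = trans (proj₁ (eval-perm A B (u · v)) i) (trans (cong enc (p _)) (sym (proj₁ (eval-perm A B (v · u)) i)))

  WG : Word → Bij X → Bij X → Set
  WG g A B = ∀ x → to (⟦ Wʷ ⟧ A B) (to (⟦ g ⟧ A B) x) ≡ to (⟦ g ⟧ A B) (to (⟦ Wʷ ⟧ A B) x)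

  down : (∀ x → to (⟦ trʷ Wʷ ⟧ R S) (to (⟦ trʷ Gʷ ⟧ R S) x) ≡ to (⟦ trʷ Gʷ ⟧ R S) (to (⟦ trʷ Wʷ ⟧ R S) x)) → WG Gʷ R T
  down p x = trans (sym (proj₁ (trʷ-eval R T (Gʷ · Wʷ)) x)) (trans (p x) (proj₁ (trʷ-eval R T (Wʷ · Gʷ)) x))

  up : WG Gʷ R T → ∀ x → to (⟦ trʷ Wʷ ⟧ R S) (to (⟦ trʷ Gʷ ⟧ R S) x) ≡ to (⟦ trʷ Gʷ ⟧ R S) (to (⟦ trʷ Wʷ ⟧ R S) x)
  up p x = trans (proj₁ (trʷ-eval R T (Gʷ · Wʷ)) x) (trans (p x) (sym (proj₁ (trʷ-eval R T (Wʷ · Gʷ)) x)))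

  R̄ S̄ : Bij X
  R̄ = invᵇ R
  S̄ = invᵇ S

  down̄ : (∀ x → to (⟦ trʷ Wʷ ⟧ R̄ S̄) (to (⟦ trʷ Gʷ ⟧ R̄ S̄) x) ≡ to (⟦ trʷ Gʷ ⟧ R̄ S̄) (to (⟦ trʷ Wʷ ⟧ R̄ S̄) x)) → WG Gʷ R̄ T
  down̄ p x = subst (λ z → to (⟦ Wʷ ⟧ R̄ T) (to (⟦ Gʷ ⟧ R̄ T) z) ≡ to (⟦ Gʷ ⟧ R̄ T) (to (⟦ Wʷ ⟧ R̄ T) z)) (from-to R x)
    (to-injective R (trans (sym (proj₁ (trʷ-mirror R T (λ _ → refl) (Gʷ · Wʷ)) (r x)))
      (trans (p (r x)) (proj₁ (trʷ-mirror R T (λ _ → refl) (Wʷ · Gʷ)) (r x)))))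

  up̄ : WG Gʷ R̄ T → ∀ x → to (⟦ trʷ Wʷ ⟧ R̄ S̄) (to (⟦ trʷ Gʷ ⟧ R̄ S̄) x) ≡ to (⟦ trʷ Gʷ ⟧ R̄ S̄) (to (⟦ trʷ Wʷ ⟧ R̄ S̄) x)
  up̄ p x = trans (proj₁ (trʷ-mirror R T (λ _ → refl) (Gʷ · Wʷ)) x)
    (trans (cong r (p _)) (sym (proj₁ (trʷ-mirror R T (λ _ → refl) (Wʷ · Gʷ)) x)))

  not-reflexible : ∀ er es → ¬ Reflexible (perm R) (perm S) er es
  not-reflexible er es (a , φr , φs) with chiral
  ... | inj₁ (c , d) = clashing _≟_ (⟦ Wʷ ⟧ R̄ T) (⟦ H ⟧ R̄ T) Wʷ-mirror-is3 d
    (down̄ (commute-from {R̄} {S̄} (trʷ Gʷ) (trʷ Wʷ) (mirror-commute (perm R) (perm S) er es a φr φs (trʷ Gʷ) (trʷ Wʷ)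
      (commute-to {R} {S} (trʷ Gʷ) (trʷ Wʷ) (up (commuting _≟_ (⟦ Wʷ ⟧ R T) (⟦ H ⟧ R T) Wʷ-is3 c))))))
  ... | inj₂ (d , c) = clashing _≟_ (⟦ Wʷ ⟧ R T) (⟦ H ⟧ R T) Wʷ-is3 d
    (down (commute-from {R} {S} (trʷ Gʷ) (trʷ Wʷ) (mirror-commute⁻ (perm R) (perm S) er es a φr φs (trʷ Gʷ) (trʷ Wʷ)
      (commute-to {R̄} {S̄} (trʷ Gʷ) (trʷ Wʷ) (up̄ (commuting _≟_ (⟦ Wʷ ⟧ R̄ T) (⟦ H ⟧ R̄ T) Wʷ-mirror-is3 c))))))

  chiralAltMap : ChiralAltMap k m n
  chiralAltMap = perm R , perm S ,
    ((r-evenₚ , s-evenₚ , generates) ,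
     perm-order R m m>0 r-order r-exact , perm-order S n n>0 s-order s-exact , rs-order) ,
    not-reflexible r-evenₚ s-evenₚ

-- Every bijection of a finite set is a product of transpositions

cleanT : ∀ {k} → TL.TranspositionList k → List (Transp k)
cleanT [] = []
cleanT ((i , j) ∷ xs) with i FinP.≟ j
... | yes _ = cleanT xs
... | no ne = (i , j , ne) ∷ cleanT xs

transpose-same : ∀ {k} (i l : Fin k) → PC.transpose i i l ≡ l
transpose-same i l with l FinP.≟ i
... | yes p = sym p
... | no ne with l FinP.≟ i
...   | yes p = ⊥-elim (ne p)
...   | no _ = refl

cleanT-eval : ∀ {k} (xs : TL.TranspositionList k) i → prodT (cleanT xs) ⟨$⟩ʳ i ≡ TL.eval xs ⟨$⟩ʳ i
cleanT-eval [] i = refl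
cleanT-eval ((a , b) ∷ xs) i with a FinP.≟ b
... | yes refl = trans (cleanT-eval xs i) (cong (TL.eval xs ⟨$⟩ʳ_) (sym (transpose-same a i)))
... | no ne = cleanT-eval xs _

module _ {X : Set} {k : ℕ} (fin : X ↔ Fin k) where
  open Finite fin

  abstract
    -- The number of transpositions is left unspecified: wherever this is applied, the list is used
    -- once in each of two copies, so the total is even.
    swapsOf : (F : Bij X) → ∃[ ts ] (∀ x → swaps _≟_ ts x ≡ to F x)
    swapsOf F = map decT us , λ x → trans (cong (swaps _≟_ (map decT us)) (sym (dec-enc x)))
      (trans (swaps-dec us (enc x)) (trans (cong dec (trans (cleanT-eval (TL.decompose (perm F)) (enc x))
        (TL.eval-decompose (perm F) (enc x)))) (trans (dec-enc _) (cong (to F) (dec-enc x)))))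
      where
      us : List (Transp k)
      us = cleanT (TL.decompose (perm F))

module _ {X Y : Set} (_≟_ : DecidableEquality X) (_≟′_ : DecidableEquality Y)
         (f : X → Y) (f-inj : ∀ {x y} → f x ≡ f y → x ≡ y) where
  mapTr : Tr _≟_ → Tr _≟′_
  mapTr (a , b , p) = f a , f b , p ∘ f-inj

  swp-map : ∀ a b x → swp _≟′_ (f a) (f b) (f x) ≡ f (swp _≟_ a b x)
  swp-map a b x with x ≟ a
  ... | yes refl = swp-left _≟′_ (f a) (f b)
  ... | no u with x ≟ b
  ...   | yes refl = swp-right _≟′_ (f a) (f b)
  ...   | no v = swp-other _≟′_ (f a) (f b) (f x) (u ∘ f-inj) (v ∘ f-inj)

  swaps-map : ∀ ts x → swaps _≟′_ (map mapTr ts) (f x) ≡ f (swaps _≟_ ts x)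
  swaps-map []                 x = refl
  swaps-map ((a , b , _) ∷ ts) x = trans (cong (swaps _≟′_ (map mapTr ts)) (swp-map a b x)) (swaps-map ts _)

  swaps-map-fix : ∀ ts y → (∀ x → y ≢ f x) → swaps _≟′_ (map mapTr ts) y ≡ y
  swaps-map-fix []                 y u = refl
  swaps-map-fix ((a , b , _) ∷ ts) y u =
    trans (cong (swaps _≟′_ (map mapTr ts)) (swp-other _≟′_ (f a) (f b) y (u a) (u b))) (swaps-map-fix ts y u)

-- Permutation pairs (r, t)

record Frame : Set₁ where
  field
    X   : Set
    k   : ℕ
    fin : X ↔ Fin k
    R   : Bij X
    t   : X → X
    t-involutive : ∀ x → t (t x) ≡ x

  _≟_ : DecidableEquality X
  _≟_ = decEq fin
  r r⁻ σ : X → X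
  r = to R
  r⁻ = from R
  σ x = r (t x)
  T : Bij X
  T = involutionᵇ t t-involutive
  τ : ℕ → X → X
  τ j x = it r j (t (it r⁻ j x))

  t-injective : ∀ {x y} → t x ≡ t y → x ≡ y
  t-injective = to-injective T
  σ-injective : ∀ {x y} → σ x ≡ σ y → x ≡ y
  σ-injective = t-injective ∘ to-injective R

data Move : Set where
  fw bw fl : Move

module _ {X : Set} (r r⁻ t : X → X) where
  run : List Move → X → X
  run []       x = x
  run (fw ∷ p) x = run p (r x)
  run (bw ∷ p) x = run p (r⁻ x)
  run (fl ∷ p) x = run p (t x)

  -- Gluing changes t at the ports and nothing else on the old points, so a path survives it as long
  -- as it never applies t at a port.
  Safe : (X → Set) → List Move → X → Set
  Safe Port []       x = ⊤
  Safe Port (fw ∷ p) x = Safe Port p (r x)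
  Safe Port (bw ∷ p) x = Safe Port p (r⁻ x)
  Safe Port (fl ∷ p) x = ¬ Port x × Safe Port p (t x)

wordOf : List Move → Word
wordOf []       = e
wordOf (fw ∷ p) = gr · wordOf p
wordOf (bw ∷ p) = inv gr · wordOf p
wordOf (fl ∷ p) = gs · wordOf p

wordOf-run : {X : Set} (R T : Bij X) → ∀ p x → to (⟦ wordOf p ⟧ R T) x ≡ run (to R) (from R) (to T) p x
wordOf-run R T []       x = refl
wordOf-run R T (fw ∷ p) x = wordOf-run R T p _
wordOf-run R T (bw ∷ p) x = wordOf-run R T p _
wordOf-run R T (fl ∷ p) x = wordOf-run R T p _

-- The part of the hypotheses of Core that only concerns finitely many points; it survives any change of t at the ports.

record Local (B : Frame) (Port : Frame.X B → Set) : Set₁ where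
  open Frame B
  field
    j q : ℕ
    y₁ y₂ y₃ : X
    y₁≢y₂ : y₁ ≢ y₂
    y₂≢y₃ : y₂ ≢ y₃
    ty₁ : t y₁ ≡ y₂
    ty₃ : t y₃ ≡ y₃
    τy₁ : τ j y₁ ≡ y₁
    τy₂ : τ j y₂ ≡ y₃
    y-safe : ∀ x → Among y₁ y₂ y₃ x → ¬ Port x × ¬ Port (it r⁻ j x)
    linked : ∀ (_∼_ : X → X → Set) → (∀ {x} → x ∼ x) → (∀ {x y} → x ∼ y → y ∼ x) →
      (∀ {x y z} → x ∼ y → y ∼ z → x ∼ z) → (∀ {x y} → x ∼ y → r x ∼ r y) →
      (∀ {x y} → ¬ Port x → ¬ Port y → x ∼ y → t x ∼ t y) → y₁ ∼ y₂ → y₂ ∼ y₃ → y₁ ∼ r y₁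
    path : List Move
    path-safe : ∀ x → Among y₁ y₂ y₃ x → Safe r r⁻ t Port path x × Safe r⁻ r t Port path (it r⁻ j x)
    chiral : (Commuting (run r r⁻ t path) y₁ y₂ y₃ × Clashing (run r⁻ r t path) (it r⁻ j y₃) (it r⁻ j y₂) (it r⁻ j y₁))
           ⊎ (Clashing (run r r⁻ t path) y₁ y₂ y₃ × Commuting (run r⁻ r t path) (it r⁻ j y₃) (it r⁻ j y₂) (it r⁻ j y₁))

-- Gluing adds whole cycles of r, hence the compatibility with r everywhere; t may have been
-- redirected into a tile at a port.
record Extension (B : Frame) (Port : Frame.X B → Set) (F : Frame) : Set where
  private
    module B = Frame B
    module F = Frame F
  field
    inj : B.X → F.X
    inj-injective : ∀ {x y} → inj x ≡ inj y → x ≡ y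
    inj-r : ∀ x → F.r (inj x) ≡ inj (B.r x)
    inj-t : ∀ x → ¬ Port x → F.t (inj x) ≡ inj (B.t x)

  inj-r⁻ : ∀ x → F.r⁻ (inj x) ≡ inj (B.r⁻ x)
  inj-r⁻ x = trans (cong F.r⁻ (trans (cong inj (sym (to-from B.R x))) (sym (inj-r _)))) (from-to F.R _)

module _ {X Y : Set} (inj : X → Y) {f : X → X} {g : Y → Y} (comm : ∀ x → g (inj x) ≡ inj (f x)) where
  it-inj : ∀ n x → it g n (inj x) ≡ inj (it f n x)
  it-inj zero    x = refl
  it-inj (suc n) x = trans (cong g (it-inj n x)) (comm _)

module Transfer {B : Frame} {Port : Frame.X B → Set} {F : Frame} (L : Local B Port) (E : Extension B Port F) where
  private
    module B = Frame B
    module F = Frame F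
  open Local L
  open Extension E

  inj-rʲ : ∀ x → it F.r j (inj x) ≡ inj (it B.r j x)
  inj-rʲ = it-inj inj inj-r j
  inj-r⁻ʲ : ∀ x → it F.r⁻ j (inj x) ≡ inj (it B.r⁻ j x)
  inj-r⁻ʲ = it-inj inj inj-r⁻ j

  inj-τ : ∀ x → ¬ Port (it B.r⁻ j x) → F.τ j (inj x) ≡ inj (B.τ j x)
  inj-τ x u = trans (cong (it F.r j ∘ F.t) (inj-r⁻ʲ x)) (trans (cong (it F.r j) (inj-t _ u)) (inj-rʲ _))

  run-inj : ∀ {f g f′ g′} → (∀ x → f′ (inj x) ≡ inj (f x)) → (∀ x → g′ (inj x) ≡ inj (g x)) →
    ∀ p x → Safe f g B.t Port p x → run f′ g′ F.t p (inj x) ≡ inj (run f g B.t p x)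
  run-inj u v []       x s = refl
  run-inj {f′ = f′} {g′} u v (fw ∷ p) x s = trans (cong (run f′ g′ F.t p) (u x)) (run-inj u v p _ s)
  run-inj {f′ = f′} {g′} u v (bw ∷ p) x s = trans (cong (run f′ g′ F.t p) (v x)) (run-inj u v p _ s)
  run-inj {f′ = f′} {g′} u v (fl ∷ p) x (s , s′) = trans (cong (run f′ g′ F.t p) (inj-t x s)) (run-inj u v p _ s′)

  module _ {a b c : B.X} (f : B.X → B.X) (g : F.X → F.X)
           (ga : g (inj a) ≡ inj (f a)) (gb : g (inj b) ≡ inj (f b)) (gc : g (inj c) ≡ inj (f c)) where
    private
      among⁺ : ∀ {x} → Among a b c x → Among (inj a) (inj b) (inj c) (inj x)
      among⁺ (inj₁ p) = inj₁ (cong inj p)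
      among⁺ (inj₂ (inj₁ p)) = inj₂ (inj₁ (cong inj p))
      among⁺ (inj₂ (inj₂ p)) = inj₂ (inj₂ (cong inj p))
      among⁻ : ∀ {x} → Among (inj a) (inj b) (inj c) (inj x) → Among a b c x
      among⁻ (inj₁ p) = inj₁ (inj-injective p)
      among⁻ (inj₂ (inj₁ p)) = inj₂ (inj₁ (inj-injective p))
      among⁻ (inj₂ (inj₂ p)) = inj₂ (inj₂ (inj-injective p))
      in⁺ : ∀ {x} → g (inj x) ≡ inj (f x) → Among a b c (f x) → Among (inj a) (inj b) (inj c) (g (inj x))
      in⁺ q p = subst (Among _ _ _) (sym q) (among⁺ p)
      out⁺ : ∀ {x} → g (inj x) ≡ inj (f x) → ¬ Among a b c (f x) → ¬ Among (inj a) (inj b) (inj c) (g (inj x))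
      out⁺ q u p = u (among⁻ (subst (Among _ _ _) q p))

    Commuting⁺ : Commuting f a b c → Commuting g (inj a) (inj b) (inj c)
    Commuting⁺ (inj₁ (u , v , w)) = inj₁ (out⁺ ga u , out⁺ gb v , out⁺ gc w)
    Commuting⁺ (inj₂ (u , v , w)) = inj₂ (trans ga (cong inj u) , trans gb (cong inj v) , trans gc (cong inj w))

    Clashing⁺ : Clashing f a b c → Clashing g (inj a) (inj b) (inj c)
    Clashing⁺ (inj₁ (u , v)) = inj₁ (in⁺ ga u , out⁺ gb v)
    Clashing⁺ (inj₂ (inj₁ (u , v))) = inj₂ (inj₁ (in⁺ gb u , out⁺ gc v))
    Clashing⁺ (inj₂ (inj₂ (u , v))) = inj₂ (inj₂ (in⁺ gc u , out⁺ ga v))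

  Y : F.X → Set
  Y = Among (inj y₁) (inj y₂) (inj y₃)

  core : ∀ {m n} → 0 < m → 0 < n → (∀ x → it F.r m x ≡ x) → ∃[ x ] (∀ i → 0 < i → i < m → it F.r i x ≢ x) →
    (∀ x → it F.σ n x ≡ x) → ∃[ x ] (∀ i → 0 < i → i < n → it F.σ i x ≢ x) →
    EvenF F._≟_ F.r → EvenF F._≟_ F.t → (∀ x → ¬ Y x → it (λ x → F.t (F.τ j x)) (suc (q * 3)) x ≡ x) →
    (∀ (P : F.X → Set) → (∀ x → P x → P (F.r x)) → (∀ x → P x → P (F.t x)) → P (inj y₁) → ∀ x → P x) →
    Core m n
  core a b c d f g re te o co = record
    { X = F.X ; k = F.k ; fin = F.fin ; R = F.R ; t = F.t ; t-involutive = F.t-involutive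
    ; m>0 = a ; n>0 = b ; r-order = c ; r-exact = d ; σ-order = f ; σ-exact = g ; r-even = re ; t-even = te
    ; j = j ; q = q ; y₁ = inj y₁ ; y₂ = inj y₂ ; y₃ = inj y₃
    ; y₁≢y₂ = y₁≢y₂ ∘ inj-injective ; y₂≢y₃ = y₂≢y₃ ∘ inj-injective
    ; ty₁ = trans (inj-t y₁ (proj₁ (y-safe y₁ Y₁))) (cong inj ty₁)
    ; ty₃ = trans (inj-t y₃ (proj₁ (y-safe y₃ Y₃))) (cong inj ty₃)
    ; τy₁ = trans (inj-τ y₁ (proj₂ (y-safe y₁ Y₁))) (cong inj τy₁)
    ; τy₂ = trans (inj-τ y₂ (proj₂ (y-safe y₂ Y₂))) (cong inj τy₂)
    ; off = o
    -- The hypothesis of the base is applied to the pullback of the relation along `inj`.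
    ; linked = λ _∼_ rf sy tr rr tt p q → subst (inj y₁ ∼_) (sym (inj-r y₁))
        (linked (λ x y → inj x ∼ inj y) rf sy tr
          (λ {x} {y} u → subst₂ _∼_ (inj-r x) (inj-r y) (rr u))
          (λ {x} {y} v w u → subst₂ _∼_ (inj-t x v) (inj-t y w) (tt u)) p q)
    ; connected = co
    ; H = wordOf path
    ; chiral = ch chiral }
    where
    Y₁ : Among y₁ y₂ y₃ y₁
    Y₁ = inj₁ refl
    Y₂ : Among y₁ y₂ y₃ y₂
    Y₂ = inj₂ (inj₁ refl)
    Y₃ : Among y₁ y₂ y₃ y₃
    Y₃ = inj₂ (inj₂ refl)
    h = to (⟦ wordOf path ⟧ F.R F.T)
    h̄ = to (⟦ wordOf path ⟧ (invᵇ F.R) F.T)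
    g₁ = run B.r B.r⁻ B.t path
    g₂ = run B.r⁻ B.r B.t path
    hi : ∀ y → Among y₁ y₂ y₃ y → h (inj y) ≡ inj (run B.r B.r⁻ B.t path y)
    hi y p = trans (wordOf-run F.R F.T path (inj y)) (run-inj inj-r inj-r⁻ path y (proj₁ (path-safe y p)))
    h̄i : ∀ y → Among y₁ y₂ y₃ y → h̄ (inj (it B.r⁻ j y)) ≡ inj (run B.r⁻ B.r B.t path (it B.r⁻ j y))
    h̄i y p = trans (wordOf-run (invᵇ F.R) F.T path _) (run-inj inj-r⁻ inj-r path _ (proj₂ (path-safe y p)))
    back : ∀ {G : F.X → F.X → F.X → Set} → G (inj (it B.r⁻ j y₃)) (inj (it B.r⁻ j y₂)) (inj (it B.r⁻ j y₁)) →
      G (it F.r⁻ j (inj y₃)) (it F.r⁻ j (inj y₂)) (it F.r⁻ j (inj y₁))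
    back {G} p = subst (λ z → G z (it F.r⁻ j (inj y₂)) (it F.r⁻ j (inj y₁))) (sym (inj-r⁻ʲ y₃)) (subst₂ (G _) (sym (inj-r⁻ʲ y₂)) (sym (inj-r⁻ʲ y₁)) p)
    ch : _ ⊎ _ → _ ⊎ _
    ch (inj₁ (u , v)) = inj₁ (Commuting⁺ g₁ h (hi y₁ Y₁) (hi y₂ Y₂) (hi y₃ Y₃) u ,
      back {Clashing h̄} (Clashing⁺ g₂ h̄ (h̄i y₃ Y₃) (h̄i y₂ Y₂) (h̄i y₁ Y₁) v))
    ch (inj₂ (u , v)) = inj₂ (Clashing⁺ g₁ h (hi y₁ Y₁) (hi y₂ Y₂) (hi y₃ Y₃) u ,
      back {Commuting h̄} (Commuting⁺ g₂ h̄ (h̄i y₃ Y₃) (h̄i y₂ Y₂) (h̄i y₁ Y₁) v))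

-- A state is an extension of a base frame whose two ports α lie on the two long cycles of σ = r t.

record State (m n : ℕ) : Set₁ where
  field
    B  : Frame
    αᴮ : Bool → Frame.X B

  Port : Frame.X B → Set
  Port = λ x → ∃[ b ] x ≡ αᴮ b

  field
    L : Local B Port
    F : Frame
    E : Extension B Port F

  open Frame F
  open Local L using (j; q; y₁; y₂; y₃)
  open Extension E using (inj)

  Y : X → Set
  Y = Among (inj y₁) (inj y₂) (inj y₃)
  u : X → X
  u = λ x → t (τ j x)

  field
    m>0     : 0 < m
    r-order : ∀ x → it r m x ≡ x
    r-exact : ∃[ x ] (∀ i → 0 < i → i < m → it r i x ≢ x)
    r-even  : EvenF _≟_ r
    t-even  : EvenF _≟_ t
    -- The current ports move on to the most recent tiles, while `αᴮ` keeps the original ones, which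
    -- is where the local data must not be touched.
    α       : Bool → X
    α-port  : ∀ x → ¬ Port x → ∀ b → inj x ≢ α b
    α-sep   : α false ≢ α true
    tα      : ∀ b → t (α b) ≡ α b
    n>1     : 1 < n
    cycle   : ∀ b → it σ n (α b) ≡ α b
    -- For b = b′ this gives the exact cycle length n; for b ≠ b′ it says that the two cycles are
    -- different.
    minimal : ∀ b b′ i → 0 < i → i < n → it σ i (α b) ≢ α b′
    cover   : ∀ x → σ x ≡ x ⊎ ∃[ b ] ∃[ i ] it σ i (α b) ≡ x
    off     : ∀ x → ¬ Y x → it u (suc (q * 3)) x ≡ x
    connected : ∀ (P : X → Set) → (∀ x → P x → P (r x)) → (∀ x → P x → P (t x)) → P (inj y₁) → ∀ x → P x

  toCore : Core m n
  toCore = Transfer.core L E m>0 (≤-trans (s≤s z≤n) n>1) r-order r-exact σ-order (α false , λ i a b → minimal false false i a b)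
    r-even t-even off connected
    where
    fixed : ∀ i x → σ x ≡ x → it σ i x ≡ x
    fixed zero x p = refl
    fixed (suc i) x p = trans (cong σ (fixed i x p)) p
    σ-order : ∀ x → it σ n x ≡ x
    σ-order x with cover x
    ... | inj₁ p = fixed n x p
    ... | inj₂ (b , i , refl) = trans (it-comm σ n i (α b)) (cong (it σ i) (cycle b))

-- Tiles and gluing

record Tile (m c : ℕ) : Set₁ where
  field
    F : Frame
  open Frame F
  field
    r-order : ∀ x → it r m x ≡ x
    g₀      : X
    tg₀     : t g₀ ≡ g₀
    c>0     : 0 < c
    cycle   : it σ c g₀ ≡ g₀
    minimal : ∀ i → 0 < i → i < c → it σ i g₀ ≢ g₀
    -- A fixed point of σ other than `g₀` remains fixed after gluing, since t is redirected only at
    -- `g₀`.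
    cover   : ∀ x → (σ x ≡ x × x ≢ g₀) ⊎ ∃[ i ] it σ i g₀ ≡ x
    connected : ∀ (P : X → Set) → (∀ x → P x → P (r x)) → (∀ x → P x → P (t x)) → P g₀ → ∀ x → P x
    p       : ℕ
    p>0     : 0 < p
    p<c     : p < c

  exit : X
  exit = it σ p g₀

module Glue {m n c : ℕ} (S : State m n) (M : Tile m c) where
  module S = State S
  module M = Tile M
  module F = Frame S.F
  module Z = Frame M.F
  open S using (α)
  open M using (g₀)

  X : Set
  X = F.X ⊎ (Bool × Z.X)

  abstract
   fin : X ↔ Fin (F.k + 2 * Z.k)
   fin = (F.fin ⊎-↔ ((↔-sym FinP.2↔Bool ×-↔ Z.fin) ∘↔ ↔-sym FinP.*↔×)) ∘↔ ↔-sym FinP.+↔⊎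
     where
     infixl 1 _∘↔_
     _∘↔_ : ∀ {A B C : Set} → A ↔ B → B ↔ C → A ↔ C
     f ∘↔ g = g ↔-∘ f

  R : Bij X
  R = record
    { to = λ { (inj₁ x) → inj₁ (F.r x) ; (inj₂ (b , z)) → inj₂ (b , Z.r z) }
    ; from = λ { (inj₁ x) → inj₁ (F.r⁻ x) ; (inj₂ (b , z)) → inj₂ (b , Z.r⁻ z) }
    ; to-from = λ { (inj₁ x) → cong inj₁ (to-from F.R x) ; (inj₂ (b , z)) → cong (λ z → inj₂ (b , z)) (to-from Z.R z) }
    ; from-to = λ { (inj₁ x) → cong inj₁ (from-to F.R x) ; (inj₂ (b , z)) → cong (λ z → inj₂ (b , z)) (from-to Z.R z) } }

  t : X → X
  t (inj₁ x) with x F.≟ α false | x F.≟ α true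
  ... | yes _ | _ = inj₂ (false , g₀)
  ... | no _ | yes _ = inj₂ (true , g₀)
  ... | no _ | no _ = inj₁ (F.t x)
  t (inj₂ (b , z)) with z Z.≟ g₀
  ... | yes _ = inj₁ (α b)
  ... | no _ = inj₂ (b , Z.t z)

  t-α : ∀ b → t (inj₁ (α b)) ≡ inj₂ (b , g₀)
  t-α false with α false F.≟ α false
  ... | yes _ = refl
  ... | no ne = ⊥-elim (ne refl)
  t-α true with α true F.≟ α false | α true F.≟ α true
  ... | yes p | _ = ⊥-elim (S.α-sep (sym p))
  ... | no _ | yes _ = refl
  ... | no _ | no ne = ⊥-elim (ne refl)

  t-old : ∀ x → (∀ b → x ≢ α b) → t (inj₁ x) ≡ inj₁ (F.t x)
  t-old x ne with x F.≟ α false | x F.≟ α true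
  ... | yes p | _ = ⊥-elim (ne false p)
  ... | no _ | yes p = ⊥-elim (ne true p)
  ... | no _ | no _ = refl

  t-g₀ : ∀ b → t (inj₂ (b , g₀)) ≡ inj₁ (α b)
  t-g₀ b with g₀ Z.≟ g₀
  ... | yes _ = refl
  ... | no ne = ⊥-elim (ne refl)

  t-new : ∀ b z → z ≢ g₀ → t (inj₂ (b , z)) ≡ inj₂ (b , Z.t z)
  t-new b z ne with z Z.≟ g₀
  ... | yes p = ⊥-elim (ne p)
  ... | no _ = refl

  data View : X → Set where
    port  : ∀ b → View (inj₁ (α b))
    old   : ∀ x → (∀ b → x ≢ α b) → View (inj₁ x)
    start : ∀ b → View (inj₂ (b , g₀))
    new   : ∀ b z → z ≢ g₀ → View (inj₂ (b , z))

  view : ∀ x → View x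
  view (inj₁ x) with x F.≟ α false | x F.≟ α true
  ... | yes refl | _ = port false
  ... | no _ | yes refl = port true
  ... | no u | no v = old x λ { false → u ; true → v }
  view (inj₂ (b , z)) with z Z.≟ g₀
  ... | yes refl = start b
  ... | no ne = new b z ne

  t-keeps-old : ∀ x → (∀ b → x ≢ α b) → ∀ b → F.t x ≢ α b
  t-keeps-old x ne b p = ne b (F.t-injective (trans p (sym (S.tα b))))

  t-keeps-new : ∀ z → z ≢ g₀ → Z.t z ≢ g₀
  t-keeps-new z ne p = ne (Z.t-injective (trans p (sym M.tg₀)))

  t-involutive : ∀ x → t (t x) ≡ x
  t-involutive x with view x
  ... | port b = trans (cong t (t-α b)) (t-g₀ b)
  ... | old x ne = trans (cong t (t-old x ne)) (trans (t-old _ (t-keeps-old x ne)) (cong inj₁ (F.t-involutive x)))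
  ... | start b = trans (cong t (t-g₀ b)) (t-α b)
  ... | new b z ne = trans (cong t (t-new b z ne)) (trans (t-new b _ (t-keeps-new z ne)) (cong (λ z → inj₂ (b , z)) (Z.t-involutive z)))

  G : Frame
  G = record { X = X ; k = F.k + 2 * Z.k ; fin = fin ; R = R ; t = t ; t-involutive = t-involutive }

  module G = Frame G

  extend : Extension S.B S.Port G
  extend = record
    { inj = λ x → inj₁ (Extension.inj S.E x)
    ; inj-injective = λ p → Extension.inj-injective S.E (inj₁-injective p)
    ; inj-r = λ x → cong inj₁ (Extension.inj-r S.E x)
    ; inj-t = λ x np → trans (t-old _ (S.α-port x np)) (cong inj₁ (Extension.inj-t S.E x np)) }

  it-old : ∀ i x → it G.r i (inj₁ x) ≡ inj₁ (it F.r i x)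
  it-old = it-inj inj₁ (λ _ → refl)
  it-old⁻ : ∀ i x → it G.r⁻ i (inj₁ x) ≡ inj₁ (it F.r⁻ i x)
  it-old⁻ = it-inj inj₁ (λ _ → refl)
  it-new : ∀ b i z → it G.r i (inj₂ (b , z)) ≡ inj₂ (b , it Z.r i z)
  it-new b = it-inj (λ z → inj₂ (b , z)) (λ _ → refl)
  it-new⁻ : ∀ b i z → it G.r⁻ i (inj₂ (b , z)) ≡ inj₂ (b , it Z.r⁻ i z)
  it-new⁻ b = it-inj (λ z → inj₂ (b , z)) (λ _ → refl)

  r-order : ∀ x → it G.r m x ≡ x
  r-order (inj₁ x) = trans (it-old m x) (cong inj₁ (S.r-order x))
  r-order (inj₂ (b , z)) = trans (it-new b m z) (cong (λ z → inj₂ (b , z)) (M.r-order z))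

  r-exact : ∃[ x ] (∀ i → 0 < i → i < m → it G.r i x ≢ x)
  r-exact = inj₁ (proj₁ S.r-exact) , λ i a b p → proj₂ S.r-exact i a b (inj₁-injective (trans (sym (it-old i _)) p))

  private
    copy : Bool → Z.X → X
    copy b z = inj₂ (b , z)
    copy-inj : ∀ b {z z′} → copy b z ≡ copy b z′ → z ≡ z′
    copy-inj b refl = refl
    oldT = mapTr F._≟_ G._≟_ inj₁ inj₁-injective
    newT : Bool → Tr Z._≟_ → Tr G._≟_
    newT b = mapTr Z._≟_ G._≟_ (copy b) (copy-inj b)
    old-old : ∀ ts x → swaps G._≟_ (map oldT ts) (inj₁ x) ≡ inj₁ (swaps F._≟_ ts x)
    old-old = swaps-map F._≟_ G._≟_ inj₁ inj₁-injective
    old-new : ∀ ts b z → swaps G._≟_ (map oldT ts) (inj₂ (b , z)) ≡ inj₂ (b , z)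
    old-new ts b z = swaps-map-fix F._≟_ G._≟_ inj₁ inj₁-injective ts _ (λ _ ())
    new-old : ∀ b ts x → swaps G._≟_ (map (newT b) ts) (inj₁ x) ≡ inj₁ x
    new-old b ts x = swaps-map-fix Z._≟_ G._≟_ (copy b) (copy-inj b) ts _ (λ _ ())
    new-new : ∀ b ts z → swaps G._≟_ (map (newT b) ts) (inj₂ (b , z)) ≡ inj₂ (b , swaps Z._≟_ ts z)
    new-new b = swaps-map Z._≟_ G._≟_ (copy b) (copy-inj b)
    new-other : ∀ b b′ ts z → b ≢ b′ → swaps G._≟_ (map (newT b) ts) (inj₂ (b′ , z)) ≡ inj₂ (b′ , z)
    new-other b b′ ts z ne = swaps-map-fix Z._≟_ G._≟_ (copy b) (copy-inj b) ts _ (λ { _ refl → ne refl })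

  r-even : EvenF G._≟_ G.r
  r-even = map oldT us ++ (map (newT false) vs ++ map (newT true) vs) ,
    subst Even (sym (trans (length-++ (map oldT us)) (cong₂ _+_ (length-map oldT us)
      (trans (length-++ (map (newT false) vs)) (cong₂ _+_ (length-map _ vs) (length-map _ vs))))))
      (even-+ (proj₁ (proj₂ S.r-even)) (even-double (length vs))) , go
    where
    us = proj₁ S.r-even
    vs = proj₁ (swapsOf Z.fin Z.R)
    rest : ∀ x → swaps G._≟_ (map (newT false) vs ++ map (newT true) vs) x ≡
                 swaps G._≟_ (map (newT true) vs) (swaps G._≟_ (map (newT false) vs) x)
    rest = swaps-++ G._≟_ (map (newT false) vs) (map (newT true) vs)
    go : ∀ x → swaps G._≟_ (map oldT us ++ (map (newT false) vs ++ map (newT true) vs)) x ≡ G.r x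
    go x = trans (swaps-++ G._≟_ (map oldT us) _ x) (trans (rest _) (go′ x))
      where
      go′ : ∀ x → swaps G._≟_ (map (newT true) vs) (swaps G._≟_ (map (newT false) vs) (swaps G._≟_ (map oldT us) x)) ≡ G.r x
      go′ (inj₁ x) rewrite old-old us x | new-old false vs (swaps F._≟_ us x) =
        trans (new-old true vs _) (cong inj₁ (proj₂ (proj₂ S.r-even) x))
      go′ (inj₂ (false , z)) rewrite old-new us false z | new-new false vs z =
        trans (new-other true false vs _ (λ ())) (cong (copy false) (proj₂ (swapsOf Z.fin Z.R) z))
      go′ (inj₂ (true , z)) rewrite old-new us true z | new-other false true vs z (λ ()) =
        trans (new-new true vs z) (cong (copy true) (proj₂ (swapsOf Z.fin Z.R) z))

  -- Each copy contributes the transposition (α g₀) and then the transpositions of the tile's own t;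
  -- the two blocks have equal length.
  t-even : EvenF G._≟_ t
  t-even = map oldT us ++ (block false ++ block true) ,
    subst Even (sym (trans (length-++ (map oldT us)) (cong₂ _+_ (length-map oldT us)
      (trans (length-++ (block false)) (cong₂ _+_ (len false) (len true))))))
      (even-+ (proj₁ (proj₂ S.t-even)) (even-double (suc (length vs)))) , go
    where
    us = proj₁ S.t-even
    vs = proj₁ (swapsOf Z.fin Z.T)
    vs-t : ∀ z → swaps Z._≟_ vs z ≡ Z.t z
    vs-t = proj₂ (swapsOf Z.fin Z.T)
    block : Bool → List (Tr G._≟_)
    block b = (inj₁ (α b) , inj₂ (b , g₀) , λ ()) ∷ map (newT b) vs
    len : ∀ b → length (block b) ≡ suc (length vs)
    len b = cong suc (length-map _ vs)
    bl : Bool → X → X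
    bl b = swaps G._≟_ (block b)
    bl-α : ∀ b → bl b (inj₁ (α b)) ≡ inj₂ (b , g₀)
    bl-α b = trans (cong (swaps G._≟_ (map (newT b) vs)) (swp-left G._≟_ (inj₁ (α b)) (inj₂ (b , g₀))))
      (trans (new-new b vs g₀) (cong (copy b) (trans (vs-t g₀) M.tg₀)))
    bl-g : ∀ b → bl b (inj₂ (b , g₀)) ≡ inj₁ (α b)
    bl-g b = trans (cong (swaps G._≟_ (map (newT b) vs)) (swp-right G._≟_ (inj₁ (α b)) (inj₂ (b , g₀)))) (new-old b vs _)
    bl-old : ∀ b x → x ≢ α b → bl b (inj₁ x) ≡ inj₁ x
    bl-old b x ne = trans (cong (swaps G._≟_ (map (newT b) vs))
      (swp-other G._≟_ (inj₁ (α b)) (inj₂ (b , g₀)) (inj₁ x) (ne ∘ inj₁-injective) (λ ()))) (new-old b vs _)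
    bl-new : ∀ b z → z ≢ g₀ → bl b (inj₂ (b , z)) ≡ inj₂ (b , Z.t z)
    bl-new b z ne = trans (cong (swaps G._≟_ (map (newT b) vs))
      (swp-other G._≟_ (inj₁ (α b)) (inj₂ (b , g₀)) (inj₂ (b , z)) (λ ()) (λ { refl → ne refl })))
      (trans (new-new b vs z) (cong (copy b) (vs-t z)))
    bl-other : ∀ b b′ z → b ≢ b′ → bl b (inj₂ (b′ , z)) ≡ inj₂ (b′ , z)
    bl-other b b′ z ne = trans (cong (swaps G._≟_ (map (newT b) vs))
      (swp-other G._≟_ (inj₁ (α b)) (inj₂ (b , g₀)) (inj₂ (b′ , z)) (λ ()) (λ { refl → ne refl })))
      (new-other b b′ vs z ne)
    both : ∀ x → View x → bl true (bl false (swaps G._≟_ (map oldT us) x)) ≡ t x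
    both _ (port false) = trans (cong (bl true ∘ bl false) (trans (old-old us _) (cong inj₁ (trans (proj₂ (proj₂ S.t-even) _) (S.tα false)))))
      (trans (cong (bl true) (bl-α false)) (trans (bl-other true false g₀ (λ ())) (sym (t-α false))))
    both _ (port true) = trans (cong (bl true ∘ bl false) (trans (old-old us _) (cong inj₁ (trans (proj₂ (proj₂ S.t-even) _) (S.tα true)))))
      (trans (cong (bl true) (bl-old false (α true) (λ p → S.α-sep (sym p)))) (trans (bl-α true) (sym (t-α true))))
    both _ (old x ne) = trans (cong (bl true ∘ bl false) (trans (old-old us _) (cong inj₁ (proj₂ (proj₂ S.t-even) x))))
      (trans (cong (bl true) (bl-old false _ (t-keeps-old x ne false))) (trans (bl-old true _ (t-keeps-old x ne true)) (sym (t-old x ne))))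
    both _ (start false) = trans (cong (bl true ∘ bl false) (old-new us false g₀))
      (trans (cong (bl true) (bl-g false)) (trans (bl-old true _ S.α-sep) (sym (t-g₀ false))))
    both _ (start true) = trans (cong (bl true ∘ bl false) (old-new us true g₀))
      (trans (cong (bl true) (bl-other false true g₀ (λ ()))) (trans (bl-g true) (sym (t-g₀ true))))
    both _ (new false z ne) = trans (cong (bl true ∘ bl false) (old-new us false z))
      (trans (cong (bl true) (bl-new false z ne)) (trans (bl-other true false _ (λ ())) (sym (t-new false z ne))))
    both _ (new true z ne) = trans (cong (bl true ∘ bl false) (old-new us true z))
      (trans (cong (bl true) (bl-other false true z (λ ()))) (trans (bl-new true z ne) (sym (t-new true z ne))))
    go : ∀ x → swaps G._≟_ (map oldT us ++ (block false ++ block true)) x ≡ t x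
    go x = trans (swaps-++ G._≟_ (map oldT us) _ x) (trans (swaps-++ G._≟_ (block false) (block true) _) (both x (view x)))

  connected : ∀ (P : X → Set) → (∀ x → P x → P (G.r x)) → (∀ x → P x → P (t x)) →
    P (inj₁ (Extension.inj S.E (Local.y₁ S.L))) → ∀ x → P x
  connected P pr pt p₀ = every
    where
    olds : ∀ x → P (inj₁ x)
    olds = S.connected (P ∘ inj₁) (λ x → pr (inj₁ x)) stepT p₀
      where
      stepT : ∀ x → P (inj₁ x) → P (inj₁ (F.t x))
      stepT x p = go (view (inj₁ x)) p
        where
        go : ∀ {x} → View (inj₁ x) → P (inj₁ x) → P (inj₁ (F.t x))
        go (port b) p = subst (P ∘ inj₁) (sym (S.tα b)) p
        go (old x ne) p = subst P (t-old x ne) (pt _ p)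
    every : ∀ x → P x
    every (inj₁ x) = olds x
    every (inj₂ (b , z)) = M.connected (λ z → P (inj₂ (b , z))) (λ z → pr _) stepT (subst P (t-α b) (pt _ (olds (α b)))) z
      where
      stepT : ∀ z → P (inj₂ (b , z)) → P (inj₂ (b , Z.t z))
      stepT z p = go (view (inj₂ (b , z))) p
        where
        go : ∀ {z} → View (inj₂ (b , z)) → P (inj₂ (b , z)) → P (inj₂ (b , Z.t z))
        go (start b) p = subst (λ z → P (inj₂ (b , z))) (sym M.tg₀) p
        go (new b z ne) p = subst P (t-new b z ne) (pt _ p)

  -- The cycle of σ through a port first runs through the new tile and then through the old cycle.

  walk-new : ∀ b i → i < c → it G.σ (suc i) (inj₁ (α b)) ≡ inj₂ (b , it Z.σ (suc i) g₀)
  walk-new b zero    h = trans (cong G.r (t-α b)) (cong (λ z → inj₂ (b , Z.r z)) (sym M.tg₀))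
  walk-new b (suc i) h = trans (cong G.σ (walk-new b i (<⇒≤ h))) (cong G.r (t-new b _ (M.minimal (suc i) (s≤s z≤n) h)))

  walk-c : ∀ b → it G.σ c (inj₁ (α b)) ≡ inj₂ (b , g₀)
  walk-c b = go c refl
    where
    go : ∀ i → i ≡ c → it G.σ i (inj₁ (α b)) ≡ inj₂ (b , g₀)
    go zero p with subst (0 <_) (sym p) M.c>0
    ... | ()
    go (suc i) refl = trans (walk-new b i ≤-refl) (cong (λ z → inj₂ (b , z)) M.cycle)

  walk-old : ∀ b i → i < n → it G.σ (suc i + c) (inj₁ (α b)) ≡ inj₁ (it F.σ (suc i) (α b))
  walk-old b zero    h = trans (cong G.σ (walk-c b)) (trans (cong G.r (t-g₀ b)) (cong (inj₁ ∘ F.r) (sym (S.tα b))))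
  walk-old b (suc i) h = trans (cong G.σ (walk-old b i (<⇒≤ h)))
    (cong G.r (t-old _ (λ b′ → S.minimal b b′ (suc i) (s≤s z≤n) h)))

  walk-all : ∀ b → it G.σ (n + c) (inj₁ (α b)) ≡ inj₁ (α b)
  walk-all b = go n refl
    where
    go : ∀ i → i ≡ n → it G.σ (i + c) (inj₁ (α b)) ≡ inj₁ (α b)
    go zero p with subst (1 <_) (sym p) S.n>1
    ... | ()
    go (suc i) refl = trans (walk-old b i ≤-refl) (cong inj₁ (S.cycle b))

  α′ : Bool → X
  α′ b = inj₂ (b , M.exit)

  walk-p : ∀ b → it G.σ M.p (inj₁ (α b)) ≡ α′ b
  walk-p b = go M.p refl
    where
    go : ∀ i → i ≡ M.p → it G.σ i (inj₁ (α b)) ≡ inj₂ (b , it Z.σ i g₀)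
    go zero p with subst (0 <_) (sym p) M.p>0
    ... | ()
    go (suc i) eq = walk-new b i (≤-trans (n≤1+n _) (subst (_< c) (sym eq) M.p<c))

  cycle′ : ∀ b → it G.σ (n + c) (α′ b) ≡ α′ b
  cycle′ b = trans (cong (it G.σ (n + c)) (sym (walk-p b)))
    (trans (it-comm G.σ (n + c) M.p _) (trans (cong (it G.σ M.p) (walk-all b)) (walk-p b)))

  private
    σ-step : ∀ b i → it G.σ i (α′ b) ≡ it G.σ (i + M.p) (inj₁ (α b))
    σ-step b i = trans (cong (it G.σ i) (sym (walk-p b))) (sym (it-+ G.σ i M.p _))

    exact : ∀ b i → 0 < i → i ≤ c → it G.σ i (inj₁ (α b)) ≡ inj₂ (b , it Z.σ i g₀)
    exact b (suc i) a h = walk-new b i h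

    repeat : ∀ i i′ → it Z.σ (i + i′) g₀ ≡ it Z.σ i′ g₀ → 0 < i → i < c → ⊥
    repeat i i′ q a h = M.minimal i a h (it-injective Z.σ Z.σ-injective i′
      (trans (it-comm Z.σ i′ i g₀) (trans (sym (it-+ Z.σ i i′ g₀)) q)))

  -- Counted from α instead of the exit, the exponent is i + p. Up to c the walk is still inside the
  -- tile; from there up to n + c it is among the old points; beyond n + c it has started over and
  -- is at a position d < p. The two cases inside the tile contradict minimality of its cycle.
  minimal′ : ∀ b b′ i → 0 < i → i < n + c → it G.σ i (α′ b) ≢ α′ b′
  minimal′ b b′ i i>0 i<n+c eq with ≤-<-connex (i + M.p) c
  ... | inj₁ le = repeat i M.p (,-injectiveʳ (inj₂-injective (trans (sym (exact b (i + M.p) (≤-trans i>0 (m≤m+n i M.p)) le))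
                    (trans (sym (σ-step b i)) eq)))) i>0 (≤-trans (≤-trans (≤-reflexive (+-comm 1 i)) (+-monoʳ-≤′ M.p>0)) le)
    where
    open import Data.Nat.Properties using (+-monoʳ-≤)
    +-monoʳ-≤′ : ∀ {a b} → a ≤ b → i + a ≤ i + b
    +-monoʳ-≤′ = +-monoʳ-≤ i
  ... | inj₂ gt with ≤-<-connex (i + M.p) (n + c)
  ...   | inj₁ le = clash (trans (sym (trans (cong (λ z → it G.σ z (inj₁ (α b))) split) (walk-old b d d<n))) (trans (sym (σ-step b i)) eq))
    where
    d = i + M.p ∸ suc c
    split : i + M.p ≡ suc d + c
    split = trans (sym (m∸n+n≡m gt)) (+-suc d c)
    d<n : d < n
    d<n = +-cancelʳ-≤ c (suc d) n (subst (_≤ n + c) split le)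
      where open import Data.Nat.Properties using (+-cancelʳ-≤)
    clash : ∀ {x y} → inj₁ x ≡ α′ y → ⊥
    clash ()
  ...   | inj₂ gt′ = repeat (M.p ∸ d) d (trans (cong (λ z → it Z.σ z g₀) (m∸n+n≡m (<⇒≤ d<p)))
        (sym (,-injectiveʳ (inj₂-injective (trans (sym wrapped) (trans (sym (σ-step b i)) eq))))))
        (m<n⇒0<n∸m d<p) (≤-trans (s≤s (m∸n≤m M.p d)) M.p<c)
    where
    d = i + M.p ∸ (n + c)
    split : d + (n + c) ≡ i + M.p
    split = m∸n+n≡m (<⇒≤ gt′)
    d<p : d < M.p
    d<p = +-cancelʳ-< (n + c) d M.p (subst (_< M.p + (n + c)) (sym split)
            (subst (_< M.p + (n + c)) (+-comm M.p i) (+-monoʳ-< M.p i<n+c)))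
    wrapped : it G.σ (i + M.p) (inj₁ (α b)) ≡ inj₂ (b , it Z.σ d g₀)
    wrapped = trans (cong (λ z → it G.σ z (inj₁ (α b))) (sym split)) (trans (it-+ G.σ d (n + c) _)
      (trans (cong (it G.σ d) (walk-all b)) (exact b d (m<n⇒0<n∸m gt′) (<⇒≤ (<-trans d<p M.p<c)))))

  cover′ : ∀ x → G.σ x ≡ x ⊎ ∃[ b ] ∃[ i ] it G.σ i (α′ b) ≡ x
  cover′ = go
    where
    OnCycle : X → Set
    OnCycle x = ∃[ b ] ∃[ i ] it G.σ i (inj₁ (α b)) ≡ x
    rebase : ∀ {x} → OnCycle x → ∃[ b ] ∃[ i ] it G.σ i (α′ b) ≡ x
    -- The exit comes p steps after α, so n + c - p further steps lead from the exit back to α.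
    rebase (b , i , refl) = b , i + (n + c ∸ M.p) , trans (it-+ G.σ i _ _) (cong (it G.σ i)
      (trans (σ-step b (n + c ∸ M.p)) (trans (cong (λ z → it G.σ z (inj₁ (α b)))
        (m∸n+n≡m (≤-trans (<⇒≤ M.p<c) (m≤n+m c n)))) (walk-all b))))
    follow : ∀ {x y} d → OnCycle x → it G.σ d x ≡ y → OnCycle y
    follow d (b , i , refl) refl = b , d + i , it-+ G.σ d i _
    olds : ∀ b i → OnCycle (inj₁ (it F.σ i (α b)))
    olds b zero = b , 0 , refl
    olds b (suc i) = step (view (inj₁ (it F.σ i (α b)))) (olds b i)
      where
      step : ∀ {x} → View (inj₁ x) → OnCycle (inj₁ x) → OnCycle (inj₁ (F.σ x))
      step (port b′) o = follow (suc c) o (walk-old b′ 0 (≤-trans (s≤s z≤n) S.n>1))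
      step (old x ne) o = follow 1 o (cong G.r (t-old x ne))
    news : ∀ b i → OnCycle (inj₂ (b , it Z.σ i g₀))
    news b zero = b , c , walk-c b
    news b (suc i) = step (view (inj₂ (b , it Z.σ i g₀))) (news b i)
      where
      step : ∀ {z} → View (inj₂ (b , z)) → OnCycle (inj₂ (b , z)) → OnCycle (inj₂ (b , Z.σ z))
      step (start b) _ = b , 1 , walk-new b 0 M.c>0
      step (new b z ne) o = follow 1 o (cong G.r (t-new b z ne))
    go : ∀ x → G.σ x ≡ x ⊎ ∃[ b ] ∃[ i ] it G.σ i (α′ b) ≡ x
    go (inj₁ x) with S.cover x
    ... | inj₂ (b , i , refl) = inj₂ (rebase (olds b i))
    ... | inj₁ p = fixed (view (inj₁ x)) p
      where
      fixed : ∀ {x} → View (inj₁ x) → F.σ x ≡ x → G.σ (inj₁ x) ≡ inj₁ x ⊎ ∃[ b ] ∃[ i ] it G.σ i (α′ b) ≡ inj₁ x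
      fixed (port b) p = ⊥-elim (S.minimal b b 1 (s≤s z≤n) S.n>1 p)
      fixed (old x ne) p = inj₁ (trans (cong G.r (t-old x ne)) (cong inj₁ p))
    go (inj₂ (b , z)) with M.cover z
    ... | inj₁ (p , ne) = inj₁ (trans (cong G.r (t-new b z ne)) (cong (λ z → inj₂ (b , z)) p))
    ... | inj₂ (i , refl) = inj₂ (rebase (news b i))

  t-exit : Z.t M.exit ≡ M.exit → ∀ b → t (α′ b) ≡ α′ b
  t-exit te b = trans (t-new b M.exit (M.minimal M.p M.p>0 M.p<c)) (cong (λ z → inj₂ (b , z)) te)

  open Local S.L using (j; q; y₁; y₂; y₃)

  Y : X → Set
  Y = Among (inj₁ (Extension.inj S.E y₁)) (inj₁ (Extension.inj S.E y₂)) (inj₁ (Extension.inj S.E y₃))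

  glue : Z.t M.exit ≡ M.exit →
    (∀ x → ¬ Y x → it (λ x → t (G.τ j x)) (suc (q * 3)) x ≡ x) → State m (n + c)
  glue te off = record
    { B = S.B ; αᴮ = S.αᴮ ; L = S.L ; F = G ; E = extend
    ; m>0 = S.m>0 ; r-order = r-order ; r-exact = r-exact ; r-even = r-even ; t-even = t-even
    ; α = α′ ; α-port = λ x np b () ; α-sep = λ () ; tα = t-exit te
    ; n>1 = ≤-trans S.n>1 (m≤m+n n c)
    ; cycle = cycle′ ; minimal = minimal′ ; cover = cover′ ; off = off ; connected = connected }

-- Ports and tiles that are isolated for the pair t, τ: gluing them creates only two-element orbits.

record IsoState (m n : ℕ) (j : ℕ) : Set₁ where
  field
    S : State m n
  open State S public
  open Frame F
  field
    j≡ : Local.j L ≡ j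
    h  : ℕ
    K-even : suc (Local.q L * 3) ≡ h * 2
    -- Together with `tα` these equations make α and γ = rʲ α fixed points of both t and τ.
    tγ  : ∀ b → t (it r j (α b)) ≡ it r j (α b)
    tγ⁻ : ∀ b → t (it r⁻ j (α b)) ≡ it r⁻ j (α b)
    γ≢α : ∀ b b′ → it r j (α b) ≢ α b′
    α∉Y : ∀ b → ¬ Y (α b)
    γ∉Y : ∀ b → ¬ Y (it r j (α b))

record IsoTile (m c j : ℕ) : Set₁ where
  field
    M : Tile m c
  open Tile M public
  open Frame F
  field
    tγ₀  : t (it r j g₀) ≡ it r j g₀
    tγ₀⁻ : t (it r⁻ j g₀) ≡ it r⁻ j g₀
    γ₀≢g₀ : it r j g₀ ≢ g₀
    off  : ∀ x → it (λ x → t (τ j x)) 2 x ≡ x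
    -- The conditions from here on make the exit an isolated port, so that gluing can be repeated.
    te   : t exit ≡ exit
    te⁺  : t (it r j exit) ≡ it r j exit
    te⁻  : t (it r⁻ j exit) ≡ it r⁻ j exit
    e≢γ₀ : exit ≢ it r j g₀
    e⁺≢g₀ : it r j exit ≢ g₀
    e⁺≢e : it r j exit ≢ exit

module IsoGlue {m n c j : ℕ} (I : IsoState m n j) (D : IsoTile m c j) where
  private
    module I = IsoState I
    module D = IsoTile D
  open Glue I.S D.M hiding (module S; module M)
  open I using (α)
  open D using (g₀)

  γ : Bool → F.X
  γ b = it F.r j (α b)
  γ₀ : Z.X
  γ₀ = it Z.r j g₀

  private
    Fr⁻ : ∀ x → it F.r⁻ j (it F.r j x) ≡ x
    Fr⁻ = it-inverse (from-to F.R) j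
    Fr : ∀ x → it F.r j (it F.r⁻ j x) ≡ x
    Fr = it-inverse (to-from F.R) j
    Zr⁻ : ∀ x → it Z.r⁻ j (it Z.r j x) ≡ x
    Zr⁻ = it-inverse (from-to Z.R) j
    Zr : ∀ x → it Z.r j (it Z.r⁻ j x) ≡ x
    Zr = it-inverse (to-from Z.R) j

  τ-old : ∀ x → (∀ b → x ≢ γ b) → G.τ j (inj₁ x) ≡ inj₁ (F.τ j x)
  τ-old x ne = trans (cong (it G.r j ∘ t) (it-old⁻ j x)) (trans (cong (it G.r j)
    (t-old _ (λ b p → ne b (trans (sym (Fr x)) (cong (it F.r j) p))))) (it-old j _))

  τ-γ : ∀ b → G.τ j (inj₁ (γ b)) ≡ inj₂ (b , γ₀)
  τ-γ b = trans (cong (it G.r j ∘ t) (trans (it-old⁻ j _) (cong inj₁ (Fr⁻ _))))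
    (trans (cong (it G.r j) (t-α b)) (it-new b j g₀))

  τ-new : ∀ b z → z ≢ γ₀ → G.τ j (inj₂ (b , z)) ≡ inj₂ (b , Z.τ j z)
  τ-new b z ne = trans (cong (it G.r j ∘ t) (it-new⁻ b j z)) (trans (cong (it G.r j)
    (t-new b _ (λ p → ne (trans (sym (Zr z)) (cong (it Z.r j) p))))) (it-new b j _))

  τ-γ₀ : ∀ b → G.τ j (inj₂ (b , γ₀)) ≡ inj₁ (γ b)
  τ-γ₀ b = trans (cong (it G.r j ∘ t) (trans (it-new⁻ b j _) (cong (λ z → inj₂ (b , z)) (Zr⁻ _))))
    (trans (cong (it G.r j) (t-g₀ b)) (it-old j _))

  u′ : X → X
  u′ x = t (G.τ j x)

  private
    Fτ-inj : ∀ {x y} → F.τ j x ≡ F.τ j y → x ≡ y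
    Fτ-inj p = to-injective (powᵇ (invᵇ F.R) j) (F.t-injective (to-injective (powᵇ F.R j) p))
    Zτ-inj : ∀ {x y} → Z.τ j x ≡ Z.τ j y → x ≡ y
    Zτ-inj p = to-injective (powᵇ (invᵇ Z.R) j) (Z.t-injective (to-injective (powᵇ Z.R j) p))
    Fτα : ∀ b → F.τ j (α b) ≡ α b
    Fτα b = trans (cong (it F.r j) (I.tγ⁻ b)) (Fr _)
    Fτγ : ∀ b → F.τ j (γ b) ≡ γ b
    Fτγ b = cong (it F.r j) (trans (cong F.t (Fr⁻ _)) (I.tα b))
    Zτg : Z.τ j g₀ ≡ g₀
    Zτg = trans (cong (it Z.r j) D.tγ₀⁻) (Zr _)
    Zτγ : Z.τ j γ₀ ≡ γ₀
    Zτγ = cong (it Z.r j) (trans (cong Z.t (Zr⁻ _)) D.tg₀)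

    Good : F.X → Set
    Good x = (∀ b → x ≢ α b) × (∀ b → x ≢ γ b)

    good-step : ∀ x → Good x → Good (F.t (F.τ j x))
    good-step x (a , g) =
      (λ b p → a b (Fτ-inj (trans (F.t-injective (trans p (sym (I.tα b)))) (sym (Fτα b))))) ,
      (λ b p → g b (Fτ-inj (trans (F.t-injective (trans p (sym (I.tγ b)))) (sym (Fτγ b)))))

    good-it : ∀ i x → Good x → Good (it (λ x → F.t (F.τ j x)) i x)
    good-it zero    x g = g
    good-it (suc i) x g = good-step _ (good-it i x g)

    old-it : ∀ i x → Good x → it u′ i (inj₁ x) ≡ inj₁ (it (λ x → F.t (F.τ j x)) i x)
    old-it zero    x g = refl
    old-it (suc i) x g = trans (cong u′ (old-it i x g)) (trans (cong t (τ-old _ (proj₂ (good-it i x g))))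
      (t-old _ (λ b p → proj₁ (good-it i x g) b (Fτ-inj (trans p (sym (Fτα b)))))))

    new-step : ∀ b z → z ≢ g₀ → z ≢ γ₀ → u′ (inj₂ (b , z)) ≡ inj₂ (b , Z.t (Z.τ j z))
    new-step b z u v = trans (cong t (τ-new b z v)) (t-new b _ (λ p → u (Zτ-inj (trans p (sym Zτg)))))

    new₂ : ∀ b z → z ≢ g₀ → z ≢ γ₀ → it u′ 2 (inj₂ (b , z)) ≡ inj₂ (b , z)
    new₂ b z u v = trans (cong u′ (new-step b z u v)) (trans (new-step b _
      (λ p → u (Zτ-inj (trans (Z.t-injective (trans p (sym D.tg₀))) (sym Zτg))))
      (λ p → v (Zτ-inj (trans (Z.t-injective (trans p (sym D.tγ₀))) (sym Zτγ))))) (cong (λ z → inj₂ (b , z)) (D.off z)))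

    uα : ∀ b → u′ (inj₁ (α b)) ≡ inj₂ (b , g₀)
    uα b = trans (cong t (trans (τ-old _ (λ b′ p → I.γ≢α b′ b (sym p))) (cong inj₁ (Fτα b)))) (t-α b)
    ug : ∀ b → u′ (inj₂ (b , g₀)) ≡ inj₁ (α b)
    ug b = trans (cong t (trans (τ-new b g₀ (≢-sym D.γ₀≢g₀)) (cong (λ z → inj₂ (b , z)) Zτg))) (t-g₀ b)
    uγ : ∀ b → u′ (inj₁ (γ b)) ≡ inj₂ (b , γ₀)
    uγ b = trans (cong t (τ-γ b)) (trans (t-new b γ₀ D.γ₀≢g₀) (cong (λ z → inj₂ (b , z)) D.tγ₀))
    uγ₀ : ∀ b → u′ (inj₂ (b , γ₀)) ≡ inj₁ (γ b)
    uγ₀ b = trans (cong t (τ-γ₀ b)) (trans (t-old _ (I.γ≢α b)) (cong inj₁ (I.tγ b)))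

    even : ∀ x → it u′ 2 x ≡ x → it u′ (suc (Local.q I.L * 3)) x ≡ x
    even x p = trans (cong (λ i → it u′ i x) I.K-even) (it-* u′ I.h 2 x p)

    isγ? : ∀ x → Dec (∃[ b ] x ≡ γ b)
    isγ? x with x F.≟ γ false | x F.≟ γ true
    ... | yes p | _ = yes (false , p)
    ... | no _ | yes p = yes (true , p)
    ... | no u | no v = no λ { (false , p) → u p ; (true , p) → v p }

  -- Gluing changes t only at α and g₀, and τ only at γ and γ₀, all of which were fixed by both. The
  -- new orbits are {α, g₀} and {γ, γ₀}, killed by the even exponent; all other orbits stay as they
  -- were.
  off′ : ∀ x → ¬ Y x → it u′ (suc (Local.q I.L * 3)) x ≡ x
  off′ x ny = go (view x) ny
    where
    go : ∀ {x} → View x → ¬ Y x → it u′ (suc (Local.q I.L * 3)) x ≡ x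
    go (port b) _ = even _ (trans (cong u′ (uα b)) (ug b))
    go (start b) _ = even _ (trans (cong u′ (ug b)) (uα b))
    go (old x ne) ny with isγ? x
    ... | yes (b , refl) = even _ (trans (cong u′ (uγ b)) (uγ₀ b))
    ... | no ng = trans (old-it (suc (Local.q I.L * 3)) x (ne , λ b p → ng (b , p)))
      (cong inj₁ (subst (λ i → it (λ x → F.t (F.τ i x)) (suc (Local.q I.L * 3)) x ≡ x) I.j≡ (I.off x
        (λ { (inj₁ p) → ny (inj₁ (cong inj₁ p)) ; (inj₂ (inj₁ p)) → ny (inj₂ (inj₁ (cong inj₁ p))) ; (inj₂ (inj₂ p)) → ny (inj₂ (inj₂ (cong inj₁ p))) }))))
    go (new b z ne) _ with z Z.≟ γ₀
    ... | yes refl = even _ (trans (cong u′ (uγ₀ b)) (uγ b))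
    ... | no ng = even _ (new₂ b z ne ng)

  isoGlue : IsoState m (n + c) j
  isoGlue = record
    { S = glue D.te (subst (λ i → ∀ x → ¬ Y x → it (λ x → t (G.τ i x)) (suc (Local.q I.L * 3)) x ≡ x) (sym I.j≡) off′)
    ; j≡ = I.j≡ ; h = I.h ; K-even = I.K-even
    ; tγ = λ b → trans (cong t (it-new b j _)) (trans (t-new b _ D.e⁺≢g₀) (trans (cong (λ z → inj₂ (b , z)) D.te⁺) (sym (it-new b j _))))
    ; tγ⁻ = λ b → trans (cong t (it-new⁻ b j _)) (trans (t-new b _ (λ p → D.e≢γ₀ (trans (sym (Zr _)) (cong (it Z.r j) p))))
              (trans (cong (λ z → inj₂ (b , z)) D.te⁻) (sym (it-new⁻ b j _))))
    ; γ≢α = λ b b′ p → D.e⁺≢e (,-injectiveʳ (inj₂-injective (trans (sym (it-new b j _)) p)))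
    ; α∉Y = λ { b (inj₁ ()) ; b (inj₂ (inj₁ ())) ; b (inj₂ (inj₂ ())) }
    ; γ∉Y = λ b p → notY (subst Y (it-new b j _) p) }
    where
    notY : ∀ {z} → ¬ Y (inj₂ z)
    notY (inj₁ ())
    notY (inj₂ (inj₁ ()))
    notY (inj₂ (inj₂ ()))

-- An element of an n-element chain, given by the numbers of its predecessors and successors. Both
-- ends are visible to pattern matching, so rotation and its inverse can be defined by cases.
record Zip (n : ℕ) : Set where
  constructor zip
  field
    before after : ℕ
    .total : suc (before + after) ≡ n

open Zip

zip≡ : ∀ {n i j i′ j′} .{p : suc (i + j) ≡ n} .{q : suc (i′ + j′) ≡ n} → i ≡ i′ → j ≡ j′ → zip i j p ≡ zip i′ j′ q
zip≡ refl refl = refl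

zip≡′ : ∀ {n i j j′} .{p : suc (i + j) ≡ n} .{q : suc (i + j′) ≡ n} → zip i j p ≡ zip i j′ q
zip≡′ {n} {i} {j} {j′} {p} {q} = zip≡ refl (trans (sym (m+n∸m≡n (suc i) j)) (trans (cong (_∸ suc i) (recompute (_ ≟ⁿ _) (trans p (sym q)))) (m+n∸m≡n (suc i) j′)))

zip-below : ∀ {n} (z : Zip n) → before z < n
zip-below (zip i j p) = subst (i <_) (recompute (_ ≟ⁿ _) p) (s≤s (m≤m+n i j))

Zip↔Fin : ∀ n → Zip n ↔ Fin n
Zip↔Fin n = mk↔ₛ′ enc dec
  (λ i → FinP.toℕ-injective (FinP.toℕ-fromℕ< (zip-below (dec i))))
  (λ { z@(zip i j p) → zip≡″ (FinP.toℕ-fromℕ< (zip-below z)) })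
  where
  enc : Zip n → Fin n
  enc z = fromℕ< (zip-below z)
  dec : Fin n → Zip n
  dec i = zip (toℕ i) (n ∸ suc (toℕ i)) (m+[n∸m]≡n (FinP.toℕ<n i))
  zip≡″ : ∀ {i i′ j j′} .{p : suc (i + j) ≡ n} .{q : suc (i′ + j′) ≡ n} → i ≡ i′ → zip i j p ≡ zip i′ j′ q
  zip≡″ refl = zip≡′

-- A gon consists of a special points, ℓ loops and f free points, in this cyclic order.

data Gon (a ℓ f : ℕ) : Set where
  sp : Zip a → Gon a ℓ f
  lo : Zip ℓ → Bool → Gon a ℓ f
  fr : Zip f → Gon a ℓ f

module _ {a ℓ f : ℕ} where
  abstract
    Gon↔Fin : Gon a ℓ f ↔ Fin (a + (ℓ * 2 + f))
    Gon↔Fin = split ∘↔ (Zip↔Fin a ⊎-↔ tail) ∘↔ ↔-sym FinP.+↔⊎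
      where
      infixr 0 _∘↔_
      _∘↔_ : ∀ {A B C : Set} → A ↔ B → B ↔ C → A ↔ C
      f ∘↔ g = g ↔-∘ f
      tail : ((Zip ℓ × Bool) ⊎ Zip f) ↔ Fin (ℓ * 2 + f)
      tail = (((Zip↔Fin ℓ ×-↔ ↔-sym FinP.2↔Bool) ∘↔ ↔-sym FinP.*↔×) ⊎-↔ Zip↔Fin f) ∘↔ ↔-sym FinP.+↔⊎
      split : Gon a ℓ f ↔ (Zip a ⊎ ((Zip ℓ × Bool) ⊎ Zip f))
      split = mk↔ₛ′ (λ { (sp z) → inj₁ z ; (lo z b) → inj₂ (inj₁ (z , b)) ; (fr z) → inj₂ (inj₂ z) })
        (λ { (inj₁ z) → sp z ; (inj₂ (inj₁ (z , b))) → lo z b ; (inj₂ (inj₂ z)) → fr z })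
        (λ { (inj₁ z) → refl ; (inj₂ (inj₁ (z , b))) → refl ; (inj₂ (inj₂ z)) → refl })
        (λ { (sp z) → refl ; (lo z b) → refl ; (fr z) → refl })

-- There is always a special and a free point, so in the cyclic order only the block of loops can be
-- empty.
Gon⁺ : ℕ → ℕ → ℕ → Set
Gon⁺ a ℓ f = Gon (suc a) ℓ (suc f)

after-sp : ∀ {a ℓ f} → Gon⁺ a ℓ f
after-sp {ℓ = zero}  {f} = fr (zip 0 f refl)
after-sp {ℓ = suc ℓ} = lo (zip 0 ℓ refl) false

before-fr : ∀ {a ℓ f} → Gon⁺ a ℓ f
before-fr {a} {zero}  = sp (zip a 0 (cong suc (+-comm a 0)))
before-fr {ℓ = suc ℓ} = lo (zip ℓ 0 (cong suc (+-comm ℓ 0))) true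

g⁰ : ∀ {a ℓ f} → Gon⁺ a ℓ f
g⁰ {a} = sp (zip 0 a refl)

rot : ∀ {a ℓ f} → Gon⁺ a ℓ f → Gon⁺ a ℓ f
rot (sp (zip i zero p))          = after-sp
rot (sp (zip i (suc j) p))       = sp (zip (suc i) j (trans (cong suc (sym (+-suc i j))) p))
rot (lo z false)                 = lo z true
rot {f = f} (lo (zip i zero p) true) = fr (zip 0 f refl)
rot (lo (zip i (suc j) p) true)  = lo (zip (suc i) j (trans (cong suc (sym (+-suc i j))) p)) false
rot (fr (zip i zero p))          = g⁰
rot (fr (zip i (suc j) p))       = fr (zip (suc i) j (trans (cong suc (sym (+-suc i j))) p))

rot⁻ : ∀ {a ℓ f} → Gon⁺ a ℓ f → Gon⁺ a ℓ f
rot⁻ {f = f} (sp (zip zero j p))  = fr (zip f 0 (cong suc (+-comm f 0)))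
rot⁻ (sp (zip (suc i) j p))       = sp (zip i (suc j) (trans (cong suc (+-suc i j)) p))
rot⁻ (lo z true)                  = lo z false
rot⁻ {a} (lo (zip zero j p) false) = sp (zip a 0 (cong suc (+-comm a 0)))
rot⁻ (lo (zip (suc i) j p) false) = lo (zip i (suc j) (trans (cong suc (+-suc i j)) p)) true
rot⁻ (fr (zip zero j p))          = before-fr
rot⁻ (fr (zip (suc i) j p))       = fr (zip i (suc j) (trans (cong suc (+-suc i j)) p))

zip≡ˡ : ∀ {n i i′ j} .{p : suc (i + j) ≡ n} .{q : suc (i′ + j) ≡ n} → zip i j p ≡ zip i′ j q
zip≡ˡ {n} {i} {i′} {j} {p} {q} = zip≡ (+-cancelʳ-≡ j i i′ (suc-injective (recompute (_ ≟ⁿ _) (trans p (sym q))))) refl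

rot-rot⁻ : ∀ {a ℓ f} (x : Gon⁺ a ℓ f) → rot (rot⁻ x) ≡ x
rot-rot⁻ (sp (zip zero j p)) = cong sp zip≡′
rot-rot⁻ (sp (zip (suc i) j p)) = refl
rot-rot⁻ (lo z true) = refl
rot-rot⁻ {ℓ = suc ℓ} (lo (zip zero j p) false) = cong (λ z → lo z false) zip≡′
rot-rot⁻ (lo (zip (suc i) j p) false) = refl
rot-rot⁻ {ℓ = zero} (fr (zip zero j p)) = cong fr zip≡′
rot-rot⁻ {ℓ = suc ℓ} (fr (zip zero j p)) = cong fr zip≡′
rot-rot⁻ (fr (zip (suc i) j p)) = refl

rot⁻-rot : ∀ {a ℓ f} (x : Gon⁺ a ℓ f) → rot⁻ (rot x) ≡ x
rot⁻-rot {ℓ = zero} (sp (zip i zero p)) = cong sp zip≡ˡ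
rot⁻-rot {ℓ = suc ℓ} (sp (zip i zero p)) = cong sp zip≡ˡ
rot⁻-rot (sp (zip i (suc j) p)) = refl
rot⁻-rot (lo z false) = refl
rot⁻-rot {ℓ = suc ℓ} (lo (zip i zero p) true) = cong (λ z → lo z true) zip≡ˡ
rot⁻-rot (lo (zip i (suc j) p) true) = refl
rot⁻-rot (fr (zip i zero p)) = cong fr zip≡ˡ
rot⁻-rot (fr (zip i (suc j) p)) = refl

Rotᵇ : ∀ {a ℓ f} → Bij (Gon⁺ a ℓ f)
Rotᵇ = record { to = rot ; from = rot⁻ ; to-from = rot-rot⁻ ; from-to = rot⁻-rot }

flipLoops : ∀ {a ℓ f} → Gon⁺ a ℓ f → Gon⁺ a ℓ f
flipLoops (sp z)   = sp z
flipLoops (lo z b) = lo z (not b)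
flipLoops (fr z)   = fr z

flipLoops-involutive : ∀ {a ℓ f} (x : Gon⁺ a ℓ f) → flipLoops (flipLoops x) ≡ x
flipLoops-involutive (sp z)       = refl
flipLoops-involutive (lo z true)  = refl
flipLoops-involutive (lo z false) = refl
flipLoops-involutive (fr z)       = refl

-- A labelling by 0, …, N-1 that increases along φ exhibits a cycle of length N.

module Labelled {X : Set} (φ : X → X) (φ-injective : ∀ {x y} → φ x ≡ φ y → x ≡ y)
    (N : ℕ) (x₀ : X) (V : X → Set) (h : X → ℕ) (V₀ : V x₀) (h₀ : h x₀ ≡ 0)
    (bound : ∀ x → V x → h x < N)
    (step : ∀ x → V x → (V (φ x) × h (φ x) ≡ suc (h x)) ⊎ (suc (h x) ≡ N × φ x ≡ x₀)) where

  private
    to-start : ∀ d x → V x → h x + suc d ≡ N → it φ (suc d) x ≡ x₀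
    to-start zero x v p with step x v
    ... | inj₁ (v′ , q) = ⊥-elim (<-irrefl (trans q (trans (+-comm 1 (h x)) p)) (bound (φ x) v′))
    ... | inj₂ (_ , q) = q
    to-start (suc d) x v p with step x v
    ... | inj₁ (v′ , q) = trans (it-shift φ (suc d) x) (to-start d (φ x) v′ (trans (cong (_+ suc d) q) (trans (sym (+-suc (h x) (suc d))) p)))
    ... | inj₂ (q , _) = ⊥-elim (m≢1+n+m (h x) (suc-injective (trans q (trans (sym p) (trans (+-comm (h x) (suc (suc d))) refl)))))

    label : ∀ i → i < N → V (it φ i x₀) × h (it φ i x₀) ≡ i
    label zero    _ = V₀ , h₀
    label (suc i) p with label i (<⇒≤ p)
    ... | (v , q) with step _ v
    ...   | inj₁ (v′ , q′) = v′ , trans q′ (cong suc q)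
    ...   | inj₂ (q′ , _) = ⊥-elim (<-irrefl (trans (cong suc (sym q)) q′) p)

  cycle : it φ N x₀ ≡ x₀
  cycle = go N refl
    where
    go : ∀ M → M ≡ N → it φ M x₀ ≡ x₀
    go zero    _ = refl
    go (suc d) p = to-start d x₀ V₀ (trans (cong (_+ suc d) h₀) p)

  minimal : ∀ i → 0 < i → i < N → it φ i x₀ ≢ x₀
  minimal (suc i) _ p q with trans (sym (proj₂ (label (suc i) p))) (trans (cong h q) h₀)
  ... | ()

  visit : ∀ i → i < N → V (it φ i x₀)
  visit i p = proj₁ (label i p)

  -- Both x and the iterate with the label of x arrive at `x₀` after the same N - h x further steps,
  -- and φ is injective.
  cover : ∀ x → V x → it φ (h x) x₀ ≡ x
  cover x v = it-injective φ φ-injective (suc d) (trans (sym (it-+ φ (suc d) (h x) x₀))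
    (trans (cong (λ i → it φ i x₀) (trans (+-comm (suc d) (h x)) split)) (trans cycle (sym (to-start d x v split)))))
    where
    d = N ∸ suc (h x)
    split : h x + suc d ≡ N
    split = trans (+-suc (h x) d) (m+[n∸m]≡n (bound x v))

bit : Bool → ℕ
bit false = 0
bit true  = 1

zip-last : ∀ {n i} → .(suc (i + 0) ≡ n) → suc i ≡ n
zip-last {n} {i} p = trans (cong suc (sym (+-identityʳ i))) (recompute (_ ≟ⁿ _) p)

module _ {a ℓ f : ℕ} where
  private
    N = suc a + (ℓ * 2 + suc f)

    h : Gon⁺ a ℓ f → ℕ
    h (sp z)   = before z
    h (lo z b) = suc a + (before z * 2 + bit b)
    h (fr z)   = suc a + (ℓ * 2 + before z)

    bound : ∀ x → ⊤ → h x < N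
    bound (sp z) _ = ≤-trans (zip-below z) (m≤m+n (suc a) _)
    bound (lo z b) _ = +-monoʳ-< (suc a) (≤-trans (lem b) (m≤m+n (ℓ * 2) (suc f)))
      where
      lem : ∀ b → before z * 2 + bit b < ℓ * 2
      lem false = ≤-trans (s≤s (≤-trans (≤-reflexive (+-identityʳ _)) (n≤1+n _))) (*-monoˡ-≤ 2 (zip-below z))
      lem true = ≤-trans (s≤s (≤-reflexive (+-comm (before z * 2) 1))) (*-monoˡ-≤ 2 (zip-below z))
    bound (fr z) _ = +-monoʳ-< (suc a) (+-monoʳ-< (ℓ * 2) (zip-below z))

    h-after : h (after-sp {a} {ℓ} {f}) ≡ suc a
    h-after = go ℓ refl
      where
      go : ∀ ℓ′ → ℓ′ ≡ ℓ → h (after-sp {a} {ℓ} {f}) ≡ suc a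
      go zero refl = +-identityʳ (suc a)
      go (suc ℓ′) refl = +-identityʳ (suc a)

    step : ∀ x → ⊤ → (⊤ × h (rot x) ≡ suc (h x)) ⊎ (suc (h x) ≡ N × rot x ≡ g⁰)
    step (sp (zip i zero p)) _ = inj₁ (tt , trans h-after (sym (zip-last p)))
    step (sp (zip i (suc j) p)) _ = inj₁ (tt , refl)
    step (lo z false) _ = inj₁ (tt , trans (cong (suc a +_) (+-suc (before z * 2) 0)) (+-suc (suc a) _))
    step (lo (zip i zero p) true) _ = inj₁ (tt , trans (cong (suc a +_) (trans (+-identityʳ (ℓ * 2)) (trans (cong (_* 2) (sym (zip-last p)))
      (cong suc (+-comm 1 (i * 2)))))) (+-suc (suc a) _))
    step (lo (zip i (suc j) p) true) _ = inj₁ (tt , trans (cong (suc a +_) (trans (+-identityʳ (suc i * 2)) (cong suc (+-comm 1 (i * 2))))) (+-suc (suc a) _))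
    step (fr (zip i zero p)) _ = inj₂ (trans (sym (+-suc (suc a) _)) (cong (suc a +_) (trans (sym (+-suc (ℓ * 2) i)) (cong (ℓ * 2 +_) (zip-last p)))) , refl)
    step (fr (zip i (suc j) p)) _ = inj₁ (tt , trans (cong (suc a +_) (+-suc (ℓ * 2) i)) (+-suc (suc a) _))

    module Lb = Labelled (rot {a} {ℓ} {f}) (to-injective Rotᵇ) N g⁰ (λ _ → ⊤) h tt refl bound step

  rot-order : ∀ x → it (rot {a} {ℓ} {f}) N x ≡ x
  rot-order x = trans (cong (it rot N) (sym (Lb.cover x tt))) (trans (it-comm rot N (h x) g⁰) (trans (cong (it rot (h x)) Lb.cycle) (Lb.cover x tt)))

  rot-exact : ∀ i → 0 < i → i < N → it (rot {a} {ℓ} {f}) i g⁰ ≢ g⁰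
  rot-exact = Lb.minimal

  rot-connected : ∀ (P : Gon⁺ a ℓ f → Set) → (∀ x → P x → P (rot x)) → P g⁰ → ∀ x → P x
  rot-connected P pr p₀ x = subst P (Lb.cover x tt) (go (h x))
    where
    go : ∀ i → P (it rot i g⁰)
    go zero    = p₀
    go (suc i) = pr _ (go i)

-- The gon as a tile, with the two points of each loop interchanged by t

module GonTile (a ℓ f : ℕ) where
  F : Frame
  F = record { X = Gon⁺ a ℓ f ; k = _ ; fin = Gon↔Fin ; R = Rotᵇ ; t = flipLoops ; t-involutive = flipLoops-involutive }
  open Frame F

  c : ℕ
  c = suc a + (ℓ + suc f)

  -- In each loop t sends the second point to the first and r sends it back, so σ fixes the second
  -- point. The cycle through `g⁰` consists of all other points, whence c = m - ℓ.
  V : X → Set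
  V (lo z true) = ⊥
  V _           = ⊤

  h : X → ℕ
  h (sp z)   = before z
  h (lo z _) = suc a + before z
  h (fr z)   = suc a + (ℓ + before z)

  bound : ∀ x → V x → h x < c
  bound (sp z) _ = ≤-trans (zip-below z) (m≤m+n (suc a) _)
  bound (lo z false) _ = +-monoʳ-< (suc a) (≤-trans (zip-below z) (m≤m+n ℓ (suc f)))
  bound (fr z) _ = +-monoʳ-< (suc a) (+-monoʳ-< ℓ (zip-below z))

  h-after : V (after-sp {a} {ℓ} {f}) × h (after-sp {a} {ℓ} {f}) ≡ suc a
  h-after = go ℓ refl
    where
    go : ∀ ℓ′ → ℓ′ ≡ ℓ → V (after-sp {a} {ℓ} {f}) × h (after-sp {a} {ℓ} {f}) ≡ suc a
    go zero refl = tt , +-identityʳ (suc a)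
    go (suc ℓ′) refl = tt , +-identityʳ (suc a)

  step : ∀ x → V x → (V (σ x) × h (σ x) ≡ suc (h x)) ⊎ (suc (h x) ≡ c × σ x ≡ g⁰)
  step (sp (zip i zero p)) _ = inj₁ (proj₁ h-after , trans (proj₂ h-after) (sym (zip-last p)))
  step (sp (zip i (suc j) p)) _ = inj₁ (tt , refl)
  step (lo (zip i zero p) false) _ = inj₁ (tt , trans (cong (suc a +_) (trans (+-identityʳ ℓ) (sym (zip-last p)))) (+-suc (suc a) i))
  step (lo (zip i (suc j) p) false) _ = inj₁ (tt , +-suc (suc a) i)
  step (fr (zip i zero p)) _ = inj₂ (trans (sym (+-suc (suc a) _)) (cong (suc a +_) (trans (sym (+-suc ℓ i)) (cong (ℓ +_) (zip-last p)))) , refl)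
  step (fr (zip i (suc j) p)) _ = inj₁ (tt , trans (cong (suc a +_) (+-suc ℓ i)) (+-suc (suc a) _))

  module Lb = Labelled σ σ-injective c g⁰ V h tt refl bound step

  cover : ∀ x → (σ x ≡ x × x ≢ g⁰) ⊎ ∃[ i ] it σ i g⁰ ≡ x
  cover x@(sp z) = inj₂ (h x , Lb.cover x tt)
  cover (lo z true) = inj₁ (refl , λ ())
  cover x@(lo z false) = inj₂ (h x , Lb.cover x tt)
  cover x@(fr z) = inj₂ (h x , Lb.cover x tt)

  tile : ∀ p → 0 < p → p < c → Tile (suc a + (ℓ * 2 + suc f)) c
  tile p p>0 p<c = record
    { F = F ; r-order = rot-order ; g₀ = g⁰ ; tg₀ = refl ; c>0 = s≤s z≤n
    ; cycle = Lb.cycle ; minimal = Lb.minimal ; cover = cover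
    ; connected = λ P pr _ → rot-connected P pr ; p = p ; p>0 = p>0 ; p<c = p<c }

-- Tiles for j = 2: four special points, and two free points if there are loops

private
  τ₂ : ∀ {a ℓ f} → Gon⁺ a ℓ f → Gon⁺ a ℓ f
  τ₂ x = rot (rot (flipLoops (rot⁻ (rot⁻ x))))

  u₂ : ∀ {a ℓ f} → Gon⁺ a ℓ f → Gon⁺ a ℓ f
  u₂ x = flipLoops (τ₂ x)

  τ₂-fix : ∀ {a ℓ f} (x : Gon⁺ a ℓ f) → flipLoops (rot⁻ (rot⁻ x)) ≡ rot⁻ (rot⁻ x) → τ₂ x ≡ x
  τ₂-fix x p = trans (cong (rot ∘ rot) p) (trans (cong rot (rot-rot⁻ (rot⁻ x))) (rot-rot⁻ x))

  u₂-fix : ∀ {a ℓ f} (x : Gon⁺ a ℓ f) → flipLoops (rot⁻ (rot⁻ x)) ≡ rot⁻ (rot⁻ x) → flipLoops x ≡ x → u₂ (u₂ x) ≡ x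
  u₂-fix x p q = trans (cong u₂ u) u
    where
    u : u₂ x ≡ x
    u = trans (cong flipLoops (τ₂-fix x p)) q

  -- Only t moves the first loop, and only τ moves the first two free points, which are the image of
  -- the last loop under r²; on the later loops the two involutions agree. If there are loops, a
  -- second free point is needed to receive that image.
  tile-off : ∀ {ℓ f} → ℓ ≡ 0 ⊎ 0 < f → (x : Gon⁺ 3 ℓ f) → u₂ (u₂ x) ≡ x
  tile-off {f = suc f} _ x@(sp (zip 0 j p)) = u₂-fix x refl refl
  tile-off {zero} {zero} _ x@(sp (zip 0 j p)) = u₂-fix x refl refl
  tile-off {suc ℓ} {zero} (inj₁ ())
  tile-off {suc ℓ} {zero} (inj₂ ())
  tile-off _ x@(sp (zip 1 j p)) = u₂-fix x refl refl
  tile-off _ x@(sp (zip (suc (suc i)) j p)) = u₂-fix x refl refl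
  tile-off {suc ℓ} _ x@(lo z@(zip 0 j p) false) = trans (cong u₂ (cong flipLoops (τ₂-fix x refl))) (cong flipLoops (τ₂-fix (lo z true) refl))
  tile-off {suc ℓ} _ x@(lo z@(zip 0 j p) true) = trans (cong u₂ (cong flipLoops (τ₂-fix x refl))) (cong flipLoops (τ₂-fix (lo z false) refl))
  tile-off _ (lo (zip (suc i) j p) false) = refl
  tile-off _ (lo (zip (suc i) j p) true) = refl
  tile-off {zero} _ x@(fr (zip 0 j p)) = u₂-fix x refl refl
  tile-off {suc ℓ} {suc f} _ (fr (zip 0 j p)) = cong fr zip≡′
  tile-off {zero} _ x@(fr (zip 1 j p)) = u₂-fix x refl refl
  tile-off {suc ℓ} {suc f} _ (fr (zip 1 j p)) = cong fr zip≡′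
  tile-off _ x@(fr (zip (suc (suc i)) j p)) = u₂-fix x refl refl

  tile-g⁻ : ∀ {ℓ f} → ℓ ≡ 0 ⊎ 0 < f → flipLoops (rot⁻ (rot⁻ (g⁰ {3} {ℓ} {f}))) ≡ rot⁻ (rot⁻ g⁰)
  tile-g⁻ {f = suc f} _ = refl
  tile-g⁻ {zero} {zero} _ = refl
  tile-g⁻ {suc ℓ} {zero} (inj₁ ())
  tile-g⁻ {suc ℓ} {zero} (inj₂ ())

gonTile : ∀ ℓ f → ℓ ≡ 0 ⊎ 0 < f → IsoTile (4 + (ℓ * 2 + suc f)) (4 + (ℓ + suc f)) 2
gonTile ℓ f enough = record
  -- With p = 1 the four special points are `g₀`, the exit, and the images of these two under r².
  { M = GonTile.tile 3 ℓ f 1 (s≤s z≤n) (s≤s (s≤s z≤n))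
  ; tγ₀ = refl ; tγ₀⁻ = tile-g⁻ enough ; γ₀≢g₀ = λ () ; off = tile-off enough
  ; te = refl ; te⁺ = refl ; te⁻ = refl ; e≢γ₀ = λ () ; e⁺≢g₀ = λ () ; e⁺≢e = λ () }

-- The quadrilateral, with j = 1

squareTile : IsoTile 4 4 1
squareTile = record
  -- All four corners are fixed by the tile's t; p = 2 places the exit opposite to `g₀`.
  { M = GonTile.tile 2 0 0 2 (s≤s z≤n) (s≤s (s≤s (s≤s z≤n)))
  ; tγ₀ = refl ; tγ₀⁻ = refl ; γ₀≢g₀ = λ ()
  ; off = λ { (sp (zip 0 j p)) → cong sp zip≡′ ; (sp (zip 1 j p)) → refl ; (sp (zip (suc (suc i)) j p)) → refl ; (fr (zip 0 j p)) → cong fr zip≡′ ; (fr (zip (suc i) j p)) → refl }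
  ; te = refl ; te⁺ = refl ; te⁻ = refl ; e≢γ₀ = λ () ; e⁺≢g₀ = λ () ; e⁺≢e = λ () }

appendTile : ∀ {m n c j} → IsoTile m c j → IsoState m n j → IsoState m (n + c) j
appendTile D I = IsoGlue.isoGlue I D

open Zip using (before)

-- A product of disjoint transpositions

module _ {X : Set} (_≟_ : DecidableEquality X) where
  end₁ end₂ : Tr _≟_ → X
  end₁ = proj₁
  end₂ m = proj₁ (proj₂ m)

  Avoids : X → List (Tr _≟_) → Set
  Avoids x ts = ∀ m → m ∈ ts → x ≢ end₁ m × x ≢ end₂ m

  data Fresh : List (Tr _≟_) → Set where
    []  : Fresh []
    _∷_ : ∀ {m ts} → Avoids (end₁ m) ts × Avoids (end₂ m) ts → Fresh ts → Fresh (m ∷ ts)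

  swaps-miss : ∀ ts x → Avoids x ts → swaps _≟_ ts x ≡ x
  swaps-miss [] x u = refl
  swaps-miss (m@(a , b , _) ∷ ts) x u = trans (cong (swaps _≟_ ts) (swp-other _≟_ a b x (proj₁ (u m (here refl))) (proj₂ (u m (here refl)))))
    (swaps-miss ts x (λ m i → u m (there i)))

  swaps-hit : ∀ ts → Fresh ts → ∀ m → m ∈ ts → swaps _≟_ ts (end₁ m) ≡ end₂ m × swaps _≟_ ts (end₂ m) ≡ end₁ m
  swaps-hit ((a , b , _) ∷ ts) (new ∷ _) _ (here refl) =
    trans (cong (swaps _≟_ ts) (swp-left _≟_ a b)) (swaps-miss ts b (proj₂ new)) ,
    trans (cong (swaps _≟_ ts) (swp-right _≟_ a b)) (swaps-miss ts a (proj₁ new))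
  swaps-hit ((c , d , _) ∷ ts) ((new₁ , new₂) ∷ fs) m (there i) =
    trans (cong (swaps _≟_ ts) (swp-other _≟_ c d _ (≢-sym (proj₁ (new₁ m i))) (≢-sym (proj₁ (new₂ m i))))) (proj₁ (swaps-hit ts fs m i)) ,
    trans (cong (swaps _≟_ ts) (swp-other _≟_ c d _ (≢-sym (proj₂ (new₁ m i))) (≢-sym (proj₂ (new₂ m i))))) (proj₂ (swaps-hit ts fs m i))

  private
    find : ∀ ts x → (∃[ m ] (m ∈ ts × (x ≡ end₁ m ⊎ x ≡ end₂ m))) ⊎ Avoids x ts
    find [] x = inj₂ λ _ ()
    find (m ∷ ts) x with x ≟ end₁ m | x ≟ end₂ m | find ts x
    ... | yes q | _ | _ = inj₁ (m , here refl , inj₁ q)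
    ... | no _ | yes q | _ = inj₁ (m , here refl , inj₂ q)
    ... | no _ | no _ | inj₁ (m′ , i , q) = inj₁ (m′ , there i , q)
    ... | no u | no v | inj₂ w = inj₂ λ { _ (here refl) → u , v ; m (there i) → w m i }

  swaps-matching : ∀ (t : X → X) ts → Fresh ts → (∀ m → m ∈ ts → t (end₁ m) ≡ end₂ m × t (end₂ m) ≡ end₁ m) →
    (∀ x → Avoids x ts → t x ≡ x) → ∀ x → swaps _≟_ ts x ≡ t x
  swaps-matching t ts fs hit miss x with find ts x
  ... | inj₁ (m , i , inj₁ refl) = trans (proj₁ (swaps-hit ts fs m i)) (sym (proj₁ (hit m i)))
  ... | inj₁ (m , i , inj₂ refl) = trans (proj₂ (swaps-hit ts fs m i)) (sym (proj₂ (hit m i)))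
  ... | inj₂ u = trans (swaps-miss ts x u) (sym (miss x u))

-- The base of the chain: two gons with seven special points, joined by four transpositions

data Special : Zip 7 → Set where
  c₀ : Special (zip 0 6 refl)
  c₁ : Special (zip 1 5 refl)
  c₂ : Special (zip 2 4 refl)
  c₃ : Special (zip 3 3 refl)
  c₄ : Special (zip 4 2 refl)
  c₅ : Special (zip 5 1 refl)
  c₆ : Special (zip 6 0 refl)

special : ∀ z → Special z
special (zip 0 j p) = subst Special zip≡′ c₀
special (zip 1 j p) = subst Special zip≡′ c₁
special (zip 2 j p) = subst Special zip≡′ c₂
special (zip 3 j p) = subst Special zip≡′ c₃
special (zip 4 j p) = subst Special zip≡′ c₄
special (zip 5 j p) = subst Special zip≡′ c₅
special (zip 6 j p) = subst Special zip≡′ c₆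
special z@(zip (suc (suc (suc (suc (suc (suc (suc i))))))) j p) = ⊥-elim (<⇒≱ (zip-below z) (m≤m+n 7 i))

module Base (ℓ f′ : ℕ) where
  f : ℕ
  f = suc f′
  P : Set
  P = Gon⁺ 6 ℓ f
  X : Set
  X = Bool × P

  s₀ s₁ s₂ s₃ s₄ s₅ s₆ : P
  s₀ = sp (zip 0 6 refl)
  s₁ = sp (zip 1 5 refl)
  s₂ = sp (zip 2 4 refl)
  s₃ = sp (zip 3 3 refl)
  s₄ = sp (zip 4 2 refl)
  s₅ = sp (zip 5 1 refl)
  s₆ = sp (zip 6 0 refl)

  -- The pair at `s₅` is the edge y₁ y₂ of t. Under r² the pair `s₂`, `s₃` becomes the edge y₃ y₂ of
  -- τ, and the pair `s₀`, `s₁` becomes the pair `s₂`, `s₃`, on which t and τ thus agree.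
  t : X → X
  t (false , sp (zip 0 _ _)) = true , s₁
  t (false , sp (zip 2 _ _)) = true , s₃
  t (false , sp (zip 5 _ _)) = true , s₅
  t (false , sp (zip 6 _ _)) = true , s₆
  t (true , sp (zip 1 _ _)) = false , s₀
  t (true , sp (zip 3 _ _)) = false , s₂
  t (true , sp (zip 5 _ _)) = false , s₅
  t (true , sp (zip 6 _ _)) = false , s₆
  t (b , lo z c) = b , lo z (not c)
  t x = x

  data XView : X → Set where
    vs : ∀ b {z} → Special z → XView (b , sp z)
    vl : ∀ b z c → XView (b , lo z c)
    vf : ∀ b z → XView (b , fr z)

  xview : ∀ x → XView x
  xview (b , sp z) = vs b (special z)
  xview (b , lo z c) = vl b z c
  xview (b , fr z) = vf b z

  t-involutive : ∀ x → t (t x) ≡ x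
  t-involutive x with xview x
  ... | vs false c₀ = refl
  ... | vs false c₁ = refl
  ... | vs false c₂ = refl
  ... | vs false c₃ = refl
  ... | vs false c₄ = refl
  ... | vs false c₅ = refl
  ... | vs false c₆ = refl
  ... | vs true c₀ = refl
  ... | vs true c₁ = refl
  ... | vs true c₂ = refl
  ... | vs true c₃ = refl
  ... | vs true c₄ = refl
  ... | vs true c₅ = refl
  ... | vs true c₆ = refl
  ... | vl false z false = refl
  ... | vl false z true = refl
  ... | vl true z false = refl
  ... | vl true z true = refl
  ... | vf false z = refl
  ... | vf true z = refl

  abstract
    fin : X ↔ Fin (2 * (7 + (ℓ * 2 + suc f)))
    fin = ↔-sym FinP.*↔× ↔-∘ (↔-sym FinP.2↔Bool ×-↔ Gon↔Fin)

  R : Bij X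
  R = record
    { to = λ (b , x) → b , rot x ; from = λ (b , x) → b , rot⁻ x
    ; to-from = λ (b , x) → cong (b ,_) (rot-rot⁻ x) ; from-to = λ (b , x) → cong (b ,_) (rot⁻-rot x) }

  F : Frame
  F = record { X = X ; k = 2 * (7 + (ℓ * 2 + suc f)) ; fin = fin ; R = R ; t = t ; t-involutive = t-involutive }

  open Frame F using (_≟_; r; r⁻; σ; τ; T; σ-injective)

  α : Bool → X
  α false = true , s₂
  α true  = false , s₁

  -- The two long cycles of σ, labelled from the ports

  n : ℕ
  n = 7 + (ℓ + suc f)

  on : X → Maybe Bool
  on (false , sp (zip 1 _ _)) = just true
  on (false , sp (zip 2 _ _)) = just true
  on (false , sp (zip 6 _ _)) = just true
  on (true , sp (zip 2 _ _)) = just false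
  on (true , sp (zip 3 _ _)) = just false
  on (true , sp (zip 6 _ _)) = just false
  on (b , sp z) = just b
  on (b , lo z false) = just b
  on (b , lo z true) = nothing
  on (b , fr z) = just b

  label : X → ℕ
  label (false , sp (zip 0 _ _)) = 6 + (ℓ + suc f)
  label (false , sp (zip 1 _ _)) = 0
  label (false , sp (zip 2 _ _)) = 1
  label (false , sp (zip 3 _ _)) = 2
  label (false , sp (zip 4 _ _)) = 3
  label (false , sp (zip 5 _ _)) = 4
  label (false , sp (zip 6 _ _)) = 4
  label (true , sp (zip 0 _ _)) = 5 + (ℓ + suc f)
  label (true , sp (zip 1 _ _)) = 6 + (ℓ + suc f)
  label (true , sp (zip 2 _ _)) = 0
  label (true , sp (zip 3 _ _)) = 1
  label (true , sp (zip 4 _ _)) = 2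
  label (true , sp (zip 5 _ _)) = 3
  label (true , sp (zip 6 _ _)) = 5
  label (_ , sp _) = 0
  label (false , lo z _) = 6 + before z
  label (true , lo z _) = 5 + before z
  label (false , fr z) = 6 + (ℓ + before z)
  label (true , fr z) = 5 + (ℓ + before z)

  private
    low : ∀ {i} → i ≤ 6 → i < n
    low p = s≤s (≤-trans p (m≤m+n 6 _))

    bound : ∀ x → label x < n
    bound x with xview x
    ... | vs false c₀ = ≤-refl
    ... | vs false c₁ = low (z≤n)
    ... | vs false c₂ = low (s≤s z≤n)
    ... | vs false c₃ = low (s≤s (s≤s z≤n))
    ... | vs false c₄ = low (s≤s (s≤s (s≤s z≤n)))
    ... | vs false c₅ = low (s≤s (s≤s (s≤s (s≤s z≤n))))
    ... | vs false c₆ = low (s≤s (s≤s (s≤s (s≤s z≤n))))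
    ... | vs true c₀ = s≤s (n≤1+n _)
    ... | vs true c₁ = ≤-refl
    ... | vs true c₂ = low (z≤n)
    ... | vs true c₃ = low (s≤s z≤n)
    ... | vs true c₄ = low (s≤s (s≤s z≤n))
    ... | vs true c₅ = low (s≤s (s≤s (s≤s z≤n)))
    ... | vs true c₆ = low (s≤s (s≤s (s≤s (s≤s (s≤s z≤n)))))
    ... | vl false z _ = s≤s (+-monoʳ-≤ 6 (<⇒≤ (≤-trans (zip-below z) (m≤m+n ℓ (suc f)))))
    ... | vl true z _ = s≤s (≤-trans (+-monoʳ-≤ 5 (<⇒≤ (≤-trans (zip-below z) (m≤m+n ℓ (suc f))))) (n≤1+n _))
    ... | vf false z = s≤s (+-monoʳ-≤ 6 (<⇒≤ (+-monoʳ-< ℓ (zip-below z))))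
    ... | vf true z = s≤s (≤-trans (+-monoʳ-≤ 5 (<⇒≤ (+-monoʳ-< ℓ (zip-below z)))) (n≤1+n _))

    first : Bool → ℕ
    first false = 6
    first true  = 5

    on-after-sp : ∀ b → on (b , after-sp {6} {ℓ} {f}) ≡ just b × label (b , after-sp {6} {ℓ} {f}) ≡ first b
    on-after-sp = go ℓ refl
      where
      go : ∀ ℓ′ → ℓ′ ≡ ℓ → ∀ b → on (b , after-sp {6} {ℓ} {f}) ≡ just b × label (b , after-sp {6} {ℓ} {f}) ≡ first b
      go zero refl false = refl , refl
      go zero refl true = refl , refl
      go (suc ℓ′) refl false = refl , refl
      go (suc ℓ′) refl true = refl , refl

    step : ∀ b x → on x ≡ just b → (on (σ x) ≡ just b × label (σ x) ≡ suc (label x)) ⊎ (suc (label x) ≡ n × σ x ≡ α b)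
    step b x p with xview x
    step false _ refl | vs false c₀ = inj₂ (refl , refl)
    step true _ refl | vs false c₁ = inj₁ (refl , refl)
    step true _ refl | vs false c₂ = inj₁ (refl , refl)
    step false _ refl | vs false c₃ = inj₁ (refl , refl)
    step false _ refl | vs false c₄ = inj₁ (refl , refl)
    step false _ refl | vs false c₅ = inj₁ (refl , refl)
    step true _ refl | vs false c₆ = inj₁ (on-after-sp true)
    step true _ refl | vs true c₀ = inj₁ (refl , refl)
    step true _ refl | vs true c₁ = inj₂ (refl , refl)
    step false _ refl | vs true c₂ = inj₁ (refl , refl)
    step false _ refl | vs true c₃ = inj₁ (refl , refl)
    step true _ refl | vs true c₄ = inj₁ (refl , refl)
    step true _ refl | vs true c₅ = inj₁ (refl , refl)
    step false _ refl | vs true c₆ = inj₁ (on-after-sp false)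
    step false _ refl | vl false (zip i zero q) false = inj₁ (refl , cong (6 +_) (trans (+-identityʳ ℓ) (sym (zip-last q))))
    step false _ refl | vl false (zip i (suc j) q) false = inj₁ (refl , refl)
    step false _ refl | vf false (zip i zero q) = inj₁ (refl , cong (6 +_) (trans (cong (ℓ +_) (sym (zip-last q))) (+-suc ℓ i)))
    step false _ refl | vf false (zip i (suc j) q) = inj₁ (refl , cong (6 +_) (+-suc ℓ i))
    step true _ refl | vl true (zip i zero q) false = inj₁ (refl , cong (5 +_) (trans (+-identityʳ ℓ) (sym (zip-last q))))
    step true _ refl | vl true (zip i (suc j) q) false = inj₁ (refl , refl)
    step true _ refl | vf true (zip i zero q) = inj₁ (refl , cong (5 +_) (trans (cong (ℓ +_) (sym (zip-last q))) (+-suc ℓ i)))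
    step true _ refl | vf true (zip i (suc j) q) = inj₁ (refl , cong (5 +_) (+-suc ℓ i))
    step b _ () | vl true z true

    on-α : ∀ b → on (α b) ≡ just b
    on-α false = refl
    on-α true = refl

    label-α : ∀ b → label (α b) ≡ 0
    label-α false = refl
    label-α true = refl

    module Lb (b : Bool) = Labelled σ σ-injective n (α b) (λ x → on x ≡ just b) label (on-α b) (label-α b) (λ x _ → bound x) (step b)

    minimal : ∀ b b′ i → 0 < i → i < n → it σ i (α b) ≢ α b′
    minimal b b′ i a p q = go (trans (sym (Lb.visit b i p)) (trans (cong on q) (on-α b′)))
      where
      go : just b ≡ just b′ → ⊥
      go refl = Lb.minimal b i a p q

    along : ∀ b x → on x ≡ just b → σ x ≡ x ⊎ ∃[ b ] ∃[ i ] it σ i (α b) ≡ x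
    along b x p = inj₂ (b , label x , Lb.cover b x p)

    cover : ∀ x → σ x ≡ x ⊎ ∃[ b ] ∃[ i ] it σ i (α b) ≡ x
    cover x with xview x
    ... | vl false z true = inj₁ refl
    ... | vl true z true = inj₁ refl
    ... | vl false z false = along false _ refl
    ... | vl true z false = along true _ refl
    ... | vf false z = along false _ refl
    ... | vf true z = along true _ refl
    ... | vs false c₀ = along false _ refl
    ... | vs false c₁ = along true _ refl
    ... | vs false c₂ = along true _ refl
    ... | vs false c₃ = along false _ refl
    ... | vs false c₄ = along false _ refl
    ... | vs false c₅ = along false _ refl
    ... | vs false c₆ = along true _ refl
    ... | vs true c₀ = along true _ refl
    ... | vs true c₁ = along true _ refl
    ... | vs true c₂ = along false _ refl
    ... | vs true c₃ = along false _ refl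
    ... | vs true c₄ = along true _ refl
    ... | vs true c₅ = along true _ refl
    ... | vs true c₆ = along false _ refl

    copy-inj : ∀ (b : Bool) {x y : P} → (b , x) ≡ (b , y) → x ≡ y
    copy-inj b refl = refl

    _≟ᴾ_ : DecidableEquality P
    _≟ᴾ_ = decEq Gon↔Fin

    copyT : Bool → Tr _≟ᴾ_ → Tr _≟_
    copyT b = mapTr _≟ᴾ_ _≟_ (b ,_) (copy-inj b)

    same : ∀ b ts x → swaps _≟_ (map (copyT b) ts) (b , x) ≡ (b , swaps _≟ᴾ_ ts x)
    same b = swaps-map _≟ᴾ_ _≟_ (b ,_) (copy-inj b)

    other : ∀ b b′ ts x → b ≢ b′ → swaps _≟_ (map (copyT b) ts) (b′ , x) ≡ (b′ , x)
    other b b′ ts x ne = swaps-map-fix _≟ᴾ_ _≟_ (b ,_) (copy-inj b) ts _ (λ { _ refl → ne refl })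

    twice : Bij P → List (Tr _≟_)
    twice G = map (copyT false) (proj₁ (swapsOf Gon↔Fin G)) ++ map (copyT true) (proj₁ (swapsOf Gon↔Fin G))

    twice-even : ∀ G → Even (length (twice G))
    twice-even G = subst Even (sym (trans (length-++ (map (copyT false) ts)) (cong₂ _+_ (length-map _ ts) (length-map _ ts)))) (even-double (length ts))
      where ts = proj₁ (swapsOf Gon↔Fin G)

    twice-swaps : ∀ G b x → swaps _≟_ (twice G) (b , x) ≡ (b , to G x)
    twice-swaps G false x = trans (swaps-++ _≟_ (map (copyT false) ts) _ _) (trans (cong (swaps _≟_ (map (copyT true) ts)) (same false ts x))
      (trans (other true false ts _ (λ ())) (cong (false ,_) (proj₂ (swapsOf Gon↔Fin G) x))))
      where ts = proj₁ (swapsOf Gon↔Fin G)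
    twice-swaps G true x = trans (swaps-++ _≟_ (map (copyT false) ts) _ _) (trans (cong (swaps _≟_ (map (copyT true) ts)) (other false true ts x (λ ())))
      (trans (same true ts x) (cong (true ,_) (proj₂ (swapsOf Gon↔Fin G) x))))
      where ts = proj₁ (swapsOf Gon↔Fin G)

    cross : List (Tr _≟_)
    cross = ((false , s₀) , (true , s₁) , λ ()) ∷ ((false , s₂) , (true , s₃) , λ ())
          ∷ ((false , s₅) , (true , s₅) , λ ()) ∷ ((false , s₆) , (true , s₆) , λ ()) ∷ []

    flips : Bij P
    flips = involutionᵇ flipLoops flipLoops-involutive

    t× : X → X
    t× (b , sp z) = t (b , sp z)
    t× x = x

    cross-fresh : Fresh _≟_ cross
    cross-fresh =
      ((λ { _ (here refl) → (λ ()) , (λ ()) ; _ (there (here refl)) → (λ ()) , (λ ()) ; _ (there (there (here refl))) → (λ ()) , (λ ()) }) , (λ { _ (here refl) → (λ ()) , (λ ()) ; _ (there (here refl)) → (λ ()) , (λ ()) ; _ (there (there (here refl))) → (λ ()) , (λ ()) })) ∷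
      ((λ { _ (here refl) → (λ ()) , (λ ()) ; _ (there (here refl)) → (λ ()) , (λ ()) }) , (λ { _ (here refl) → (λ ()) , (λ ()) ; _ (there (here refl)) → (λ ()) , (λ ()) })) ∷
      ((λ { _ (here refl) → (λ ()) , (λ ()) }) , (λ { _ (here refl) → (λ ()) , (λ ()) })) ∷
      ((λ _ ()) , (λ _ ())) ∷
      []

    cross-pair : ∀ m → m ∈ cross → t× (proj₁ m) ≡ proj₁ (proj₂ m) × t× (proj₁ (proj₂ m)) ≡ proj₁ m
    cross-pair _ (here refl) = refl , refl
    cross-pair _ (there (here refl)) = refl , refl
    cross-pair _ (there (there (here refl))) = refl , refl
    cross-pair _ (there (there (there (here refl)))) = refl , refl

    cross-miss : ∀ x → Avoids _≟_ x cross → t× x ≡ x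
    cross-miss x u with xview x
    ... | vs false c₀ = ⊥-elim (proj₁ (u _ (here refl)) refl)
    ... | vs false c₁ = refl
    ... | vs false c₂ = ⊥-elim (proj₁ (u _ (there (here refl))) refl)
    ... | vs false c₃ = refl
    ... | vs false c₄ = refl
    ... | vs false c₅ = ⊥-elim (proj₁ (u _ (there (there (here refl)))) refl)
    ... | vs false c₆ = ⊥-elim (proj₁ (u _ (there (there (there (here refl))))) refl)
    ... | vs true c₀ = refl
    ... | vs true c₁ = ⊥-elim (proj₂ (u _ (here refl)) refl)
    ... | vs true c₂ = refl
    ... | vs true c₃ = ⊥-elim (proj₂ (u _ (there (here refl))) refl)
    ... | vs true c₄ = refl
    ... | vs true c₅ = ⊥-elim (proj₂ (u _ (there (there (here refl)))) refl)
    ... | vs true c₆ = ⊥-elim (proj₂ (u _ (there (there (there (here refl))))) refl)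
    ... | vl false z c = refl
    ... | vf false z = refl
    ... | vl true z c = refl
    ... | vf true z = refl

    cross-swaps : ∀ x → swaps _≟_ cross x ≡ t× x
    cross-swaps = swaps-matching _≟_ t× cross cross-fresh cross-pair cross-miss

    t-split : ∀ x → (proj₁ (t× x) , flipLoops (proj₂ (t× x))) ≡ t x
    t-split x with xview x
    ... | vs false c₀ = refl
    ... | vs false c₁ = refl
    ... | vs false c₂ = refl
    ... | vs false c₃ = refl
    ... | vs false c₄ = refl
    ... | vs false c₅ = refl
    ... | vs false c₆ = refl
    ... | vs true c₀ = refl
    ... | vs true c₁ = refl
    ... | vs true c₂ = refl
    ... | vs true c₃ = refl
    ... | vs true c₄ = refl
    ... | vs true c₅ = refl
    ... | vs true c₆ = refl
    ... | vl false z c = refl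
    ... | vf false z = refl
    ... | vl true z c = refl
    ... | vf true z = refl

    r-even : EvenF _≟_ r
    r-even = twice Rotᵇ , twice-even Rotᵇ , λ (b , x) → twice-swaps Rotᵇ b x

    t-even : EvenF _≟_ t
    t-even = cross ++ twice flips , subst Even (sym (length-++ cross {twice flips})) (even-+ (even-ss (even-ss even-zero)) (twice-even flips)) ,
      λ x → trans (swaps-++ _≟_ cross (twice flips) x) (trans (cong (swaps _≟_ (twice flips)) (cross-swaps x))
        (trans (twice-swaps flips (proj₁ (t× x)) (proj₂ (t× x))) (t-split x)))

    -- (t τ)² is trivial away from the three exceptional points.

    u : X → X
    u x = t (τ 2 x)

    fr₀ fr₁ : P
    fr₀ = fr (zip 0 f refl)
    fr₁ = fr (zip 1 f′ refl)

    -- What follows the special points and what precedes the free ones depends on whether there are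
    -- loops. With ℓ a parameter this does not reduce, so the two outcomes are recorded as
    -- equations.
    data Junction : Set where
      direct : before-fr {6} {ℓ} {f} ≡ s₆ → after-sp {6} {ℓ} {f} ≡ fr₀ → Junction
      looped : ∀ z → before-fr {6} {ℓ} {f} ≡ lo z true → rot {6} {ℓ} {f} (lo z true) ≡ fr₀ → Junction

    junction : Junction
    junction = go ℓ refl
      where
      go : ∀ ℓ′ → ℓ′ ≡ ℓ → Junction
      go zero refl = direct refl refl
      go (suc ℓ′) refl = looped (zip ℓ′ 0 (cong suc (+-comm ℓ′ 0))) refl refl

    after-lo : ∀ {a ℓ f j} .{p} → after-sp {a} {ℓ} {f} ≡ lo (zip 0 j p) false
    after-lo {ℓ = zero} {p = p} = ⊥-elim (<⇒≱ (zip-below (zip 0 _ p)) z≤n)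
    after-lo {ℓ = suc ℓ} = cong (λ z → lo z false) zip≡′

    -- The pairs at `s₅` and `s₆` are carried by r² to the first loop, so there τ changes the
    -- polygon while t flips the loop.
    loop₀ : ∀ b {j} .{p} → u (b , lo (zip 0 j p) false) ≡ (not b , lo (zip 0 j p) true)
    loop₀ false = cong (λ w → t (true , w)) after-lo
    loop₀ true = cong (λ w → t (false , w)) after-lo

    loop₁ : ∀ b {j} .{p} → u (b , lo (zip 0 j p) true) ≡ (not b , lo (zip 0 j p) false)
    loop₁ false {j} {p} = cong (λ w → t (true , rot w)) (after-lo {j = j} {p})
    loop₁ true {j} {p} = cong (λ w → t (false , rot w)) (after-lo {j = j} {p})

    -- Without loops it is the pairs at `s₅` and `s₆` that r² carries to the first two free points,
    -- and the orbit joins the two polygons; with loops it is the last loop, and the orbit stays in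
    -- one polygon.
    free₀ : ∀ b → u (u (b , fr₀)) ≡ (b , fr₀)
    free₀ b with junction
    ... | direct p q = trans (cong u (swap b)) (trans (swap (not b)) (back b))
      where
      swap : ∀ b → u (b , fr₀) ≡ (not b , fr₀)
      swap false = trans (cong (λ w → t (it r 2 (t (false , rot⁻ w)))) p) (cong (λ w → t (true , w)) q)
      swap true = trans (cong (λ w → t (it r 2 (t (true , rot⁻ w)))) p) (cong (λ w → t (false , w)) q)
      back : ∀ b → (not (not b) , fr₀) ≡ (b , fr₀)
      back false = refl
      back true = refl
    ... | looped z p q = trans (cong u (up b)) (down b)
      where
      up : ∀ b → u (b , fr₀) ≡ (b , fr₁)
      up false = trans (cong (λ w → t (it r 2 (t (false , rot⁻ w)))) p) (cong (λ w → t (false , rot w)) q)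
      up true = trans (cong (λ w → t (it r 2 (t (true , rot⁻ w)))) p) (cong (λ w → t (true , rot w)) q)
      down : ∀ b → u (b , fr₁) ≡ (b , fr₀)
      down false = trans (cong (λ w → t (it r 2 (t (false , w)))) p) (cong (λ w → t (false , w)) q)
      down true = trans (cong (λ w → t (it r 2 (t (true , w)))) p) (cong (λ w → t (true , w)) q)

    free₁ : ∀ b → u (u (b , fr₁)) ≡ (b , fr₁)
    free₁ b with junction
    ... | direct p q = trans (cong u (swap b)) (trans (swap (not b)) (back b))
      where
      swap : ∀ b → u (b , fr₁) ≡ (not b , fr₁)
      swap false = trans (cong (λ w → t (it r 2 (t (false , w)))) p) (cong (λ w → t (true , rot w)) q)
      swap true = trans (cong (λ w → t (it r 2 (t (true , w)))) p) (cong (λ w → t (false , rot w)) q)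
      back : ∀ b → (not (not b) , fr₁) ≡ (b , fr₁)
      back false = refl
      back true = refl
    ... | looped z p q = trans (cong u (down b)) (up b)
      where
      up : ∀ b → u (b , fr₀) ≡ (b , fr₁)
      up false = trans (cong (λ w → t (it r 2 (t (false , rot⁻ w)))) p) (cong (λ w → t (false , rot w)) q)
      up true = trans (cong (λ w → t (it r 2 (t (true , rot⁻ w)))) p) (cong (λ w → t (true , rot w)) q)
      down : ∀ b → u (b , fr₁) ≡ (b , fr₀)
      down false = trans (cong (λ w → t (it r 2 (t (false , w)))) p) (cong (λ w → t (false , w)) q)
      down true = trans (cong (λ w → t (it r 2 (t (true , w)))) p) (cong (λ w → t (true , w)) q)

    u² : ∀ x → ¬ Among (false , s₅) (true , s₅) (false , s₄) x → u (u x) ≡ x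
    u² x ny with xview x
    ... | vs false c₀ = refl
    ... | vs false c₁ = refl
    ... | vs false c₂ = refl
    ... | vs false c₃ = refl
    ... | vs false c₄ = ⊥-elim (ny (inj₂ (inj₂ refl)))
    ... | vs false c₅ = ⊥-elim (ny (inj₁ refl))
    ... | vs false c₆ = refl
    ... | vs true c₀ = refl
    ... | vs true c₁ = refl
    ... | vs true c₂ = refl
    ... | vs true c₃ = refl
    ... | vs true c₄ = refl
    ... | vs true c₅ = ⊥-elim (ny (inj₂ (inj₁ refl)))
    ... | vs true c₆ = refl
    ... | vl false (zip 0 j p) false = trans (cong u (loop₀ false {j} {p})) (loop₁ true {j} {p})
    ... | vl true (zip 0 j p) false = trans (cong u (loop₀ true {j} {p})) (loop₁ false {j} {p})
    ... | vl false (zip 0 j p) true = trans (cong u (loop₁ false {j} {p})) (loop₀ true {j} {p})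
    ... | vl true (zip 0 j p) true = trans (cong u (loop₁ true {j} {p})) (loop₀ false {j} {p})
    ... | vl false (zip (suc i) j p) false = refl
    ... | vl true (zip (suc i) j p) false = refl
    ... | vl false (zip (suc i) j p) true = refl
    ... | vl true (zip (suc i) j p) true = refl
    ... | vf b (zip 0 j p) = subst (λ z → u (u (b , fr z)) ≡ (b , fr z)) zip≡′ (free₀ b)
    ... | vf b (zip 1 j p) = subst (λ z → u (u (b , fr z)) ≡ (b , fr z)) zip≡′ (free₁ b)
    ... | vf false (zip (suc (suc i)) j p) = refl
    ... | vf true (zip (suc (suc i)) j p) = refl

    connected : ∀ (Q : X → Set) → (∀ x → Q x → Q (r x)) → (∀ x → Q x → Q (t x)) → Q (false , s₅) → ∀ x → Q x
    connected Q qr qt q₀ = λ { (false , x) → gon false q₀ x ; (true , x) → gon true (qt _ q₀) x }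
      where
      reach : ∀ b i → Q (b , s₅) → Q (b , it rot i s₅)
      reach b zero    q = q
      reach b (suc i) q = qr _ (reach b i q)
      close : it rot (2 + (ℓ * 2 + suc f)) s₅ ≡ g⁰
      close = trans (sym (it-+ rot (2 + (ℓ * 2 + suc f)) 5 g⁰))
        (trans (cong (λ i → it rot i g⁰) (+-comm (2 + (ℓ * 2 + suc f)) 5)) (rot-order g⁰))
      gon : ∀ b → Q (b , s₅) → ∀ x → Q (b , x)
      gon b q = rot-connected (λ x → Q (b , x)) (λ x → qr _) (subst (λ x → Q (b , x)) close (reach b (2 + (ℓ * 2 + suc f)) q))

  Port : X → Set
  Port x = ∃[ b ] x ≡ α b

  y₁ y₂ y₃ : X
  y₁ = false , s₅
  y₂ = true , s₅
  y₃ = false , s₄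

  module _ (path : List Move)
      (path-safe : ∀ x → Among y₁ y₂ y₃ x → Safe r r⁻ t Port path x × Safe r⁻ r t Port path (it r⁻ 2 x))
      (chiral : (Commuting (run r r⁻ t path) y₁ y₂ y₃ × Clashing (run r⁻ r t path) (it r⁻ 2 y₃) (it r⁻ 2 y₂) (it r⁻ 2 y₁))
              ⊎ (Clashing (run r r⁻ t path) y₁ y₂ y₃ × Commuting (run r⁻ r t path) (it r⁻ 2 y₃) (it r⁻ 2 y₂) (it r⁻ 2 y₁))) where

    local : Local F Port
    local = record
      { j = 2 ; q = 1 ; y₁ = y₁ ; y₂ = y₂ ; y₃ = y₃ ; y₁≢y₂ = λ () ; y₂≢y₃ = λ ()
      ; ty₁ = refl ; ty₃ = refl ; τy₁ = refl ; τy₂ = refl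
      ; y-safe = λ { _ (inj₁ refl) → (λ { (false , ()) ; (true , ()) }) , (λ { (false , ()) ; (true , ()) })
                   ; _ (inj₂ (inj₁ refl)) → (λ { (false , ()) ; (true , ()) }) , (λ { (false , ()) ; (true , ()) })
                   ; _ (inj₂ (inj₂ refl)) → (λ { (false , ()) ; (true , ()) }) , (λ { (false , ()) ; (true , ()) }) }
      -- Here r y₃ = y₁, so applying r to y₃ ∼ y₁ suffices.
      ; linked = λ _∼_ rf sy tr rr tt p q → rr (sy (tr p q))
      ; path = path ; path-safe = path-safe ; chiral = chiral }

    state : State (7 + (ℓ * 2 + suc f)) n
    state = record
      { B = F ; αᴮ = α ; L = local ; F = F
      ; E = record { inj = λ x → x ; inj-injective = λ p → p ; inj-r = λ _ → refl ; inj-t = λ _ _ → refl }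
      ; m>0 = s≤s z≤n
      ; r-order = λ (b , x) → trans (it-inj (b ,_) {f = rot} {g = r} (λ _ → refl) (7 + (ℓ * 2 + suc f)) x) (cong (b ,_) (rot-order x))
      ; r-exact = (false , g⁰) , λ i a p q → rot-exact i a p (copy-inj false (trans (sym (it-inj (false ,_) {f = rot} {g = r} (λ _ → refl) i g⁰)) q))
      ; r-even = r-even ; t-even = t-even ; α = α
      ; α-port = λ x np b q → np (b , q) ; α-sep = λ ()
      ; tα = λ { false → refl ; true → refl }
      ; n>1 = s≤s (s≤s z≤n) ; cycle = Lb.cycle ; minimal = minimal ; cover = cover
      ; off = λ x ny → trans (cong (λ z → u (u z)) (u² x ny)) (u² x ny)
      ; connected = connected }

    isoState : IsoState (7 + (ℓ * 2 + suc f)) n 2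
    isoState = record
      { S = state ; j≡ = refl ; h = 2 ; K-even = refl
      ; tγ = λ { false → refl ; true → refl } ; tγ⁻ = λ { false → refl ; true → refl }
      ; γ≢α = λ { false false () ; false true () ; true false () ; true true () }
      ; α∉Y = λ { false (inj₁ ()) ; false (inj₂ (inj₁ ())) ; false (inj₂ (inj₂ ())) ; true (inj₁ ()) ; true (inj₂ (inj₁ ())) ; true (inj₂ (inj₂ ())) }
      ; γ∉Y = λ { false (inj₁ ()) ; false (inj₂ (inj₁ ())) ; false (inj₂ (inj₂ ())) ; true (inj₁ ()) ; true (inj₂ (inj₁ ())) ; true (inj₂ (inj₂ ())) } }

private
  away : ∀ {ℓ f′ x} → Base.α ℓ f′ false ≢ x → Base.α ℓ f′ true ≢ x → ¬ Base.Port ℓ f′ x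
  away u v (false , p) = u (sym p)
  away u v (true , p) = v (sym p)

baseState : ∀ ℓ f′ → IsoState (7 + (ℓ * 2 + suc (suc f′))) (7 + (ℓ + suc (suc f′))) 2
-- The path is r³ t r⁻³. It carries the three points to free points, fixed by t, and hence fixes
-- them. In the mirror image it brings r⁻² y₁ to `s₀` of the first polygon, from where t leads into
-- the second one, while r⁻² y₂ is fixed.
baseState zero f′ = Base.isoState zero f′ (fw ∷ fw ∷ fw ∷ fl ∷ bw ∷ bw ∷ bw ∷ [])
  (λ { _ (inj₁ refl) → (away (λ ()) (λ ()) , tt) , (away (λ ()) (λ ()) , tt)
     ; _ (inj₂ (inj₁ refl)) → (away (λ ()) (λ ()) , tt) , (away (λ ()) (λ ()) , tt)
     ; _ (inj₂ (inj₂ refl)) → (away (λ ()) (λ ()) , tt) , (away (λ ()) (λ ()) , tt) })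
  (inj₁ (inj₂ (refl , refl , refl) , inj₂ (inj₁ (inj₂ (inj₁ refl) , λ { (inj₁ ()) ; (inj₂ (inj₁ ())) ; (inj₂ (inj₂ ())) }))))
-- The path is r⁴ t r⁻². It turns y₃ around on the first loop and takes it to y₁, but leaves y₁ on
-- that loop: a clash. In the mirror image it applies t only at fixed points and moves the whole
-- triple off itself. The clause for more loops differs in that r⁴ y₁ is then on the second loop
-- instead of being free.
baseState (suc zero) f′ = Base.isoState 1 f′ (fw ∷ fw ∷ fw ∷ fw ∷ fl ∷ bw ∷ bw ∷ [])
  (λ { _ (inj₁ refl) → (away (λ ()) (λ ()) , tt) , (away (λ ()) (λ ()) , tt)
     ; _ (inj₂ (inj₁ refl)) → (away (λ ()) (λ ()) , tt) , (away (λ ()) (λ ()) , tt)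
     ; _ (inj₂ (inj₂ refl)) → (away (λ ()) (λ ()) , tt) , (away (λ ()) (λ ()) , tt) })
  (inj₂ (inj₂ (inj₂ (inj₁ refl , λ { (inj₁ ()) ; (inj₂ (inj₁ ())) ; (inj₂ (inj₂ ())) })) ,
    inj₁ ((λ { (inj₁ ()) ; (inj₂ (inj₁ ())) ; (inj₂ (inj₂ ())) }) , (λ { (inj₁ ()) ; (inj₂ (inj₁ ())) ; (inj₂ (inj₂ ())) }) , (λ { (inj₁ ()) ; (inj₂ (inj₁ ())) ; (inj₂ (inj₂ ())) }))))
baseState (suc (suc ℓ)) f′ = Base.isoState (suc (suc ℓ)) f′ (fw ∷ fw ∷ fw ∷ fw ∷ fl ∷ bw ∷ bw ∷ [])
  (λ { _ (inj₁ refl) → (away (λ ()) (λ ()) , tt) , (away (λ ()) (λ ()) , tt)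
     ; _ (inj₂ (inj₁ refl)) → (away (λ ()) (λ ()) , tt) , (away (λ ()) (λ ()) , tt)
     ; _ (inj₂ (inj₂ refl)) → (away (λ ()) (λ ()) , tt) , (away (λ ()) (λ ()) , tt) })
  (inj₂ (inj₂ (inj₂ (inj₁ refl , λ { (inj₁ ()) ; (inj₂ (inj₁ ())) ; (inj₂ (inj₂ ())) })) ,
    inj₁ ((λ { (inj₁ ()) ; (inj₂ (inj₁ ())) ; (inj₂ (inj₂ ())) }) , (λ { (inj₁ ()) ; (inj₂ (inj₁ ())) ; (inj₂ (inj₂ ())) }) , (λ { (inj₁ ()) ; (inj₂ (inj₁ ())) ; (inj₂ (inj₂ ())) }))))

-- Triangles: the tile consists of three triangles g, h, k (points 0-2, 3-5, 6-8) in a row, and j = 1.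

module Triangles where
  Z : Set
  Z = Fin 9

  r r⁻ t : Z → Z
  r 0F = 1F
  r 1F = 2F
  r 2F = 0F
  r 3F = 4F
  r 4F = 5F
  r 5F = 3F
  r 6F = 7F
  r 7F = 8F
  r 8F = 6F
  r⁻ 0F = 2F
  r⁻ 1F = 0F
  r⁻ 2F = 1F
  r⁻ 3F = 5F
  r⁻ 4F = 3F
  r⁻ 5F = 4F
  r⁻ 6F = 8F
  r⁻ 7F = 6F
  r⁻ 8F = 7F
  t 2F = 3F
  t 3F = 2F
  t 4F = 6F
  t 6F = 4F
  t x  = x

  F : Frame
  F = record
    { X = Z ; k = 9 ; fin = record { to = λ x → x ; from = λ x → x ; to-cong = λ p → p ; from-cong = λ p → p ; inverse = (λ p → p) , (λ p → p) }
    ; R = record { to = r ; from = r⁻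
                 ; to-from = from-yes (FinP.all? λ x → r (r⁻ x) FinP.≟ x)
                 ; from-to = from-yes (FinP.all? λ x → r⁻ (r x) FinP.≟ x) }
    ; t = t ; t-involutive = from-yes (FinP.all? λ x → t (t x) FinP.≟ x) }

  σ : Z → Z
  σ = Frame.σ F

  index : Z → ℕ
  index 0F = 0
  index 1F = 1
  index 2F = 2
  index 4F = 3
  index 7F = 4
  index 8F = 5
  index 6F = 6
  index 5F = 7
  index 3F = 8

  tile : Tile 3 9
  tile = record
    { F = F ; r-order = from-yes (FinP.all? λ x → it r 3 x FinP.≟ x) ; g₀ = 0F ; tg₀ = refl ; c>0 = s≤s z≤n
    ; cycle = refl
    ; minimal = λ { 1 _ _ () ; 2 _ _ () ; 3 _ _ () ; 4 _ _ () ; 5 _ _ () ; 6 _ _ () ; 7 _ _ () ; 8 _ _ ()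
                  ; (suc (suc (suc (suc (suc (suc (suc (suc (suc i))))))))) _ (s≤s (s≤s (s≤s (s≤s (s≤s (s≤s (s≤s (s≤s (s≤s ()))))))))) }
    ; cover = λ x → inj₂ (index x , from-yes (FinP.all? λ x → it σ (index x) 0F FinP.≟ x) x)
    ; connected = λ P pr pt p → let q : ∀ i → P (it σ i 0F)
                                    q = λ i → walk P pr pt p i
                                in λ x → subst P (from-yes (FinP.all? λ x → it σ (index x) 0F FinP.≟ x) x) (q (index x))
    -- The exit is point 7. It is exchanged with 5 by τ, its image under r is 8, and t fixes 5, 7
    -- and 8, as the next gluing demands.
    ; p = 4 ; p>0 = s≤s z≤n ; p<c = s≤s (s≤s (s≤s (s≤s (s≤s z≤n)))) }
    where
    walk : ∀ (P : Z → Set) → (∀ x → P x → P (r x)) → (∀ x → P x → P (t x)) → P 0F → ∀ i → P (it σ i 0F)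
    walk P pr pt p zero    = p
    walk P pr pt p (suc i) = pr _ (pt _ (walk P pr pt p i))

-- The translate r⁻¹ α is allowed to be moved by t. Then τ joins α to a second point β fixed by t,
-- so {α, β} is an orbit of ⟨t, τ⟩, while γ is still fixed by both.
record TriState (m n : ℕ) : Set₁ where
  field
    S : State m n
  open State S public
  open Frame F
  β : Bool → X
  β = λ b → τ 1 (α b)
  γ : Bool → X
  γ = λ b → r (α b)
  field
    j≡ : Local.j L ≡ 1
    h  : ℕ
    K-ten : suc (Local.q L * 3) ≡ h * 10
    tβ  : ∀ b → t (β b) ≡ β b
    tγ  : ∀ b → t (γ b) ≡ γ b
    α≢β : ∀ b b′ → α b ≢ β b′
    α≢γ : ∀ b b′ → α b ≢ γ b′
    β≢γ : ∀ b b′ → β b ≢ γ b′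
    α∉Y : ∀ b → ¬ Y (α b)
    β∉Y : ∀ b → ¬ Y (β b)
    γ∉Y : ∀ b → ¬ Y (γ b)

module TriGlue {n : ℕ} (I : TriState 3 n) where
  private
    module I = TriState I
  open Glue I.S Triangles.tile hiding (module S; module M)
  open I using (α; β; γ)

  private
    z : Bool → Fin 9 → X
    z b i = inj₂ (b , i)

    Fττ : ∀ x → F.τ 1 (F.τ 1 x) ≡ x
    Fττ x = trans (cong (F.r ∘ F.t) (from-to F.R _)) (trans (cong F.r (F.t-involutive _)) (to-from F.R x))
    Fτγ : ∀ b → F.τ 1 (γ b) ≡ γ b
    Fτγ b = cong F.r (trans (cong F.t (from-to F.R _)) (I.tα b))
    Fτ-inj : ∀ {x y} → F.τ 1 x ≡ F.τ 1 y → x ≡ y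
    Fτ-inj {x} {y} p = trans (sym (Fττ x)) (trans (cong (F.τ 1) p) (Fττ y))

    τ-old : ∀ x → (∀ b → x ≢ γ b) → G.τ 1 (inj₁ x) ≡ inj₁ (F.τ 1 x)
    τ-old x ne = cong G.r (t-old _ (λ b p → ne b (trans (sym (to-from F.R x)) (cong F.r p))))

    τ-γ : ∀ b → G.τ 1 (inj₁ (γ b)) ≡ z b 1F
    τ-γ b = cong G.r (trans (cong (t ∘ inj₁) (from-to F.R _)) (t-α b))

    τ-α : ∀ b → G.τ 1 (inj₁ (α b)) ≡ inj₁ (β b)
    τ-α b = τ-old _ (I.α≢γ b)

    τ-β : ∀ b → G.τ 1 (inj₁ (β b)) ≡ inj₁ (α b)
    τ-β b = trans (τ-old _ (I.β≢γ b)) (cong inj₁ (Fττ _))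

    u′ : X → X
    u′ x = t (G.τ 1 x)

    uβ : ∀ b → u′ (inj₁ (β b)) ≡ z b 0F
    uβ b = trans (cong t (τ-β b)) (t-α b)
    u0 : ∀ b → u′ (z b 0F) ≡ z b 6F
    u0 b = refl
    u6 : ∀ b → u′ (z b 6F) ≡ z b 4F
    u6 b = refl
    u4 : ∀ b → u′ (z b 4F) ≡ inj₁ (α b)
    u4 b = t-g₀ b
    uα : ∀ b → u′ (inj₁ (α b)) ≡ inj₁ (β b)
    uα b = trans (cong t (τ-α b)) (trans (t-old _ (λ b′ p → I.α≢β b′ b (sym p))) (cong inj₁ (I.tβ b)))
    uγ : ∀ b → u′ (inj₁ (γ b)) ≡ z b 1F
    uγ b = cong t (τ-γ b)
    u1 : ∀ b → u′ (z b 1F) ≡ inj₁ (γ b)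
    u1 b = trans (cong (t ∘ G.r) (t-g₀ b)) (trans (t-old _ (λ b′ p → I.α≢γ b′ b (sym p))) (cong inj₁ (I.tγ b)))

    five : ∀ {a b c d e′} → u′ a ≡ b → u′ b ≡ c → u′ c ≡ d → u′ d ≡ e′ → u′ e′ ≡ a → it u′ 5 a ≡ a
    five refl refl refl refl q = q

    K : ℕ
    K = suc (Local.q I.L * 3)

    by5 : ∀ x → it u′ 5 x ≡ x → it u′ K x ≡ x
    by5 x p = trans (cong (λ i → it u′ i x) I.K-ten) (it-* u′ I.h 10 x (it-* u′ 2 5 x p))
    by2 : ∀ x → it u′ 2 x ≡ x → it u′ K x ≡ x
    by2 x p = trans (cong (λ i → it u′ i x) I.K-ten) (it-* u′ I.h 10 x (it-* u′ 5 2 x p))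

    Good : F.X → Set
    Good x = (∀ b → x ≢ α b) × (∀ b → x ≢ β b) × (∀ b → x ≢ γ b)

    good-step : ∀ x → Good x → Good (F.t (F.τ 1 x))
    good-step x (a , b , c) =
      (λ i p → b i (trans (sym (Fττ x)) (cong (F.τ 1) (F.t-injective (trans p (sym (I.tα i))))))) ,
      (λ i p → a i (Fτ-inj (F.t-injective (trans p (sym (I.tβ i)))))) ,
      (λ i p → c i (Fτ-inj (trans (F.t-injective (trans p (sym (I.tγ i)))) (sym (Fτγ i)))))

    good-it : ∀ i x → Good x → Good (it (λ x → F.t (F.τ 1 x)) i x)
    good-it zero    x g = g
    good-it (suc i) x g = good-step _ (good-it i x g)

    old-it : ∀ i x → Good x → it u′ i (inj₁ x) ≡ inj₁ (it (λ x → F.t (F.τ 1 x)) i x)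
    old-it zero    x g = refl
    old-it (suc i) x g = trans (cong u′ (old-it i x g)) (trans (cong t (τ-old _ (proj₂ (proj₂ (good-it i x g)))))
      (t-old _ (λ b p → proj₁ (proj₂ (good-it i x g)) b (trans (sym (Fττ _)) (cong (F.τ 1) p)))))

    is? : (δ : Bool → F.X) → ∀ x → Dec (∃[ b ] x ≡ δ b)
    is? δ x with x F.≟ δ false | x F.≟ δ true
    ... | yes p | _ = yes (false , p)
    ... | no _ | yes p = yes (true , p)
    ... | no u | no v = no λ { (false , p) → u p ; (true , p) → v p }

  -- The orbit {α, β} grows to the cycle α, β, 0, 6, 4 of t τ, of length five; γ pairs with 1, and
  -- the remaining points of the tile lie in orbits of size at most two. An exponent divisible by 10
  -- kills them all.
  off′ : ∀ x → ¬ Y x → it u′ K x ≡ x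
  off′ (inj₂ (b , 0F)) _ = by5 _ (five (u0 b) (u6 b) (u4 b) (uα b) (uβ b))
  off′ (inj₂ (b , 1F)) _ = by2 _ (trans (cong u′ (u1 b)) (uγ b))
  off′ (inj₂ (b , 2F)) _ = by2 _ refl
  off′ (inj₂ (b , 3F)) _ = by2 _ refl
  off′ (inj₂ (b , 4F)) _ = by5 _ (five (u4 b) (uα b) (uβ b) (u0 b) (u6 b))
  off′ (inj₂ (b , 5F)) _ = by2 _ refl
  off′ (inj₂ (b , 6F)) _ = by5 _ (five (u6 b) (u4 b) (uα b) (uβ b) (u0 b))
  off′ (inj₂ (b , 7F)) _ = by2 _ refl
  off′ (inj₂ (b , 8F)) _ = by2 _ refl
  off′ (inj₁ x) ny with is? α x | is? β x | is? γ x
  ... | yes (b , refl) | _ | _ = by5 _ (five (uα b) (uβ b) (u0 b) (u6 b) (u4 b))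
  ... | no _ | yes (b , refl) | _ = by5 _ (five (uβ b) (u0 b) (u6 b) (u4 b) (uα b))
  ... | no _ | no _ | yes (b , refl) = by2 _ (trans (cong u′ (uγ b)) (u1 b))
  ... | no na | no nb | no nc = trans (old-it K x ((λ b p → na (b , p)) , (λ b p → nb (b , p)) , (λ b p → nc (b , p))))
      (cong inj₁ (subst (λ i → it (λ x → F.t (F.τ i x)) K x ≡ x) I.j≡ (I.off x
        (λ { (inj₁ p) → ny (inj₁ (cong inj₁ p)) ; (inj₂ (inj₁ p)) → ny (inj₂ (inj₁ (cong inj₁ p))) ; (inj₂ (inj₂ p)) → ny (inj₂ (inj₂ (cong inj₁ p))) }))))

  triGlue : TriState 3 (n + 9)
  triGlue = record
    { S = glue refl (subst (λ i → ∀ x → ¬ Y x → it (λ x → t (G.τ i x)) K x ≡ x) (sym I.j≡) off′)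
    ; j≡ = I.j≡ ; h = I.h ; K-ten = I.K-ten
    ; tβ = λ _ → refl ; tγ = λ _ → refl
    ; α≢β = λ _ _ () ; α≢γ = λ _ _ () ; β≢γ = λ _ _ ()
    ; α∉Y = λ { b (inj₁ ()) ; b (inj₂ (inj₁ ())) ; b (inj₂ (inj₂ ())) }
    ; β∉Y = λ { b (inj₁ ()) ; b (inj₂ (inj₁ ())) ; b (inj₂ (inj₂ ())) }
    ; γ∉Y = λ { b (inj₁ ()) ; b (inj₂ (inj₁ ())) ; b (inj₂ (inj₂ ())) } }

-- Finite examples

-- r rotates G disjoint m-gons and fixes x further points; t is the product of the transpositions in pairs.
-- Each link is a word that moves {y₁, y₂} or {y₂, y₃} to an edge of a chain from y₁ to r y₁. Conjugation by the word path
-- gives a commuting pair of 3-cycles in the map and a non-commuting one in its mirror image, or conversely, according to side.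

record Datum : Set where
  constructor datum
  field
    m n G x : ℕ
    pairs   : List (ℕ × ℕ)
    j       : ℕ
    y₁ y₂ y₃ : ℕ
    q       : ℕ
    links   : List (List ℕ × Bool × Bool)
    path    : List ℕ
    side    : Bool
    α₀ α₁   : ℕ

-- The tables below write lists as numbers: after a leading 1, every two digits are one entry.
digits : ℕ → List ℕ
digits n = go 100 n []
  where
  go : ℕ → ℕ → List ℕ → List ℕ
  go zero    n ds = ds
  go (suc l) n ds = if n <ᵇ 100 then ds else go l (n / 100) (n % 100 ∷ ds)

pairUp : List ℕ → List (ℕ × ℕ)
pairUp (a ∷ b ∷ ds) = (a , b) ∷ pairUp ds
pairUp _            = []

-- The first entry holds two flags: which of the two edges is moved, and whether it is traversed backwards.
linkOf : List ℕ → List ℕ × Bool × Bool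
linkOf []       = [] , false , false
linkOf (c ∷ ds) = ds , (9 <ᵇ c) , (c % 10 ≡ᵇ 1)

entry : (m n G x pairs j y₁ y₂ y₃ q : ℕ) → List ℕ → (path : ℕ) → Bool → (α₀ α₁ : ℕ) → Datum
entry m n G x pairs j y₁ y₂ y₃ q links path side α₀ α₁ =
  datum m n G x (pairUp (digits pairs)) j y₁ y₂ y₃ q (map (linkOf ∘ digits) links) (digits path) side α₀ α₁

swapℕ : List (ℕ × ℕ) → ℕ → ℕ
swapℕ []             v = v
swapℕ ((a , b) ∷ ps) v = swapℕ ps (if v ≡ᵇ a then b else if v ≡ᵇ b then a else v)

-- The same list is read in two ways: `swapℕ` composes the transpositions, as parity requires, while
-- `matchℕ` looks up the partner of a point. `checkEven` verifies that they agree.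
matchℕ : List (ℕ × ℕ) → ℕ → ℕ
matchℕ []             v = v
matchℕ ((a , b) ∷ ps) v = if v ≡ᵇ a then b else if v ≡ᵇ b then a else matchℕ ps v

-- With this value at 0, a positive number does not count as divisible by 0, which `it-mod` relies
-- on.
mod : ℕ → ℕ → ℕ
mod a zero    = a
mod a (suc b) = a % suc b

repeat : {A : Set} → ℕ → A → List A → List A
repeat zero    a as = as
repeat (suc n) a as = a ∷ repeat n a as

-- e₁ ∷ e₂ ∷ … stands for r^e₁, then t, then r^e₂, and so on.
moves : List ℕ → List Move
moves []       = []
moves (i ∷ is) = repeat i fw (rest is)
  where
  rest : List ℕ → List Move
  rest []       = []
  rest (i ∷ is) = fl ∷ repeat i fw (rest is)

all< : ℕ → (ℕ → Bool) → Bool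
all< zero    p = true
all< (suc k) p = p k ∧ all< k p

-- The test starts at `f v` and not at v, so it covers exactly the iterates 1 to n.
along : ℕ → (ℕ → ℕ) → ℕ → (ℕ → Bool) → Bool
along zero    f v p = true
along (suc n) f v p = p (f v) ∧ along n f (f v) p

orbit : ℕ → (ℕ → ℕ) → ℕ → List ℕ
orbit zero    f v = []
orbit (suc n) f v = v ∷ orbit n f (f v)

-- The length of the f-cycle through v divides K; the argument w is the i-th iterate of v.
home : (ℕ → ℕ) → ℕ → ℕ → ℕ → ℕ → ℕ → Bool
home f K zero    i v w = false
home f K (suc l) i v w = if w ≡ᵇ v then mod K i ≡ᵇ 0 else home f K l (suc i) v (f w)

mem : ℕ → List ℕ → Bool
mem v = any (v ≡ᵇ_)

evenᵇ : ℕ → Bool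
evenᵇ zero          = true
evenᵇ (suc zero)    = false
evenᵇ (suc (suc n)) = evenᵇ n

∧₁ : ∀ {a b} → True (a ∧ b) → True a
∧₁ p = proj₁ (Equivalence.to T-∧ p)
∧₂ : ∀ {a b} → True (a ∧ b) → True b
∧₂ {a} p = proj₂ (Equivalence.to (T-∧ {a}) p)
T-not : ∀ {b} → True (not b) → ¬ True b
T-not {false} _ ()

all<-sound : ∀ k p → True (all< k p) → ∀ v → v < k → True (p v)
all<-sound (suc k) p c v h with m<1+n⇒m<n∨m≡n h
... | inj₁ h′ = all<-sound k p (∧₂ {p k} c) v h′
... | inj₂ refl = ∧₁ c

along-sound : ∀ n f v p → True (along n f v p) → ∀ i → 0 < i → i ≤ n → True (p (it f i v))
along-sound (suc n) f v p c (suc zero) _ _ = ∧₁ c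
along-sound (suc n) f v p c (suc (suc i)) _ (s≤s h) =
  subst (True ∘ p) (sym (it-shift f (suc i) v)) (along-sound n f (f v) p (∧₂ {p (f v)} c) (suc i) (s≤s z≤n) h)

orbit-sound : ∀ n f v w → True (mem w (orbit n f v)) → ∃[ i ] it f i v ≡ w
orbit-sound (suc n) f v w c with Equivalence.to (T-∨ {w ≡ᵇ v}) c
... | inj₁ q = 0 , sym (≡ᵇ⇒≡ w v q)
... | inj₂ q with orbit-sound n f (f v) w q
...   | (i , eq) = suc i , trans (it-shift f i v) eq

home-sound : ∀ f K l i v → True (home f K l i v (it f i v)) → ∃[ i ] (it f i v ≡ v × mod K i ≡ 0)
home-sound f K (suc l) i v c with it f i v ≡ᵇ v in q
... | true  = i , ≡ᵇ⇒≡ _ v (subst True (sym q) tt) , ≡ᵇ⇒≡ _ 0 c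
... | false = home-sound f K l (suc i) v c

even-sound : ∀ n → True (evenᵇ n) → Even n
even-sound zero          _ = even-zero
even-sound (suc (suc n)) p = even-ss (even-sound n p)

it-mod : ∀ {X : Set} (f : X → X) K l x → mod K l ≡ 0 → it f l x ≡ x → it f K x ≡ x
it-mod f zero    l       x p q = refl
it-mod f (suc K) zero    x () q
it-mod f K@(suc _) (suc l) x p q = trans (cong (λ a → it f a x) (trans (m≡m%n+[m/n]*n K (suc l)) (cong (_+ K / suc l * suc l) p)))
  (it-* f (K / suc l) (suc l) x q)

-- All tests are Boolean computations with plain numbers; `Sound` carries their outcome over to
-- `Fin k`.
module Check (d : Datum) (isPort : ℕ → Bool) where
  open Datum d

  g k K : ℕ
  g = G * m
  k = g + x
  K = suc (q * 3)

  rN r⁻N tN σN τN uN : ℕ → ℕ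
  rN v = if v <ᵇ g then (if mod (suc v) m ≡ᵇ 0 then suc v ∸ m else suc v) else v
  r⁻N v = if v <ᵇ g then (if mod v m ≡ᵇ 0 then (v + m) ∸ 1 else v ∸ 1) else v
  tN = matchℕ pairs
  σN v = rN (tN v)
  τN v = it rN j (tN (it r⁻N j v))
  uN v = tN (τN v)

  -- Each m-cycle is the product, in this order, of the transpositions of its first point with the
  -- second, the third, and so on.
  rotations : ℕ → List (ℕ × ℕ)
  rotations zero    = []
  rotations (suc i) = gon (m ∸ 1) (rotations i)
    where
    gon : ℕ → List (ℕ × ℕ) → List (ℕ × ℕ)
    gon zero    ps = ps
    gon (suc l) ps = gon l ((i * m , i * m + suc l) ∷ ps)

  isY : ℕ → Bool
  isY v = (v ≡ᵇ y₁) ∨ ((v ≡ᵇ y₂) ∨ (v ≡ᵇ y₃))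

  amongᵇ : ℕ → ℕ → ℕ → ℕ → Bool
  amongᵇ a b c v = (v ≡ᵇ a) ∨ ((v ≡ᵇ b) ∨ (v ≡ᵇ c))

  okPairs : List (ℕ × ℕ) → Bool
  okPairs = all λ (a , b) → (a <ᵇ k) ∧ ((b <ᵇ k) ∧ not (a ≡ᵇ b))

  safeN : (ℕ → ℕ) → (ℕ → ℕ) → List Move → ℕ → Bool
  safeN f f⁻ []       v = true
  safeN f f⁻ (fw ∷ p) v = safeN f f⁻ p (f v)
  safeN f f⁻ (bw ∷ p) v = safeN f f⁻ p (f⁻ v)
  safeN f f⁻ (fl ∷ p) v = not (isPort v) ∧ safeN f f⁻ p (tN v)

  runN r̄unN : List Move → ℕ → ℕ
  runN = run rN r⁻N tN
  r̄unN = run r⁻N rN tN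

  -- Both ends of each moved edge have to avoid the ports on the way, so that the chain remains
  -- valid after gluing.
  linkᵇ : List (List ℕ × Bool × Bool) → ℕ → Bool
  linkᵇ [] v = v ≡ᵇ rN y₁
  linkᵇ ((w , b , o) ∷ ls) v = safeN rN r⁻N p a ∧ (safeN rN r⁻N p c ∧
      (if o then (v ≡ᵇ runN p c) ∧ linkᵇ ls (runN p a) else (v ≡ᵇ runN p a) ∧ linkᵇ ls (runN p c)))
    where
    p = moves w
    a = if b then y₂ else y₁
    c = if b then y₃ else y₂

  commutingᵇ clashingᵇ : (ℕ → ℕ) → ℕ → ℕ → ℕ → Bool
  commutingᵇ h a b c = not (amongᵇ a b c (h a)) ∧ (not (amongᵇ a b c (h b)) ∧ not (amongᵇ a b c (h c)))
  clashingᵇ h a b c = (amongᵇ a b c (h a) ∧ not (amongᵇ a b c (h b)))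
                    ∨ ((amongᵇ a b c (h b) ∧ not (amongᵇ a b c (h c)))
                    ∨ (amongᵇ a b c (h c) ∧ not (amongᵇ a b c (h a))))

  ȳN : ℕ → ℕ
  ȳN = it r⁻N j

  pathN : List Move
  pathN = moves path

  grow : ℕ → List ℕ → List ℕ → List ℕ
  grow zero    st       seen = seen
  grow (suc f) []       seen = seen
  grow (suc f) (v ∷ st) seen = if mem v seen then grow f st seen else grow f (rN v ∷ tN v ∷ st) (v ∷ seen)

  reached : List ℕ
  -- Each newly seen point pushes two entries, so at most 2 k + 1 entries are ever popped, and 3 k
  -- is enough fuel.
  reached = grow (3 * k) (y₁ ∷ []) []

  allInᵇ : List ℕ → Bool
  allInᵇ l = all< k (λ v → mem v l)

  ySafeᵇ offᵇ pathSafeᵇ : ℕ → Bool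
  ySafeᵇ v = not (isY v) ∨ (not (isPort v) ∧ not (isPort (it r⁻N j v)))
  offᵇ v = isY v ∨ home uN K k 1 v (uN v)
  pathSafeᵇ v = not (isY v) ∨ (safeN rN r⁻N pathN v ∧ safeN r⁻N rN pathN (ȳN v))

  chiralᵇ : Bool → Bool
  chiralᵇ true  = commutingᵇ (runN pathN) y₁ y₂ y₃ ∧ clashingᵇ (r̄unN pathN) (ȳN y₃) (ȳN y₂) (ȳN y₁)
  chiralᵇ false = clashingᵇ (runN pathN) y₁ y₂ y₃ ∧ commutingᵇ (r̄unN pathN) (ȳN y₃) (ȳN y₂) (ȳN y₁)

  checkMap checkEven checkY checkOff checkConn checkLink checkChiral : Bool
  checkMap = (0 <ᵇ m) ∧ ((0 <ᵇ k) ∧ (all< k (λ v → (rN v <ᵇ k) ∧ ((r⁻N v <ᵇ k) ∧ ((tN v <ᵇ k) ∧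
    ((rN (r⁻N v) ≡ᵇ v) ∧ ((r⁻N (rN v) ≡ᵇ v) ∧ ((tN (tN v) ≡ᵇ v) ∧ (it rN m v ≡ᵇ v)))))))
    ∧ along (m ∸ 1) rN 0 (λ v → not (v ≡ᵇ 0))))
  checkEven = okPairs pairs ∧ (okPairs (rotations G) ∧ (evenᵇ (length pairs) ∧ (evenᵇ (length (rotations G)) ∧
    (all< k (λ v → swapℕ (rotations G) v ≡ᵇ rN v) ∧ all< k (λ v → swapℕ pairs v ≡ᵇ tN v)))))
  checkY = (y₁ <ᵇ k) ∧ ((y₂ <ᵇ k) ∧ ((y₃ <ᵇ k) ∧ (not (y₁ ≡ᵇ y₂) ∧ (not (y₂ ≡ᵇ y₃) ∧ ((tN y₁ ≡ᵇ y₂) ∧ ((tN y₃ ≡ᵇ y₃) ∧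
    ((τN y₁ ≡ᵇ y₁) ∧ ((τN y₂ ≡ᵇ y₃) ∧ all< k ySafeᵇ))))))))
  checkOff = all< k offᵇ
  checkConn = allInᵇ reached
  checkLink = linkᵇ links y₁
  checkChiral = all< k pathSafeᵇ ∧ chiralᵇ side

  check : Bool
  check = checkMap ∧ (checkEven ∧ (checkY ∧ (checkOff ∧ (checkConn ∧ (checkLink ∧ checkChiral)))))

  module Sound (c : True check) where
    private
      ok₁ : True checkMap
      ok₁ = ∧₁ c
      ok₂ : True checkEven
      ok₂ = ∧₁ (∧₂ {checkMap} c)
      ok₃ : True checkY
      ok₃ = ∧₁ (∧₂ {checkEven} (∧₂ {checkMap} c))
      ok₄₊ : True (checkOff ∧ (checkConn ∧ (checkLink ∧ checkChiral)))
      ok₄₊ = ∧₂ {checkY} (∧₂ {checkEven} (∧₂ {checkMap} c))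
      ok₄ : True checkOff
      ok₄ = ∧₁ ok₄₊
      ok₅ : True checkConn
      ok₅ = ∧₁ (∧₂ {checkOff} ok₄₊)
      ok₆ : True checkLink
      ok₆ = ∧₁ (∧₂ {checkConn} (∧₂ {checkOff} ok₄₊))
      ok₇ : True checkChiral
      ok₇ = ∧₂ {checkLink} (∧₂ {checkConn} (∧₂ {checkOff} ok₄₊))

      eq : ∀ {a b} → True (a ≡ᵇ b) → a ≡ b
      eq {a} {b} = ≡ᵇ⇒≡ a b
      neq : ∀ {a b} → True (not (a ≡ᵇ b)) → a ≢ b
      neq {a} {b} p q = T-not p (≡⇒≡ᵇ a b q)

    m>0 : 0 < m
    m>0 = <ᵇ⇒< 0 m (∧₁ ok₁)

    k>0 : 0 < k
    k>0 = <ᵇ⇒< 0 k (∧₁ (∧₂ {0 <ᵇ m} ok₁))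

    private
      ok₁₊ = ∧₂ {0 <ᵇ k} (∧₂ {0 <ᵇ m} ok₁)

      atᵇ : ℕ → Bool
      atᵇ v = (rN v <ᵇ k) ∧ ((r⁻N v <ᵇ k) ∧ ((tN v <ᵇ k) ∧
        ((rN (r⁻N v) ≡ᵇ v) ∧ ((r⁻N (rN v) ≡ᵇ v) ∧ ((tN (tN v) ≡ᵇ v) ∧ (it rN m v ≡ᵇ v))))))

      at : ∀ v → v < k → True (atᵇ v)
      at = all<-sound k atᵇ (∧₁ ok₁₊)

      rN< : ∀ v → v < k → rN v < k
      rN< v h = <ᵇ⇒< _ _ (∧₁ (at v h))
      at₂ : ∀ v → v < k → True ((r⁻N v <ᵇ k) ∧ ((tN v <ᵇ k) ∧ ((rN (r⁻N v) ≡ᵇ v) ∧ ((r⁻N (rN v) ≡ᵇ v) ∧ ((tN (tN v) ≡ᵇ v) ∧ (it rN m v ≡ᵇ v))))))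
      at₂ v h = ∧₂ {rN v <ᵇ k} (at v h)
      r⁻N< : ∀ v → v < k → r⁻N v < k
      r⁻N< v h = <ᵇ⇒< _ _ (∧₁ (at₂ v h))
      at₃ : ∀ v → v < k → True ((tN v <ᵇ k) ∧ ((rN (r⁻N v) ≡ᵇ v) ∧ ((r⁻N (rN v) ≡ᵇ v) ∧ ((tN (tN v) ≡ᵇ v) ∧ (it rN m v ≡ᵇ v)))))
      at₃ v h = ∧₂ {r⁻N v <ᵇ k} (at₂ v h)
      tN< : ∀ v → v < k → tN v < k
      tN< v h = <ᵇ⇒< _ _ (∧₁ (at₃ v h))
      at₄ : ∀ v → v < k → True ((rN (r⁻N v) ≡ᵇ v) ∧ ((r⁻N (rN v) ≡ᵇ v) ∧ ((tN (tN v) ≡ᵇ v) ∧ (it rN m v ≡ᵇ v))))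
      at₄ v h = ∧₂ {tN v <ᵇ k} (at₃ v h)
      at₅ : ∀ v → v < k → True ((r⁻N (rN v) ≡ᵇ v) ∧ ((tN (tN v) ≡ᵇ v) ∧ (it rN m v ≡ᵇ v)))
      at₅ v h = ∧₂ {rN (r⁻N v) ≡ᵇ v} (at₄ v h)
      at₆ : ∀ v → v < k → True ((tN (tN v) ≡ᵇ v) ∧ (it rN m v ≡ᵇ v))
      at₆ v h = ∧₂ {r⁻N (rN v) ≡ᵇ v} (at₅ v h)

    X : Set
    X = Fin k

    lift : (f : ℕ → ℕ) → (∀ v → v < k → f v < k) → X → X
    lift f h i = fromℕ< (h (toℕ i) (FinP.toℕ<n i))

    toℕ-lift : ∀ f h i → toℕ (lift f h i) ≡ f (toℕ i)
    toℕ-lift f h i = FinP.toℕ-fromℕ< _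

    private
      inℕ : ∀ {i j : X} → toℕ i ≡ toℕ j → i ≡ j
      inℕ = FinP.toℕ-injective

      lift₂ : ∀ f g hf hg i → toℕ (lift f hf (lift g hg i)) ≡ f (g (toℕ i))
      lift₂ f g hf hg i = trans (toℕ-lift f hf _) (cong f (toℕ-lift g hg i))

    F : Frame
    F = record
      { X = X ; k = k ; fin = ↔-id X
      ; R = record { to = lift rN rN< ; from = lift r⁻N r⁻N<
          ; to-from = λ i → inℕ (trans (lift₂ rN r⁻N rN< r⁻N< i) (eq (∧₁ (at₄ _ (FinP.toℕ<n i)))))
          ; from-to = λ i → inℕ (trans (lift₂ r⁻N rN r⁻N< rN< i) (eq (∧₁ (at₅ _ (FinP.toℕ<n i))))) }
      ; t = lift tN tN<
      ; t-involutive = λ i → inℕ (trans (lift₂ tN tN tN< tN< i) (eq (∧₁ (at₆ _ (FinP.toℕ<n i))))) }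

    open Frame F using (_≟_; r; r⁻; t; σ; τ; R) public

    private
      toℕ-it : ∀ {f : X → X} {fN} → (∀ i → toℕ (f i) ≡ fN (toℕ i)) → ∀ n i → toℕ (it f n i) ≡ it fN n (toℕ i)
      toℕ-it e′ zero    i = refl
      toℕ-it {fN = fN} e′ (suc n) i = trans (e′ _) (cong fN (toℕ-it e′ n i))

    toℕ-r : ∀ i → toℕ (r i) ≡ rN (toℕ i)
    toℕ-r = toℕ-lift rN rN<
    toℕ-r⁻ : ∀ i → toℕ (r⁻ i) ≡ r⁻N (toℕ i)
    toℕ-r⁻ = toℕ-lift r⁻N r⁻N<
    toℕ-t : ∀ i → toℕ (t i) ≡ tN (toℕ i)
    toℕ-t = toℕ-lift tN tN<
    toℕ-σ : ∀ i → toℕ (σ i) ≡ σN (toℕ i)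
    toℕ-σ i = trans (toℕ-r _) (cong rN (toℕ-t i))
    toℕ-τ : ∀ i → toℕ (τ j i) ≡ τN (toℕ i)
    toℕ-τ i = trans (toℕ-it toℕ-r j _) (cong (it rN j) (trans (toℕ-t _) (cong tN (toℕ-it toℕ-r⁻ j i))))
    toℕ-u : ∀ i → toℕ (t (τ j i)) ≡ uN (toℕ i)
    toℕ-u i = trans (toℕ-t _) (cong tN (toℕ-τ i))

    itσ : ∀ n i → toℕ (it σ n i) ≡ it σN n (toℕ i)
    itσ = toℕ-it toℕ-σ
    itr : ∀ n i → toℕ (it r n i) ≡ it rN n (toℕ i)
    itr = toℕ-it toℕ-r
    itr⁻ : ∀ n i → toℕ (it r⁻ n i) ≡ it r⁻N n (toℕ i)
    itr⁻ = toℕ-it toℕ-r⁻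

    point : ∀ v → True (v <ᵇ k) → ∃[ i ] toℕ {k} i ≡ v
    point v h = fromℕ< (<ᵇ⇒< v k h) , FinP.toℕ-fromℕ< _

    r-order : ∀ i → it r m i ≡ i
    r-order i = inℕ (trans (itr m i) (eq (∧₂ {tN (tN (toℕ i)) ≡ᵇ toℕ i} (at₆ _ (FinP.toℕ<n i)))))

    r-exact : ∃[ i ] (∀ l → 0 < l → l < m → it r l i ≢ i)
    r-exact = fromℕ< k>0 , λ l a b p → neq {b = 0}
      (along-sound (m ∸ 1) rN 0 (λ v → not (v ≡ᵇ 0)) (∧₂ {all< k atᵇ} ok₁₊) l a (pred-mono b))
      (trans (cong (it rN l) (sym (FinP.toℕ-fromℕ< k>0))) (trans (sym (itr l _)) (trans (cong toℕ p) (FinP.toℕ-fromℕ< k>0))))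
      where
      pred-mono : ∀ {l m} → l < m → l ≤ m ∸ 1
      pred-mono (s≤s h) = h

    private
      T⇒true : ∀ {b} → True b → b ≡ true
      T⇒true {true} _ = refl
      ¬T⇒false : ∀ {b} → ¬ True b → b ≡ false
      ¬T⇒false {true} p = ⊥-elim (p tt)
      ¬T⇒false {false} _ = refl

      sw : ℕ → ℕ → ℕ → ℕ
      sw a b v = if v ≡ᵇ a then b else if v ≡ᵇ b then a else v

      swp-toℕ : ∀ a b i → toℕ (swp _≟_ a b i) ≡ sw (toℕ a) (toℕ b) (toℕ i)
      swp-toℕ a b i with i ≟ a
      ... | yes refl rewrite T⇒true (≡⇒≡ᵇ (toℕ i) (toℕ i) refl) = refl
      ... | no ne rewrite ¬T⇒false {toℕ i ≡ᵇ toℕ a} (λ q → ne (inℕ (eq q))) with i ≟ b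
      ...   | yes refl rewrite T⇒true (≡⇒≡ᵇ (toℕ i) (toℕ i) refl) = refl
      ...   | no ne′ rewrite ¬T⇒false {toℕ i ≡ᵇ toℕ b} (λ q → ne′ (inℕ (eq q))) = refl

      convert : ∀ ps → True (okPairs ps) → List (Tr _≟_)
      convert [] _ = []
      convert ((a , b) ∷ ps) p = (proj₁ A , proj₁ B , λ q → neq (∧₂ {b <ᵇ k} h) (trans (sym (proj₂ A)) (trans (cong toℕ q) (proj₂ B)))) ∷
        convert ps (∧₂ {(a <ᵇ k) ∧ ((b <ᵇ k) ∧ not (a ≡ᵇ b))} p)
        where
        h = ∧₂ {a <ᵇ k} (∧₁ p)
        A = point a (∧₁ (∧₁ p))
        B = point b (∧₁ h)

      convert-length : ∀ ps p → length (convert ps p) ≡ length ps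
      convert-length [] p = refl
      convert-length ((a , b) ∷ ps) p = cong suc (convert-length ps (∧₂ {(a <ᵇ k) ∧ ((b <ᵇ k) ∧ not (a ≡ᵇ b))} p))

      convert-swaps : ∀ ps p i → toℕ (swaps _≟_ (convert ps p) i) ≡ swapℕ ps (toℕ i)
      convert-swaps [] p i = refl
      convert-swaps ((a , b) ∷ ps) p i = trans (convert-swaps ps (∧₂ {(a <ᵇ k) ∧ ((b <ᵇ k) ∧ not (a ≡ᵇ b))} p) _)
        (cong (swapℕ ps) (trans (swp-toℕ _ _ i) (cong₂ (λ u v → sw u v (toℕ i)) (FinP.toℕ-fromℕ< _) (FinP.toℕ-fromℕ< _))))

      e₂ = ∧₂ {okPairs pairs} ok₂
      e₃ = ∧₂ {okPairs (rotations G)} e₂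
      e₄ = ∧₂ {evenᵇ (length pairs)} e₃
      e₅ = ∧₂ {evenᵇ (length (rotations G))} e₄

    t-even : EvenF _≟_ t
    t-even = convert pairs (∧₁ ok₂) , subst Even (sym (convert-length pairs (∧₁ ok₂))) (even-sound _ (∧₁ e₃)) ,
      λ i → inℕ (trans (convert-swaps pairs (∧₁ ok₂) i) (trans
        (eq (all<-sound k (λ v → swapℕ pairs v ≡ᵇ tN v) (∧₂ {all< k (λ v → swapℕ (rotations G) v ≡ᵇ rN v)} e₅) (toℕ i) (FinP.toℕ<n i))) (sym (toℕ-t i))))

    r-even : EvenF _≟_ r
    r-even = convert (rotations G) (∧₁ e₂) , subst Even (sym (convert-length (rotations G) (∧₁ e₂))) (even-sound _ (∧₁ e₄)) ,
      λ i → inℕ (trans (convert-swaps (rotations G) (∧₁ e₂) i) (trans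
        (eq (all<-sound k (λ v → swapℕ (rotations G) v ≡ᵇ rN v) (∧₁ e₅) (toℕ i) (FinP.toℕ<n i))) (sym (toℕ-r i))))

    private
      f₂ = ∧₂ {y₁ <ᵇ k} ok₃
      f₃ = ∧₂ {y₂ <ᵇ k} f₂
      f₄ = ∧₂ {y₃ <ᵇ k} f₃
      f₅ = ∧₂ {not (y₁ ≡ᵇ y₂)} f₄
      f₆ = ∧₂ {not (y₂ ≡ᵇ y₃)} f₅
      f₇ = ∧₂ {tN y₁ ≡ᵇ y₂} f₆
      f₈ = ∧₂ {tN y₃ ≡ᵇ y₃} f₇
      f₉ = ∧₂ {τN y₁ ≡ᵇ y₁} f₈

    Y₁ Y₂ Y₃ : X
    Y₁ = proj₁ (point y₁ (∧₁ ok₃))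
    Y₂ = proj₁ (point y₂ (∧₁ f₂))
    Y₃ = proj₁ (point y₃ (∧₁ f₃))

    eY₁ : toℕ Y₁ ≡ y₁
    eY₁ = proj₂ (point y₁ (∧₁ ok₃))
    eY₂ : toℕ Y₂ ≡ y₂
    eY₂ = proj₂ (point y₂ (∧₁ f₂))
    eY₃ : toℕ Y₃ ≡ y₃
    eY₃ = proj₂ (point y₃ (∧₁ f₃))

    private
      among⁺ : ∀ {A B C : X} {a b c} → toℕ A ≡ a → toℕ B ≡ b → toℕ C ≡ c → ∀ {v} i → toℕ i ≡ v → True (amongᵇ a b c v) → Among A B C i
      among⁺ {a = a} {b} {c} p q s {v} i e′ h with Equivalence.to (T-∨ {v ≡ᵇ a}) h
      ... | inj₁ h₁ = inj₁ (inℕ (trans e′ (trans (eq h₁) (sym p))))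
      ... | inj₂ h₂ with Equivalence.to (T-∨ {v ≡ᵇ b}) h₂
      ...   | inj₁ h₃ = inj₂ (inj₁ (inℕ (trans e′ (trans (eq h₃) (sym q)))))
      ...   | inj₂ h₃ = inj₂ (inj₂ (inℕ (trans e′ (trans (eq h₃) (sym s)))))

      among⁻ : ∀ {A B C : X} {a b c} → toℕ A ≡ a → toℕ B ≡ b → toℕ C ≡ c → ∀ {v} i → toℕ i ≡ v → Among A B C i → True (amongᵇ a b c v)
      among⁻ {a = a} p q s {v} i e′ (inj₁ refl) = Equivalence.from (T-∨ {v ≡ᵇ a}) (inj₁ (≡⇒≡ᵇ v a (trans (sym e′) p)))
      among⁻ {a = a} {b} p q s {v} i e′ (inj₂ (inj₁ refl)) = Equivalence.from (T-∨ {v ≡ᵇ a}) (inj₂ (Equivalence.from (T-∨ {v ≡ᵇ b}) (inj₁ (≡⇒≡ᵇ v b (trans (sym e′) q)))))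
      among⁻ {a = a} {b} {c} p q s {v} i e′ (inj₂ (inj₂ refl)) = Equivalence.from (T-∨ {v ≡ᵇ a}) (inj₂ (Equivalence.from (T-∨ {v ≡ᵇ b}) (inj₂ (≡⇒≡ᵇ v c (trans (sym e′) s)))))

    isY⁺ : ∀ i → True (isY (toℕ i)) → Among Y₁ Y₂ Y₃ i
    isY⁺ i = among⁺ eY₁ eY₂ eY₃ i refl
    isY⁻ : ∀ i → Among Y₁ Y₂ Y₃ i → True (isY (toℕ i))
    isY⁻ i = among⁻ eY₁ eY₂ eY₃ i refl

    off : ∀ i → ¬ Among Y₁ Y₂ Y₃ i → it (λ i → t (τ j i)) K i ≡ i
    off i ny = either (Equivalence.to (T-∨ {isY (toℕ i)}) (all<-sound k offᵇ ok₄ (toℕ i) (FinP.toℕ<n i)))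
      where
      Goal : Set
      Goal = it (λ i → t (τ j i)) K i ≡ i
      back : ∃[ l ] (it uN l (toℕ i) ≡ toℕ i × mod K l ≡ 0) → Goal
      back (l , p , p′) = it-mod (λ i → t (τ j i)) K l i p′ (inℕ (trans (toℕ-it toℕ-u l i) p))
      either : True (isY (toℕ i)) ⊎ True (home uN K k 1 (toℕ i) (uN (toℕ i))) → Goal
      either (inj₁ h) = ⊥-elim (ny (isY⁺ i h))
      either (inj₂ h) = back (home-sound uN K k 1 (toℕ i) h)

    connected : ∀ (P : X → Set) → (∀ i → P i → P (r i)) → (∀ i → P i → P (t i)) → P Y₁ → ∀ i → P i
    connected P pr pt p₀ i = found (grow-sound (3 * k) (y₁ ∷ []) [] ((Y₁ , eY₁ , p₀) ∷ []) [])
      where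
      Q : ℕ → Set
      Q v = ∃[ i ] (toℕ {k} i ≡ v × P i)
      pick : ∀ l v → All Q l → True (mem v l) → Q v
      pick (w ∷ l) v (q ∷ qs) h with Equivalence.to (T-∨ {v ≡ᵇ w}) h
      ... | inj₁ h′ = subst Q (sym (eq h′)) q
      ... | inj₂ h′ = pick l v qs h′
      -- The invariant of the search: every number on the stack or already seen represents a point
      -- satisfying P.
      grow-sound : ∀ f st seen → All Q st → All Q seen → All Q (grow f st seen)
      grow-sound zero    st       seen a b = b
      grow-sound (suc f) []       seen a b = b
      grow-sound (suc f) (v ∷ st) seen (q@(i , e′ , p) ∷ a) b with mem v seen
      ... | true = grow-sound f st seen a b
      ... | false = grow-sound f (rN v ∷ tN v ∷ st) (v ∷ seen)
              ((r i , trans (toℕ-r i) (cong rN e′) , pr i p) ∷ (t i , trans (toℕ-t i) (cong tN e′) , pt i p) ∷ a) (q ∷ b)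
      use : Q (toℕ i) → P i
      use (i′ , e′ , p) = subst P (inℕ e′) p
      found : All Q reached → P i
      found a = use (pick reached (toℕ i) a (all<-sound k (λ v → mem v reached) ok₅ (toℕ i) (FinP.toℕ<n i)))

    toℕ-run : ∀ {f f⁻ : X → X} {fN f⁻N} → (∀ i → toℕ (f i) ≡ fN (toℕ i)) → (∀ i → toℕ (f⁻ i) ≡ f⁻N (toℕ i)) →
      ∀ p i → toℕ (run f f⁻ t p i) ≡ run fN f⁻N tN p (toℕ i)
    toℕ-run u v []       i = refl
    toℕ-run {fN = fN} {f⁻N} u v (fw ∷ p) i = trans (toℕ-run u v p _) (cong (run fN f⁻N tN p) (u i))
    toℕ-run {fN = fN} {f⁻N} u v (bw ∷ p) i = trans (toℕ-run u v p _) (cong (run fN f⁻N tN p) (v i))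
    toℕ-run {fN = fN} {f⁻N} u v (fl ∷ p) i = trans (toℕ-run u v p _) (cong (run fN f⁻N tN p) (toℕ-t i))

    module _ (Port : X → Set) (no-port : ∀ i → True (not (isPort (toℕ i))) → ¬ Port i) where

      safe-sound : ∀ {f f⁻ : X → X} {fN f⁻N} → (∀ i → toℕ (f i) ≡ fN (toℕ i)) → (∀ i → toℕ (f⁻ i) ≡ f⁻N (toℕ i)) →
        ∀ p i v → toℕ i ≡ v → True (safeN fN f⁻N p v) → Safe f f⁻ t Port p i
      safe-sound u v []       i _ refl s = tt
      safe-sound u v (fw ∷ p) i _ refl s = safe-sound u v p _ _ (u i) s
      safe-sound u v (bw ∷ p) i _ refl s = safe-sound u v p _ _ (v i) s
      safe-sound u v (fl ∷ p) i _ refl s = no-port i (∧₁ s) , safe-sound u v p _ _ (toℕ-t i) (∧₂ {not (isPort (toℕ i))} s)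

      module _ (_∼_ : X → X → Set) (rf : ∀ {x} → x ∼ x) (sy : ∀ {x y} → x ∼ y → y ∼ x) (tr : ∀ {x y z} → x ∼ y → y ∼ z → x ∼ z)
               (rr : ∀ {x y} → x ∼ y → r x ∼ r y) (rt : ∀ {x y} → ¬ Port x → ¬ Port y → x ∼ y → t x ∼ t y) where
        private
          -- Invariance under r is enough, because r⁻¹ is the power of r with exponent m - 1.
          rr⁻ : ∀ {x y} → x ∼ y → r⁻ x ∼ r⁻ y
          rr⁻ {x} {y} p = subst₂ _∼_ (back x) (back y) (many (m ∸ 1))
            where
            many : ∀ l → it r l x ∼ it r l y
            many zero    = p
            many (suc l) = rr (many l)
            back : ∀ z → it r (m ∸ 1) z ≡ r⁻ z
            back z = trans (sym (from-to R _)) (cong r⁻ (trans (cong (λ l → it r l z) (suc-pred m>0)) (r-order z)))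
              where
              suc-pred : ∀ {m} → 0 < m → suc (m ∸ 1) ≡ m
              suc-pred (s≤s _) = refl

          travel : ∀ p {x y} → Safe r r⁻ t Port p x → Safe r r⁻ t Port p y → x ∼ y → run r r⁻ t p x ∼ run r r⁻ t p y
          travel []       a b h = h
          travel (fw ∷ p) a b h = travel p a b (rr h)
          travel (bw ∷ p) a b h = travel p a b (rr⁻ h)
          travel (fl ∷ p) (na , a) (nb , b) h = travel p a b (rt na nb h)

        link-sound : Y₁ ∼ Y₂ → Y₂ ∼ Y₃ → ∀ ls i v → toℕ i ≡ v → Y₁ ∼ i → True (linkᵇ ls v) → Y₁ ∼ r Y₁
        link-sound h₁ h₂ [] i _ refl p s = subst (Y₁ ∼_) (inℕ (trans (eq s) (trans (cong rN (sym eY₁)) (sym (toℕ-r Y₁))))) p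
        link-sound h₁ h₂ ((w , b , o) ∷ ls) i _ refl p s = go o (∧₂ {safeN rN r⁻N (moves w) (bc b)} s′)
          where
          ba bc : Bool → ℕ
          ba b = if b then y₂ else y₁
          bc b = if b then y₃ else y₂
          A C : X
          A = if b then Y₂ else Y₁
          C = if b then Y₃ else Y₂
          eA : toℕ A ≡ ba b
          eA = pickA b
            where
            pickA : ∀ b → toℕ (if b then Y₂ else Y₁) ≡ ba b
            pickA true = eY₂
            pickA false = eY₁
          eC : toℕ C ≡ bc b
          eC = pickC b
            where
            pickC : ∀ b → toℕ (if b then Y₃ else Y₂) ≡ bc b
            pickC true = eY₃
            pickC false = eY₂
          A∼C : A ∼ C
          A∼C = pick b
            where
            pick : ∀ b → (if b then Y₂ else Y₁) ∼ (if b then Y₃ else Y₂)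
            pick true = h₂
            pick false = h₁
          s′ = ∧₂ {safeN rN r⁻N (moves w) (ba b)} s
          gA gC : X
          gA = run r r⁻ t (moves w) A
          gC = run r r⁻ t (moves w) C
          egA : toℕ gA ≡ runN (moves w) (ba b)
          egA = trans (toℕ-run toℕ-r toℕ-r⁻ (moves w) A) (cong (runN (moves w)) eA)
          egC : toℕ gC ≡ runN (moves w) (bc b)
          egC = trans (toℕ-run toℕ-r toℕ-r⁻ (moves w) C) (cong (runN (moves w)) eC)
          gA∼gC : gA ∼ gC
          gA∼gC = travel (moves w) (safe-sound toℕ-r toℕ-r⁻ (moves w) A _ eA (∧₁ s)) (safe-sound toℕ-r toℕ-r⁻ (moves w) C _ eC (∧₁ s′)) A∼C
          go : ∀ o → True (if o then (toℕ i ≡ᵇ runN (moves w) (bc b)) ∧ linkᵇ ls (runN (moves w) (ba b))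
                             else (toℕ i ≡ᵇ runN (moves w) (ba b)) ∧ linkᵇ ls (runN (moves w) (bc b))) → Y₁ ∼ r Y₁
          go true h = link-sound h₁ h₂ ls gA _ egA (tr (subst (Y₁ ∼_) (inℕ (trans (eq (∧₁ h)) (sym egC))) p) (sy gA∼gC)) (∧₂ {toℕ i ≡ᵇ runN (moves w) (bc b)} h)
          go false h = link-sound h₁ h₂ ls gC _ egC (tr (subst (Y₁ ∼_) (inℕ (trans (eq (∧₁ h)) (sym egA))) p) gA∼gC) (∧₂ {toℕ i ≡ᵇ runN (moves w) (ba b)} h)

      private
        module _ {A B C : X} {a b c : ℕ} (p : toℕ A ≡ a) (q : toℕ B ≡ b) (s : toℕ C ≡ c) (h : X → X) (hN : ℕ → ℕ) (e′ : ∀ i → toℕ (h i) ≡ hN (toℕ i)) where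
          hA : toℕ (h A) ≡ hN a
          hA = trans (e′ A) (cong hN p)
          hB : toℕ (h B) ≡ hN b
          hB = trans (e′ B) (cong hN q)
          hC : toℕ (h C) ≡ hN c
          hC = trans (e′ C) (cong hN s)
          out : ∀ {v} i → toℕ i ≡ v → True (not (amongᵇ a b c v)) → ¬ Among A B C i
          out i e″ u v = T-not u (among⁻ p q s i e″ v)
          commuting-sound : True (commutingᵇ hN a b c) → Commuting h A B C
          commuting-sound u = inj₁ (out _ hA (∧₁ u) , out _ hB (∧₁ (∧₂ {not (amongᵇ a b c (hN a))} u)) ,
            out _ hC (∧₂ {not (amongᵇ a b c (hN b))} (∧₂ {not (amongᵇ a b c (hN a))} u)))
          clashing-sound : True (clashingᵇ hN a b c) → Clashing h A B C
          clashing-sound u with Equivalence.to (T-∨ {amongᵇ a b c (hN a) ∧ not (amongᵇ a b c (hN b))}) u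
          ... | inj₁ v = inj₁ (among⁺ p q s _ hA (∧₁ v) , out _ hB (∧₂ {amongᵇ a b c (hN a)} v))
          ... | inj₂ v with Equivalence.to (T-∨ {amongᵇ a b c (hN b) ∧ not (amongᵇ a b c (hN c))}) v
          ...   | inj₁ w = inj₂ (inj₁ (among⁺ p q s _ hB (∧₁ w) , out _ hC (∧₂ {amongᵇ a b c (hN b)} w)))
          ...   | inj₂ w = inj₂ (inj₂ (among⁺ p q s _ hC (∧₁ w) , out _ hA (∧₂ {amongᵇ a b c (hN c)} w)))

        implied : ∀ {b p} → True (not b ∨ p) → True b → True p
        implied {true} h _ = h

        chiral : (Commuting (run r r⁻ t pathN) Y₁ Y₂ Y₃ × Clashing (run r⁻ r t pathN) (it r⁻ j Y₃) (it r⁻ j Y₂) (it r⁻ j Y₁))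
               ⊎ (Clashing (run r r⁻ t pathN) Y₁ Y₂ Y₃ × Commuting (run r⁻ r t pathN) (it r⁻ j Y₃) (it r⁻ j Y₂) (it r⁻ j Y₁))
        chiral = go side (∧₂ {all< k pathSafeᵇ} ok₇)
          where
          ȳe : ∀ {Y y} → toℕ Y ≡ y → toℕ (it r⁻ j Y) ≡ ȳN y
          ȳe {Y} p = trans (itr⁻ j Y) (cong ȳN p)
          go : ∀ o → True (chiralᵇ o) → (Commuting (run r r⁻ t pathN) Y₁ Y₂ Y₃ × Clashing (run r⁻ r t pathN) (it r⁻ j Y₃) (it r⁻ j Y₂) (it r⁻ j Y₁))
               ⊎ (Clashing (run r r⁻ t pathN) Y₁ Y₂ Y₃ × Commuting (run r⁻ r t pathN) (it r⁻ j Y₃) (it r⁻ j Y₂) (it r⁻ j Y₁))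
          go true h = inj₁ (commuting-sound eY₁ eY₂ eY₃ (run r r⁻ t pathN) (runN pathN) (toℕ-run toℕ-r toℕ-r⁻ pathN) (∧₁ h) ,
            clashing-sound (ȳe eY₃) (ȳe eY₂) (ȳe eY₁) (run r⁻ r t pathN) (r̄unN pathN) (toℕ-run toℕ-r⁻ toℕ-r pathN) (∧₂ {commutingᵇ (runN pathN) y₁ y₂ y₃} h))
          go false h = inj₂ (clashing-sound eY₁ eY₂ eY₃ (run r r⁻ t pathN) (runN pathN) (toℕ-run toℕ-r toℕ-r⁻ pathN) (∧₁ h) ,
            commuting-sound (ȳe eY₃) (ȳe eY₂) (ȳe eY₁) (run r⁻ r t pathN) (r̄unN pathN) (toℕ-run toℕ-r⁻ toℕ-r pathN) (∧₂ {clashingᵇ (runN pathN) y₁ y₂ y₃} h))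

        y-safe : ∀ i → Among Y₁ Y₂ Y₃ i → ¬ Port i × ¬ Port (it r⁻ j i)
        y-safe i p = no-port i (∧₁ h) , no-port _ (subst (λ v → True (not (isPort v))) (sym (itr⁻ j i)) (∧₂ {not (isPort (toℕ i))} h))
          where
          h = implied {isY (toℕ i)} {_} (all<-sound k ySafeᵇ (∧₂ {τN y₂ ≡ᵇ y₃} f₉) (toℕ i) (FinP.toℕ<n i)) (isY⁻ i p)

        path-safe : ∀ i → Among Y₁ Y₂ Y₃ i → Safe r r⁻ t Port pathN i × Safe r⁻ r t Port pathN (it r⁻ j i)
        path-safe i p = safe-sound toℕ-r toℕ-r⁻ pathN i _ refl (∧₁ h) ,
            safe-sound toℕ-r⁻ toℕ-r pathN _ _ (itr⁻ j i) (∧₂ {safeN rN r⁻N pathN (toℕ i)} h)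
          where
          h = implied {isY (toℕ i)} {_} (all<-sound k pathSafeᵇ (∧₁ ok₇) (toℕ i) (FinP.toℕ<n i)) (isY⁻ i p)

      local : Local F Port
      local = record
        { j = j ; q = q ; y₁ = Y₁ ; y₂ = Y₂ ; y₃ = Y₃
        ; y₁≢y₂ = λ p → neq (∧₁ f₄) (trans (sym eY₁) (trans (cong toℕ p) eY₂))
        ; y₂≢y₃ = λ p → neq (∧₁ f₅) (trans (sym eY₂) (trans (cong toℕ p) eY₃))
        ; ty₁ = inℕ (trans (toℕ-t Y₁) (trans (cong tN eY₁) (trans (eq (∧₁ f₆)) (sym eY₂))))
        ; ty₃ = inℕ (trans (toℕ-t Y₃) (trans (cong tN eY₃) (trans (eq (∧₁ f₇)) (sym eY₃))))
        ; τy₁ = inℕ (trans (toℕ-τ Y₁) (trans (cong τN eY₁) (trans (eq (∧₁ f₈)) (sym eY₁))))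
        ; τy₂ = inℕ (trans (toℕ-τ Y₂) (trans (cong τN eY₂) (trans (eq (∧₁ f₉)) (sym eY₃))))
        ; y-safe = y-safe
        ; linked = λ _∼_ rf sy tr rr rt h₁ h₂ → link-sound _∼_ rf sy tr rr rt h₁ h₂ links Y₁ y₁ eY₁ rf ok₆
        ; path = pathN ; path-safe = path-safe ; chiral = chiral }

    trivialExtension : ∀ Port → Extension F Port F
    trivialExtension Port = record { inj = λ x → x ; inj-injective = λ p → p ; inj-r = λ _ → refl ; inj-t = λ _ _ → refl }

and-sound : ∀ bs → True (and bs) → All True bs
and-sound []          _ = []
and-sound (true ∷ bs) p = tt ∷ and-sound bs p

private
  eq : ∀ {a b} → True (a ≡ᵇ b) → a ≡ b
  eq {a} {b} = ≡ᵇ⇒≡ a b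
  neq : ∀ {a b} → True (not (a ≡ᵇ b)) → a ≢ b
  neq {a} {b} p q = T-not p (≡⇒≡ᵇ a b q)
  pred-mono : ∀ {l m} → l < m → l ≤ m ∸ 1
  pred-mono (s≤s h) = h

-- These examples have no ports and are not extended; here `α₀` is a point whose cycle under σ has
-- the full length n.
module Closed (d : Datum) where
  open Datum d
  open Check d (λ _ → false)

  closedᵇ : List Bool
  closedᵇ = check ∷ (0 <ᵇ n) ∷ all< k (λ v → it σN n v ≡ᵇ v) ∷ along (n ∸ 1) σN α₀ (λ v → not (v ≡ᵇ α₀)) ∷ (α₀ <ᵇ k) ∷ []

  core : All True closedᵇ → Core m n
  core (c ∷ n>0 ∷ order ∷ exact ∷ α<k ∷ []) =
      Transfer.core (local (λ _ → ⊥) (λ _ _ ())) (trivialExtension (λ _ → ⊥)) m>0 (<ᵇ⇒< 0 n n>0) r-order r-exact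
        (λ i → FinP.toℕ-injective (trans (itσ n i) (eq (all<-sound k (λ v → it σN n v ≡ᵇ v) order (toℕ i) (FinP.toℕ<n i)))))
        (fromℕ< α< , λ l a b p → neq {b = α₀} (along-sound (n ∸ 1) σN α₀ (λ v → not (v ≡ᵇ α₀)) exact l a (pred-mono b))
          (trans (cong (it σN l) (sym (FinP.toℕ-fromℕ< α<))) (trans (sym (itσ l _)) (trans (cong toℕ p) (FinP.toℕ-fromℕ< α<)))))
        r-even t-even off connected
    where
    open Sound c
    α< = <ᵇ⇒< α₀ k α<k

module Ported (d : Datum) where
  open Datum d

  αN : Bool → ℕ
  αN false = α₀
  αN true  = α₁

  isPort : ℕ → Bool
  isPort v = (v ≡ᵇ α₀) ∨ (v ≡ᵇ α₁)

  open Check d isPort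

  rʲN r⁻ʲN βN : ℕ → ℕ
  rʲN = it rN j
  r⁻ʲN = it r⁻N j
  βN v = rN (tN (r⁻N v))

  coverᵇ : List ℕ → List ℕ → Bool
  coverᵇ o₀ o₁ = all< k (λ v → (σN v ≡ᵇ v) ∨ (mem v o₀ ∨ mem v o₁))

  portᵇ isoᵇ triᵇ : ℕ → List Bool
  -- The last test excludes both ports among the iterates before the n-th, which also separates the
  -- two cycles.
  portᵇ v = (v <ᵇ k) ∷ (tN v ≡ᵇ v) ∷ (it σN n v ≡ᵇ v) ∷ along (n ∸ 1) σN v (λ w → not (isPort w)) ∷ []
  isoᵇ v = (tN (rʲN v) ≡ᵇ rʲN v) ∷ (tN (r⁻ʲN v) ≡ᵇ r⁻ʲN v) ∷ not (isPort (rʲN v)) ∷ not (isY v) ∷ not (isY (rʲN v)) ∷ []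
  triᵇ v = (tN (βN v) ≡ᵇ βN v) ∷ (tN (rN v) ≡ᵇ rN v) ∷ not (isPort (βN v)) ∷ not (isPort (rN v)) ∷
    not (βN v ≡ᵇ rN α₀) ∷ not (βN v ≡ᵇ rN α₁) ∷ not (isY v) ∷ not (isY (βN v)) ∷ not (isY (rN v)) ∷ []

  stateᵇ isoStateᵇ triStateᵇ : List Bool
  stateᵇ = check ∷ (1 <ᵇ n) ∷ not (α₀ ≡ᵇ α₁) ∷ and (portᵇ α₀) ∷ and (portᵇ α₁) ∷
    coverᵇ (orbit n σN α₀) (orbit n σN α₁) ∷ []
  isoStateᵇ = (K ≡ᵇ (K / 2) * 2) ∷ and stateᵇ ∷ and (isoᵇ α₀) ∷ and (isoᵇ α₁) ∷ []
  triStateᵇ = (j ≡ᵇ 1) ∷ (K ≡ᵇ (K / 10) * 10) ∷ and stateᵇ ∷ and (triᵇ α₀) ∷ and (triᵇ α₁) ∷ []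

  isPort⁺ : ∀ b v → v ≡ αN b → True (isPort v)
  isPort⁺ false v p = Equivalence.from (T-∨ {v ≡ᵇ α₀}) (inj₁ (≡⇒≡ᵇ v α₀ p))
  isPort⁺ true  v p = Equivalence.from (T-∨ {v ≡ᵇ α₀}) (inj₂ (≡⇒≡ᵇ v α₁ p))

  module FromChecks (c : True check) (n>1 : True (1 <ᵇ n)) (sep : True (not (α₀ ≡ᵇ α₁)))
           (p₀ : All True (portᵇ α₀)) (p₁ : All True (portᵇ α₁)) (cov : True (coverᵇ (orbit n σN α₀) (orbit n σN α₁))) where
    open Sound c

    ports : ∀ b → All True (portᵇ (αN b))
    ports false = p₀
    ports true  = p₁

    α : Bool → X
    α b = lookup b (ports b)
      where
      lookup : ∀ b → All True (portᵇ (αN b)) → X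
      lookup b (h ∷ _) = fromℕ< (<ᵇ⇒< (αN b) k h)

    toℕ-α : ∀ b → toℕ (α b) ≡ αN b
    toℕ-α b with ports b
    ... | h ∷ _ = FinP.toℕ-fromℕ< (<ᵇ⇒< (αN b) k h)

    Port : X → Set
    Port = λ x → ∃[ b ] x ≡ α b

    no-port : ∀ i → True (not (isPort (toℕ i))) → ¬ Port i
    no-port i h (b , refl) = T-not h (isPort⁺ b _ (toℕ-α b))

    at-α : ∀ (f : X → X) fN → (∀ i → toℕ (f i) ≡ fN (toℕ i)) → ∀ b → toℕ (f (α b)) ≡ fN (αN b)
    at-α f fN h b = trans (h (α b)) (cong fN (toℕ-α b))

    tα : ∀ b → t (α b) ≡ α b
    tα b = go (ports b)
      where
      go : All True (portᵇ (αN b)) → t (α b) ≡ α b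
      go (_ ∷ h ∷ _) = FinP.toℕ-injective (trans (at-α t tN toℕ-t b) (trans (eq h) (sym (toℕ-α b))))

    cycle : ∀ b → it σ n (α b) ≡ α b
    cycle b = go (ports b)
      where
      go : All True (portᵇ (αN b)) → it σ n (α b) ≡ α b
      go (_ ∷ _ ∷ h ∷ _) = FinP.toℕ-injective (trans (at-α (it σ n) (it σN n) (itσ n) b) (trans (eq h) (sym (toℕ-α b))))

    minimal : ∀ b b′ i → 0 < i → i < n → it σ i (α b) ≢ α b′
    minimal b b′ i a i<n q = go (ports b)
      where
      go : All True (portᵇ (αN b)) → ⊥
      go (_ ∷ _ ∷ _ ∷ h ∷ _) = T-not (along-sound (n ∸ 1) σN (αN b) (λ w → not (isPort w)) h i a (pred-mono i<n))
        (isPort⁺ b′ _ (trans (sym (at-α (it σ i) (it σN i) (itσ i) b)) (trans (cong toℕ q) (toℕ-α b′))))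

    cover : ∀ x → σ x ≡ x ⊎ ∃[ b ] ∃[ i ] it σ i (α b) ≡ x
    cover x = go (Equivalence.to (T-∨ {σN (toℕ x) ≡ᵇ toℕ x})
        (all<-sound k (λ v → (σN v ≡ᵇ v) ∨ (mem v (orbit n σN α₀) ∨ mem v (orbit n σN α₁))) cov (toℕ x) (FinP.toℕ<n x)))
      where
      Goal : Set
      Goal = σ x ≡ x ⊎ ∃[ b ] ∃[ i ] it σ i (α b) ≡ x
      onOrbit : ∀ b → True (mem (toℕ x) (orbit n σN (αN b))) → Goal
      onOrbit b h = inj₂ (b , proj₁ o , FinP.toℕ-injective (trans (at-α (it σ (proj₁ o)) (it σN (proj₁ o)) (itσ (proj₁ o)) b) (proj₂ o)))
        where
        o : ∃[ i ] it σN i (αN b) ≡ toℕ x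
        o = orbit-sound n σN (αN b) (toℕ x) h
      go₂ : True (mem (toℕ x) (orbit n σN α₀)) ⊎ True (mem (toℕ x) (orbit n σN α₁)) → Goal
      go₂ (inj₁ h) = onOrbit false h
      go₂ (inj₂ h) = onOrbit true h
      go : True (σN (toℕ x) ≡ᵇ toℕ x) ⊎ True (mem (toℕ x) (orbit n σN α₀) ∨ mem (toℕ x) (orbit n σN α₁)) → Goal
      go (inj₁ h) = inj₁ (FinP.toℕ-injective (trans (toℕ-σ x) (eq h)))
      go (inj₂ h) = go₂ (Equivalence.to (T-∨ {mem (toℕ x) (orbit n σN α₀)}) h)

    state : State m n
    state = record
      { B = F ; αᴮ = α ; L = local Port no-port ; F = F ; E = trivialExtension Port
      ; m>0 = m>0 ; r-order = r-order ; r-exact = r-exact ; r-even = r-even ; t-even = t-even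
      ; α = α ; α-port = λ x np b p → np (b , p)
      ; α-sep = λ p → neq sep (trans (sym (toℕ-α false)) (trans (cong toℕ p) (toℕ-α true)))
      ; tα = tα ; n>1 = <ᵇ⇒< 1 n n>1 ; cycle = cycle ; minimal = minimal ; cover = cover ; off = off ; connected = connected }

    private
      fixes : ∀ (f : X → X) (fN : ℕ → ℕ) → (∀ i → toℕ (f i) ≡ fN (toℕ i)) → ∀ b → True (tN (fN (αN b)) ≡ᵇ fN (αN b)) → t (f (α b)) ≡ f (α b)
      fixes f fN h b p = FinP.toℕ-injective (trans (toℕ-t _) (trans (cong tN (at-α f fN h b)) (trans (eq p) (sym (at-α f fN h b)))))
      avoids : ∀ (f : X → X) fN → (∀ i → toℕ (f i) ≡ fN (toℕ i)) → ∀ b b′ → True (not (isPort (fN (αN b)))) → f (α b) ≢ α b′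
      avoids f fN h b b′ p q = no-port (f (α b)) (subst (λ v → True (not (isPort v))) (sym (at-α f fN h b)) p) (b′ , q)
      outside : ∀ (f : X → X) fN → (∀ i → toℕ (f i) ≡ fN (toℕ i)) → ∀ b → True (not (isY (fN (αN b)))) → ¬ Among Y₁ Y₂ Y₃ (f (α b))
      outside f fN h b p q = T-not p (subst (True ∘ isY) (at-α f fN h b) (isY⁻ _ q))

    isoState : K ≡ (K / 2) * 2 → (∀ b → All True (isoᵇ (αN b))) → IsoState m n j
    isoState even iso = record
      { S = state ; j≡ = refl ; h = K / 2 ; K-even = even
      ; tγ = λ b → tγ b (iso b) ; tγ⁻ = λ b → tγ⁻ b (iso b) ; γ≢α = λ b b′ → γ≢α b b′ (iso b)
      ; α∉Y = λ b → α∉Y b (iso b) ; γ∉Y = λ b → γ∉Y b (iso b) }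
      where
      tγ : ∀ b → All True (isoᵇ (αN b)) → t (it r j (α b)) ≡ it r j (α b)
      tγ b (h ∷ _) = fixes (it r j) rʲN (itr j) b h
      tγ⁻ : ∀ b → All True (isoᵇ (αN b)) → t (it r⁻ j (α b)) ≡ it r⁻ j (α b)
      tγ⁻ b (_ ∷ h ∷ _) = fixes (it r⁻ j) r⁻ʲN (itr⁻ j) b h
      γ≢α : ∀ b b′ → All True (isoᵇ (αN b)) → it r j (α b) ≢ α b′
      γ≢α b b′ (_ ∷ _ ∷ h ∷ _) = avoids (it r j) rʲN (itr j) b b′ h
      α∉Y : ∀ b → All True (isoᵇ (αN b)) → ¬ Among Y₁ Y₂ Y₃ (α b)
      α∉Y b (_ ∷ _ ∷ _ ∷ h ∷ _) = outside (λ x → x) (λ x → x) (λ _ → refl) b h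
      γ∉Y : ∀ b → All True (isoᵇ (αN b)) → ¬ Among Y₁ Y₂ Y₃ (it r j (α b))
      γ∉Y b (_ ∷ _ ∷ _ ∷ _ ∷ h ∷ _) = outside (it r j) rʲN (itr j) b h

    triState : j ≡ 1 → K ≡ (K / 10) * 10 → (∀ b → All True (triᵇ (αN b))) → TriState m n
    triState j≡1 ten tri = record
      { S = state ; j≡ = j≡1 ; h = K / 10 ; K-ten = ten
      ; tβ = λ b → tβ b (tri b) ; tγ = λ b → tγ b (tri b)
      ; α≢β = λ b b′ p → β≢α b′ b (tri b′) (sym p) ; α≢γ = λ b b′ p → γ≢α b′ b (tri b′) (sym p) ; β≢γ = λ b b′ → β≢γ b b′ (tri b)
      ; α∉Y = λ b → α∉Y b (tri b) ; β∉Y = λ b → β∉Y b (tri b) ; γ∉Y = λ b → γ∉Y b (tri b) }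
      where
      toℕ-β : ∀ i → toℕ (τ 1 i) ≡ βN (toℕ i)
      toℕ-β i = trans (toℕ-r _) (cong rN (trans (toℕ-t _) (cong tN (toℕ-r⁻ i))))
      tβ : ∀ b → All True (triᵇ (αN b)) → t (τ 1 (α b)) ≡ τ 1 (α b)
      tβ b (h ∷ _) = fixes (τ 1) βN toℕ-β b h
      tγ : ∀ b → All True (triᵇ (αN b)) → t (r (α b)) ≡ r (α b)
      tγ b (_ ∷ h ∷ _) = fixes r rN toℕ-r b h
      β≢α : ∀ b b′ → All True (triᵇ (αN b)) → τ 1 (α b) ≢ α b′
      β≢α b b′ (_ ∷ _ ∷ h ∷ _) = avoids (τ 1) βN toℕ-β b b′ h
      γ≢α : ∀ b b′ → All True (triᵇ (αN b)) → r (α b) ≢ α b′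
      γ≢α b b′ (_ ∷ _ ∷ _ ∷ h ∷ _) = avoids r rN toℕ-r b b′ h
      β≢γ : ∀ b b′ → All True (triᵇ (αN b)) → τ 1 (α b) ≢ r (α b′)
      β≢γ b b′ (_ ∷ _ ∷ _ ∷ _ ∷ h₀ ∷ h₁ ∷ _) p =
          neq (pick b′) (trans (sym (at-α (τ 1) βN toℕ-β b)) (trans (cong toℕ p) (at-α r rN toℕ-r b′)))
        where
        pick : ∀ b′ → True (not (βN (αN b) ≡ᵇ rN (αN b′)))
        pick false = h₀
        pick true  = h₁
      α∉Y : ∀ b → All True (triᵇ (αN b)) → ¬ Among Y₁ Y₂ Y₃ (α b)
      α∉Y b (_ ∷ _ ∷ _ ∷ _ ∷ _ ∷ _ ∷ h ∷ _) = outside (λ x → x) (λ x → x) (λ _ → refl) b h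
      β∉Y : ∀ b → All True (triᵇ (αN b)) → ¬ Among Y₁ Y₂ Y₃ (τ 1 (α b))
      β∉Y b (_ ∷ _ ∷ _ ∷ _ ∷ _ ∷ _ ∷ _ ∷ h ∷ _) = outside (τ 1) βN toℕ-β b h
      γ∉Y : ∀ b → All True (triᵇ (αN b)) → ¬ Among Y₁ Y₂ Y₃ (r (α b))
      γ∉Y b (_ ∷ _ ∷ _ ∷ _ ∷ _ ∷ _ ∷ _ ∷ _ ∷ h ∷ _) = outside r rN toℕ-r b h

  toIsoState : All True isoStateᵇ → IsoState m n j
  toIsoState (even ∷ s ∷ i₀ ∷ i₁ ∷ []) = go (and-sound stateᵇ s)
    where
    go : All True stateᵇ → IsoState m n j
    go (c ∷ n>1 ∷ sep ∷ p₀ ∷ p₁ ∷ cov ∷ []) =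
      FromChecks.isoState c n>1 sep (and-sound (portᵇ α₀) p₀) (and-sound (portᵇ α₁) p₁) cov (eq even)
        λ { false → and-sound (isoᵇ α₀) i₀ ; true → and-sound (isoᵇ α₁) i₁ }

  toTriState : All True triStateᵇ → TriState m n
  toTriState (j≡1 ∷ ten ∷ s ∷ i₀ ∷ i₁ ∷ []) = go (and-sound stateᵇ s)
    where
    go : All True stateᵇ → TriState m n
    go (c ∷ n>1 ∷ sep ∷ p₀ ∷ p₁ ∷ cov ∷ []) =
      FromChecks.triState c n>1 sep (and-sound (portᵇ α₀) p₀) (and-sound (portᵇ α₁) p₁) cov (eq j≡1) (eq ten)
        λ { false → and-sound (triᵇ α₀) i₀ ; true → and-sound (triᵇ α₁) i₁ }

-- Types obtained by gluing polygons

open +-*-Solver using (solve; _:+_; _:*_; _:=_; con)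

private
  -- The base has m = 9 + 2 ℓ + f and n = 9 + ℓ + f; solved for the parameters, ℓ = m - n and f = 2
  -- n - m - 9.
  baseState′ : ∀ ℓ f {m n} → n + ℓ ≡ m → 9 + m + f ≡ n + n → IsoState m n 2
  baseState′ ℓ f {n = n} refl q = subst₂ (λ m n → IsoState m n 2)
    (trans (solve 2 (λ ℓ f → con 7 :+ (ℓ :* con 2 :+ (con 2 :+ f)) := (ℓ :+ con 9 :+ f) :+ ℓ) refl ℓ f) (cong (_+ ℓ) (sym n≡)))
    (trans (solve 2 (λ ℓ f → con 7 :+ (ℓ :+ (con 2 :+ f)) := ℓ :+ con 9 :+ f) refl ℓ f) (sym n≡)) (baseState ℓ f)
    where
    n≡ : n ≡ ℓ + 9 + f
    n≡ = +-cancelˡ-≡ n n (ℓ + 9 + f) (trans (sym q) (solve 3 (λ n ℓ f → con 9 :+ (n :+ ℓ) :+ f := n :+ (ℓ :+ con 9 :+ f)) refl n ℓ f))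

  -- Here m = 6 + 2 ℓ + f and c = 6 + ℓ + f, where 6 counts the four special points and the two free
  -- ones required next to loops.
  polygonTile′ : ∀ ℓ f {m c} → c + ℓ ≡ m → 6 + m + f ≡ c + c → IsoTile m c 2
  polygonTile′ ℓ f {c = c} refl q = subst₂ (λ m c → IsoTile m c 2)
    (trans (solve 2 (λ ℓ f → con 4 :+ (ℓ :* con 2 :+ (con 2 :+ f)) := (ℓ :+ con 6 :+ f) :+ ℓ) refl ℓ f) (cong (_+ ℓ) (sym c≡)))
    (trans (solve 2 (λ ℓ f → con 4 :+ (ℓ :+ (con 2 :+ f)) := ℓ :+ con 6 :+ f) refl ℓ f) (sym c≡)) (gonTile ℓ (suc f) (inj₂ (s≤s z≤n)))
    where
    c≡ : c ≡ ℓ + 6 + f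
    c≡ = +-cancelˡ-≡ c c (ℓ + 6 + f) (trans (sym q) (solve 3 (λ n ℓ f → con 6 :+ (n :+ ℓ) :+ f := n :+ (ℓ :+ con 6 :+ f)) refl c ℓ f))

polygonState : ∀ {m n} → n ≤ m → 9 + m ≤ n + n → IsoState m n 2
polygonState p q = baseState′ (proj₁ (m≤n⇒∃[o]m+o≡n p)) (proj₁ (m≤n⇒∃[o]m+o≡n q)) (proj₂ (m≤n⇒∃[o]m+o≡n p)) (proj₂ (m≤n⇒∃[o]m+o≡n q))

polygonTile : ∀ {m c} → c ≤ m → 6 + m ≤ c + c → IsoTile m c 2
polygonTile p q = polygonTile′ (proj₁ (m≤n⇒∃[o]m+o≡n p)) (proj₁ (m≤n⇒∃[o]m+o≡n q)) (proj₂ (m≤n⇒∃[o]m+o≡n p)) (proj₂ (m≤n⇒∃[o]m+o≡n q))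

fullTile : ∀ {m} → 5 ≤ m → IsoTile m m 2
fullTile (s≤s (s≤s (s≤s (s≤s (s≤s {n = f} z≤n))))) = gonTile 0 f (inj₁ refl)

module _ {Q : ℕ → Set₁} (c : ℕ) .{{_ : NonZero c}} (step : ∀ {n} → Q n → Q (n + c)) where
  steps : ∀ i {n} → Q n → Q (n + i * c)
  steps zero    {n} q = subst Q (sym (+-identityʳ n)) q
  steps (suc i) {n} q = subst Q (+-assoc n c (i * c)) (steps i (step q))

  fromWindow : ∀ a → (∀ i → i < c → Q (a + i)) → ∀ n → a ≤ n → Q n
  fromWindow a window n a≤n = subst Q (trans (+-assoc a (o % c) _) (trans (cong (a +_) (sym (m≡m%n+[m/n]*n o c))) (m+[n∸m]≡n a≤n)))
    (steps (o / c) (window (o % c) (m%n<n o c)))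
    where
    o = n ∸ a

halve : ∀ n → ∃[ h ] (n ≡ h + h ⊎ n ≡ suc (h + h))
halve zero = 0 , inj₁ refl
halve (suc n) with halve n
... | h , inj₁ refl = h , inj₂ refl
... | h , inj₂ refl = suc h , inj₁ (cong suc (sym (+-suc h h)))

double-cancel-≤ : ∀ {a b} → a + a ≤ b + b → a ≤ b
double-cancel-≤ p = ≮⇒≥ λ q → <⇒≱ (+-mono-< q q) p

double-cancel-< : ∀ {a b} → a + a < b + b → a < b
double-cancel-< p = ≰⇒> λ q → <⇒≱ p (+-mono-≤ q q)

-- One base and one tile, sharing n as equally as possible. The base needs 9 + m and the tile 6 + m
-- below twice its share, so the base gets the larger part: one more than the tile if n is odd, two
-- more if n is even.
twoPolygons : ∀ {m n} → 9 ≤ m → 8 + m ≤ n → n ≤ m + m → IsoState m n 2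
twoPolygons {m} {n} 9≤m low upp with halve n
... | h , inj₂ refl = appendTile (polygonTile (<⇒≤ h<m) (≤-trans (n≤1+n _) (s≤s⁻¹ low)))
        (polygonState h<m (subst (9 + m ≤_) (cong suc (sym (+-suc h h))) (s≤s low)))
  where
  h<m : h < m
  h<m = double-cancel-< upp
... | zero , inj₁ refl = ⊥-elim (n≮0 low)
... | suc h , inj₁ refl with m≤n⇒m<n∨m≡n (double-cancel-≤ upp)
...   | inj₁ h+1<m = subst (λ n → IsoState m n 2) (cong suc (sym (+-suc h h)))
        (appendTile (polygonTile (<⇒≤ (<⇒≤ h+1<m)) (s≤s⁻¹ (s≤s⁻¹ (subst (8 + m ≤_) (cong suc (+-suc h h)) low))))
          (polygonState h+1<m (≤-trans (n≤1+n _) (subst (10 + m ≤_) (cong suc (sym (trans (+-suc (suc h) (suc h)) refl))) (s≤s (s≤s low))))))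
-- For n = 2 m the base cannot take more than m, and the tile is a full polygon without loops.
...   | inj₂ refl = appendTile (fullTile (≤-trans (s≤s (s≤s (s≤s (s≤s (s≤s z≤n))))) 9≤m)) (polygonState ≤-refl (+-monoˡ-≤ m 9≤m))

private
  ∸≤ : ∀ {n a b} → n ≤ a + b → n ∸ b ≤ a
  ∸≤ {n} {a} {b} p = subst (n ∸ b ≤_) (m+n∸n≡m a b) (∸-monoˡ-≤ b p)

-- From 8 + 2 m on, a full m-gon is split off. Below that the remainder would be too small for
-- `twoPolygons`, so the tile is shortened to c = m - 7, which leaves at least 8 + m. Its condition
-- 6 + m ≤ 2 c says m ≥ 20; this is the origin of the bound 20.
threePolygons : ∀ {m n} → 20 ≤ m → suc (m + m) ≤ n → n ≤ m + m + m → IsoState m n 2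
threePolygons {m} {n} 20≤m low upp with 8 + m + m ≤? n
... | yes p = subst (λ n → IsoState m n 2) (m∸n+n≡m m≤n)
      (appendTile (fullTile (≤-trans 5≤20 20≤m)) (twoPolygons (≤-trans 9≤20 20≤m) (m+n≤o⇒m≤o∸n (8 + m) p) (∸≤ upp)))
  where
  m≤n : m ≤ n
  m≤n = ≤-trans (m≤n+m m (8 + m)) p
  5≤20 : 5 ≤ 20
  5≤20 = ≤ᵇ⇒≤ 5 20 _
  9≤20 : 9 ≤ 20
  9≤20 = ≤ᵇ⇒≤ 9 20 _
... | no p = go (m∸n+n≡m (≤-trans (≤ᵇ⇒≤ 7 20 _) 20≤m))
  where
  13≤m∸7 : 13 ≤ m ∸ 7
  13≤m∸7 = ∸-monoˡ-≤ 7 20≤m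
  go : ∀ {c} → c + 7 ≡ m → IsoState m n 2
  go {c} refl = subst (λ n → IsoState m n 2) (m∸n+n≡m (≤-trans (m≤n+m c (8 + m)) low′))
      (appendTile (polygonTile (m≤m+n c 7) (subst (_≤ c + c) (solve 1 (λ c → con 13 :+ c := con 6 :+ (c :+ con 7)) refl c) (+-monoˡ-≤ c 13≤c)))
        (twoPolygons (≤-trans (≤ᵇ⇒≤ 9 20 _) 20≤m) (m+n≤o⇒m≤o∸n (8 + m) low′) (∸≤ (≤-trans (s≤s⁻¹ (≰⇒> p)) 7+m+m≤))))
    where
    13≤c : 13 ≤ c
    13≤c = subst (13 ≤_) (m+n∸n≡m c 7) 13≤m∸7
    low′ : 8 + m + c ≤ n
    low′ = subst (_≤ n) (solve 1 (λ c → con 1 :+ (c :+ con 7 :+ (c :+ con 7)) := con 8 :+ (c :+ con 7) :+ c) refl c) low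
    7+m+m≤ : 7 + m + m ≤ m + m + c
    7+m+m≤ = subst (7 + m + m ≤_) (+-comm c (m + m)) (+-monoˡ-≤ (m + m) (≤-trans (≤ᵇ⇒≤ 7 13 _) 13≤c))

-- Tables of finite examples

closedData triangleData squareData polygonData : List Datum
closedData =
  entry 3 7 5 0 1_0012_0105_0306_0414_0913_1011 1 6 3 2 7 (1_00_01_02 ∷ 1_11_01_01 ∷ 1_11_00_01_00 ∷ []) 1_01_01_02_02 false 0 0 ∷
  entry 3 8 5 1 1_0011_0114_0310_0407_0615_0812 1 14 1 9 9 (1_10_00_00 ∷ 1_10_01_01_01 ∷ 1_00_01_00 ∷ 1_01_01 ∷ []) 1_01_01_02_02 true 0 0 ∷
  entry 3 9 8 3 1_0005_0123_0218_0306_0714_0925_1021_1112_1519_1624_1726_2022 1 14 7 4 95 (1_10_00_00 ∷ 1_01_01_01_01 ∷ 1_00_01_01_02 ∷ 1_11_00_01 ∷ []) 1_01_01_01_02_02 false 0 0 ∷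
  entry 3 10 7 1 1_0014_0115_0220_0309_0513_0611_0708_1017_1221_1819 1 17 10 4 6 (1_00_00 ∷ 1_01_01_01_01_02 ∷ 1_00_01_01_01 ∷ 1_01_01_01_02_01 ∷ 1_10_00_01_01_01_00 ∷ []) 1_01_01_01_02_02 true 0 0 ∷
  entry 3 11 3 2 1_0004_0109_0207_0610 1 4 0 8 2 (1_00_01_02 ∷ 1_01_01_00 ∷ []) 1_01_01_02_02 false 0 0 ∷
  entry 3 12 8 1 1_0007_0222_0309_0421_0520_0608_1017_1224_1319_1523 1 9 3 18 13 (1_00_00 ∷ 1_00_01_01_01_02 ∷ 1_01_01_01_01_01_00 ∷ 1_01_02_00 ∷ 1_00_01_02_01_01 ∷ 1_00_01_02_01 ∷ 1_01_01_02_01_00 ∷ []) 1_01_01_01_02_02 true 0 0 ∷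
  entry 3 13 4 1 1_0112_0207_0310_0406 1 6 4 11 3 (1_01_01_02_00 ∷ 1_00_01_02_01 ∷ []) 1_01_01_01_02_02 true 0 0 ∷
  entry 3 14 10 0 1_0017_0102_0326_0429_0527_0611_0715_0925_1023_1214_1322_1619_2024_2128 1 19 16 8 8 (1_00_00 ∷ 1_01_01_01_01_02 ∷ 1_11_01_02_02 ∷ 1_01_01_01_01 ∷ 1_11_01_02 ∷ 1_10_01_01_02_00 ∷ []) 1_01_01_02_02 false 0 0 ∷
  entry 3 15 5 1 1_0012_0206_0310_0415_0709_1314 1 3 10 8 9 (1_00_00 ∷ 1_01_01_02 ∷ 1_00_01_00 ∷ 1_01_01 ∷ []) 1_01_01_02_02 true 0 0 ∷
  entry 4 5 8 0 1_0030_0117_0228_0325_0409_0721_0822_1118_1215_1331_1426_1920_2329_2427 1 7 21 16 17 (1_00_02_02 ∷ 1_10_02_02 ∷ 1_01_01_01 ∷ 1_00_01_01_00 ∷ []) 1_01_03 true 0 0 ∷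
  entry 4 6 6 0 1_0014_0123_0221_0305_0406_0709_1217_1319_1520_1622 1 19 13 18 29 (1_11_01 ∷ 1_01_01 ∷ []) 1_01_02_03 true 0 0 ∷
  entry 4 7 6 0 1_0015_0323_0407_0511_0609_0818_1022_1221_1314_1619 1 21 12 1 30 (1_00_00 ∷ 1_10_01_02 ∷ 1_00_02_01 ∷ 1_10_01_00 ∷ 1_11_00_01 ∷ []) 1_01_01_03_02 false 0 0 ∷
  entry 4 8 4 1 1_0005_0215_0313_0607_1014_1116 1 13 3 12 13 (1_11_01 ∷ 1_01_01 ∷ []) 1_01_03 true 0 0 ∷
  entry 4 9 2 1 1_0005_0107_0304_0608 1 3 4 2 1 (1_11_01 ∷ 1_01_01 ∷ []) 1_01_03 false 0 0 ∷
  entry 4 10 6 0 1_0013_0104_0203_0519_0607_0811_0920_1221_1622_1718 1 12 21 10 5 (1_10_00_00 ∷ 1_11_01_02 ∷ 1_10_01_01_00 ∷ 1_10_02_01 ∷ 1_11_02 ∷ 1_10_02_00 ∷ 1_11_00_01 ∷ []) 1_01_03 true 0 0 ∷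
  entry 5 5 3 0 1_0007_0104_0213_0611_0810_1214 1 6 11 9 7 (1_10_00_00 ∷ 1_00_03 ∷ 1_10_01_00 ∷ 1_11_00_01 ∷ []) 1_01_03_03 true 0 0 ∷
  entry 5 6 3 0 1_0111_0205_0304_0607_0812_1314 2 12 8 9 5 (1_00_00 ∷ 1_10_00 ∷ 1_01_01 ∷ []) 1_01_01 true 0 0 ∷
  entry 5 7 3 0 1_0002_0105_0310_0409_0714_1213 1 9 4 11 5 (1_00_00 ∷ 1_01_01_02 ∷ 1_10_01_01 ∷ 1_00_03_00 ∷ 1_01_01 ∷ []) 1_01_03 false 0 0 ∷
  entry 5 10 4 0 1_0011_0115_0205_0410_0709_0817_1218_1619 2 8 17 3 3 (1_00_00 ∷ 1_10_02_01 ∷ 1_11_01_02 ∷ 1_01_01_02 ∷ []) 1_01_02_04 false 0 0 ∷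
  entry 6 6 2 0 1_0009_0106_0208_0710 1 0 9 3 2 (1_10_00_00 ∷ 1_00_03 ∷ 1_00_01_00 ∷ 1_10_01_00 ∷ 1_11_00_01 ∷ []) 1_01_03 false 0 0 ∷
  entry 6 7 6 3 1_0018_0138_0226_0420_0517_0619_0809_1014_1122_1330_1516_2131_2328_2425_2737_2934_3233_3536 1 4 20 7 215 (1_10_00_00 ∷ 1_10_02_02 ∷ 1_11_00_01_01 ∷ 1_00_01_01_00 ∷ 1_10_01_02 ∷ 1_10_02_00 ∷ 1_11_00_01 ∷ []) 1_01_03 true 0 0 ∷
  entry 6 8 6 0 1_0001_0211_0425_0535_0607_0813_0929_1020_1219_1530_1618_1733_2122_2627_2832_3134 2 16 18 23 373 (1_00_00 ∷ 1_11_01 ∷ 1_01_01 ∷ []) 1_01_01 true 0 0 ∷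
  entry 6 9 2 0 1_0001_0210_0405_0809 2 5 4 6 1 (1_01_01 ∷ []) 1_01_01 false 0 0 ∷
  entry 6 10 4 0 1_0001_0220_0316_0615_0722_0809_1011_1223_1417_1819 1 14 17 4 93 (1_10_02_01 ∷ 1_11_04 ∷ []) 1_01_05 false 0 0 ∷
  entry 7 7 1 1 1_0102_0307 3 3 7 6 1 (1_00_00 ∷ 1_01_01 ∷ []) 1_01_01 true 0 0 ∷
  entry 8 11 4 3 1_0001_0203_0413_0532_0611_0720_0830_0923_1027_1218_1526_1624_1729_1922_2534_3133 2 23 9 28 13 (1_00_00 ∷ 1_11_02_01 ∷ 1_01_02_01 ∷ 1_11_00_02 ∷ 1_11_00_01_00 ∷ 1_11_04 ∷ 1_01_04 ∷ 1_11_01_02 ∷ 1_11_00_01 ∷ []) 1_01_01 false 0 0 ∷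
  entry 10 14 6 0 1_0017_0102_0324_0540_0612_0735_0809_1025_1157_1355_1541_1656_1838_1958_2026_2127_2234_2354_2849_2947_3031_3233_3651_3739_4259_4352_4653_4850 1 46 53 44 61 (1_11_00_01_01 ∷ 1_11_03_01 ∷ 1_01_03_01 ∷ 1_10_00_01_00 ∷ 1_11_00_01 ∷ []) 1_01_07 true 0 0 ∷
  []

triangleData =
  entry 3 16 11 0 1_0003_0519_0609_1124_1220_1321_1532_1617_1830_2229_2527_2631 1 29 22 14 13 (1_10_00_00 ∷ 1_10_01_01_01 ∷ 1_10_00_01_01_00 ∷ 1_00_01_01_02 ∷ 1_11_00_01 ∷ []) 1_01_01_01_02_02 false 1 7 ∷
  entry 3 17 11 1 1_0003_0531_0609_1127_1217_1332_1533_1626_1828_2023_2224_2930 1 20 23 25 13 (1_10_01_02_00 ∷ 1_11_01_02_01 ∷ []) 1_01_01_01_02_02 true 1 7 ∷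
  entry 3 18 12 0 1_0003_0519_0609_1126_1231_1417_1525_1630_1827_2023_2128_2224_2934_3233 1 33 32 13 23 (1_00_00 ∷ 1_10_01_01_01_01 ∷ 1_01_01_02_01_01 ∷ 1_11_01_01_00 ∷ 1_11_00_01 ∷ []) 1_01_01_01_01_02_02 true 1 7 ∷
  entry 3 19 13 0 1_0003_0528_0609_1114_1226_1320_1537_1631_1718_2127_2223_2434_2529_3336 1 31 16 38 23 (1_00_00 ∷ 1_00_01_02_00 ∷ 1_11_01_01_02_01 ∷ 1_10_02 ∷ 1_00_01_02_02_00 ∷ 1_11_00_01_01_02 ∷ []) 1_01_01_01_02_01_02 true 1 7 ∷
  entry 3 20 14 0 1_0003_0517_0609_1127_1216_1314_1534_1832_1938_2040_2141_2223_2437_2530_2839_3536 1 24 37 33 73 (1_00_01_01_02_02 ∷ 1_10_01_01_02_02 ∷ 1_11_00_01_01_00 ∷ 1_00_01_01 ∷ 1_00_01_01_01_02 ∷ 1_01_01_01_01_01_00 ∷ 1_01_01 ∷ []) 1_01_01_01_02_02_02 true 1 7 ∷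
  entry 3 21 14 2 1_0003_0534_0609_1118_1241_1314_1536_1629_1740_1942_2023_2127_2231_2426_2538_3239_3337_3543 1 31 22 28 93 (1_10_00_00 ∷ 1_00_01_01_02_02 ∷ 1_10_01_01_01 ∷ 1_00_01_02_01_01_00 ∷ 1_01_01 ∷ []) 1_01_01_02_02 false 1 7 ∷
  entry 3 22 15 0 1_0003_0523_0609_1136_1215_1322_1419_1642_1825_2024_2141_2632_2728_2940_3144_3438_3543_3739 1 31 44 33 23 (1_00_00 ∷ 1_01_01_01_02_02 ∷ 1_01_01_02_01 ∷ 1_10_00_01_01_02 ∷ 1_11_01_01_02_00 ∷ 1_01_01 ∷ []) 1_01_01_02_02 false 1 7 ∷
  entry 3 23 16 0 1_0003_0527_0609_1146_1244_1345_1440_1528_1618_1747_1925_2026_2133_2223_2436_2937_3035_3138_3441_4243 1 30 35 39 173 (1_00_00 ∷ 1_01_01_01_01_02 ∷ 1_00_01_01_02_01 ∷ 1_10_01_01_01 ∷ 1_11_01_01_02_00 ∷ 1_10_01_01_00 ∷ 1_11_01_01_01_01 ∷ 1_10_02 ∷ 1_01_01_01_01_01_00 ∷ 1_10_00_01_01_02 ∷ 1_11_01_01_01_00 ∷ 1_01_01 ∷ []) 1_01_01_01_01_02_02 false 1 7 ∷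
  entry 3 24 16 1 1_0003_0514_0609_1144_1231_1339_1538_1721_1830_1925_2046_2243_2328_2442_2627_2947_3248_3336_3445_4041 1 33 36 16 93 (1_01_01_02_00 ∷ 1_11_01_02_01 ∷ []) 1_01_01_01_02_02 true 1 7 ∷
  []

squareData =
  entry 4 11 6 0 1_0008_0210_0319_0509_0607_1123_1220_2122 1 5 9 1 23 (1_00_01_02 ∷ 1_01_03_00 ∷ 1_00_01_01 ∷ 1_11_00_02 ∷ 1_00_01_00 ∷ 1_11_00_01 ∷ []) 1_01_03 false 17 14 ∷
  entry 4 12 6 1 1_0008_0522_0620_0714_1024_1121_1215_1316 1 20 6 23 93 (1_11_01 ∷ 1_01_01 ∷ []) 1_01_03 true 2 18 ∷
  entry 4 13 6 2 1_0024_0104_0512_0613_0710_1416_1725_1821 1 12 5 2 13 (1_10_00_00 ∷ 1_11_02_01_02 ∷ 1_10_02_03 ∷ 1_11_02_00 ∷ 1_10_02_01_03 ∷ 1_11_01_00 ∷ []) 1_01_01_03 true 8 23 ∷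
  entry 4 14 6 4 1_0008_0206_0324_0916_1017_1125_1223_1318_1427_1526 1 16 9 1 23 (1_10_01_03 ∷ 1_11_01_01_02 ∷ 1_00_02_02 ∷ 1_01_02_03 ∷ 1_10_01_01_03 ∷ 1_11_01_00 ∷ []) 1_01_03 false 4 21 ∷
  []

polygonData =
  entry 5 8 3 1 1_0007_0104_0211_0515 2 11 2 9 1 (1_00_00 ∷ 1_01_02_01 ∷ 1_00_03 ∷ 1_10_01_02 ∷ 1_11_01_00 ∷ 1_01_01 ∷ []) 1_04_03 false 6 12 ∷
  entry 5 9 4 0 1_0008_0214_0506_0919_1016_1112 2 0 8 7 9 (1_00_00 ∷ 1_11_01 ∷ 1_01_01 ∷ []) 1_04_03 false 15 1 ∷
  entry 5 11 5 0 1_0216_0304_0506_0708_0919_1021_1317_1524 2 3 4 18 3 (1_00_00 ∷ []) 1_01_01 false 14 20 ∷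
  entry 5 12 5 0 1_0409_0618_0711_1015_1321_1617 2 16 17 12 1 (1_00_00 ∷ []) 1_01_01 false 0 22 ∷
  entry 5 15 6 0 1_0221_0612_0710_0928_1123_1315_1420_1824 2 7 10 17 93 (1_10_02_01 ∷ 1_01_03_00 ∷ 1_00_01_02 ∷ 1_11_01_01 ∷ 1_11_00_01_00 ∷ []) 1_01_01 true 1 29 ∷
  entry 6 11 4 0 1_0022_0111_0203_0713_1218_1516 2 16 15 9 9 (1_01_01 ∷ []) 1_02_03 true 23 6 ∷
  entry 6 12 4 0 1_0108_0523_0612_0914_1117_1319 2 17 11 16 9 (1_11_01 ∷ 1_01_01 ∷ []) 1_01_04 false 0 18 ∷
  entry 6 13 4 2 1_0411_0624_0820_0921_1318_1925 2 4 11 23 13 (1_00_01_05 ∷ 1_01_01_00 ∷ []) 1_01_02_05 false 3 14 ∷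
  entry 6 14 4 4 1_0024_0107_0316_0525_0923_1420_1927_2126 2 0 24 2 3 (1_00_00 ∷ 1_01_01 ∷ []) 1_01_02_01 true 8 17 ∷
  entry 6 15 4 6 1_0017_0225_0310_0415_0624_0826_1319_1828_2127_2329 2 18 28 20 23 (1_00_00 ∷ 1_01_01 ∷ []) 1_01_01_01 true 12 11 ∷
  entry 6 16 6 0 1_0109_0517_1126_1213_1415_1634_1927_2429_2533_3035 2 24 29 21 13 (1_01_01 ∷ []) 1_01_01 false 0 6 ∷
  entry 7 8 2 2 1_0214_0410_0612_1315 2 13 15 8 1 (1_00_00 ∷ 1_01_01 ∷ []) 1_06_03 true 3 9 ∷
  entry 7 9 3 0 1_0006_0208_0419_0713_1011_1217 2 0 6 14 5 (1_01_01 ∷ []) 1_06_03 true 18 3 ∷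
  entry 7 10 3 0 1_0009_0304_0620_1214 2 20 6 5 1 (1_00_00 ∷ 1_11_01 ∷ 1_01_01 ∷ []) 1_02_06 true 17 13 ∷
  entry 7 11 4 0 1_0008_0102_0304_0506_0925_1318_1415_1627_1920_2223 2 9 25 24 9 (1_00_00 ∷ 1_11_01 ∷ 1_01_01 ∷ []) 1_06_03 false 26 12 ∷
  entry 7 12 4 0 1_0304_0610_0713_0814_1219_1626_2127_2425 2 19 12 1 13 (1_00_00 ∷ 1_00_02_04 ∷ 1_00_02_01_01 ∷ 1_01_01_00 ∷ []) 1_01_05 false 0 15 ∷
  entry 7 13 4 0 1_0117_0207_0826_1112_1825_2127 2 2 7 13 1 (1_00_00 ∷ 1_11_01 ∷ 1_01_01 ∷ []) 1_01_01 true 5 14 ∷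
  entry 7 14 4 0 1_0027_0312_0525_0724_1121_1723 2 17 23 13 3 (1_00_05_01_01 ∷ 1_01_04_04 ∷ []) 1_01_04_01 true 4 8 ∷
  entry 8 8 2 0 1_0113_0205_0309_1215 2 2 5 11 3 (1_01_05 ∷ 1_10_02_00 ∷ 1_01_04 ∷ 1_01_01 ∷ []) 1_03_03 false 6 8 ∷
  entry 8 9 2 2 1_0208_0309_0617_1516 2 6 17 0 1 (1_00_00 ∷ 1_01_01 ∷ []) 1_03_03 true 7 12 ∷
  entry 8 10 2 4 1_0114_0219_0317_0516_0713_1518 2 2 19 4 23 (1_00_00 ∷ 1_01_01 ∷ []) 1_01_01_01 false 10 6 ∷
  entry 8 12 4 0 1_0102_0304_0510_0607_0809_1220_1422_1631_1718_2526_2728_2930 2 2 1 0 13 (1_01_01 ∷ []) 1_01_04 false 21 13 ∷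
  entry 8 13 4 0 1_0121_0203_0405_0609_0718_0815_1628_1920_2223_3031 2 28 16 17 37 (1_00_00 ∷ 1_10_00 ∷ 1_01_01 ∷ []) 1_01_01 true 27 12 ∷
  entry 8 14 4 0 1_0031_0210_0329_0413_0506_0822_0925_1415_1623_1718 2 13 4 12 37 (1_11_01 ∷ 1_01_01 ∷ []) 1_01_05 false 24 28 ∷
  entry 9 10 2 2 1_0018_0209_0714_1519 2 15 19 17 3 (1_00_00 ∷ 1_01_01 ∷ []) 1_01_01 false 1 6 ∷
  entry 9 11 2 4 1_0010_0118_0515_0819_0921_1320 2 9 21 11 13 (1_00_00 ∷ 1_01_01 ∷ []) 1_01_01 true 14 4 ∷
  entry 9 12 2 6 1_0020_0218_0419_0610_0812_0922_1423_1721 2 9 22 11 13 (1_00_00 ∷ 1_01_01 ∷ []) 1_01_06 true 3 13 ∷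
  entry 9 13 3 0 1_0003_0104_0525_0709_0823_1011 2 9 7 18 3 (1_10_00_00 ∷ 1_01_01_04 ∷ 1_00_06 ∷ 1_01_03_00 ∷ 1_00_03 ∷ 1_01_02_01_00 ∷ []) 1_01_04 false 26 14 ∷
  entry 9 14 4 0 1_0011_0405_0607_0917_1024_1319_1415_2021_2631_2735_2829_3334 2 9 17 16 13 (1_01_01 ∷ []) 1_02_05 true 1 25 ∷
  entry 9 15 4 0 1_0012_0233_0607_0824_0917_1516_1826_1920_2135_3031 2 18 26 1 1 (1_01_01 ∷ []) 1_01_01 false 34 3 ∷
  entry 9 16 4 0 1_0034_0310_0621_0708_1415_1920_2233_3132 2 7 8 23 9 (1_00_00 ∷ []) 1_01_01 false 28 11 ∷
  entry 10 12 2 4 1_0013_0316_0521_0720_1823_1922 2 19 22 11 5 (1_00_00 ∷ 1_01_01 ∷ []) 1_02_06 true 4 12 ∷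
  entry 10 13 2 6 1_0012_0120_0221_0522_0911_1624_1825_1923 2 5 22 7 13 (1_00_00 ∷ 1_01_01 ∷ []) 1_03_07 false 15 6 ∷
  entry 10 15 4 0 1_0203_0419_0506_0735_0809_1314_1516_1739_2122_2324_2537_2829_3132_3334 2 22 21 20 37 (1_01_01 ∷ []) 1_01_06 false 10 38 ∷
  entry 10 16 4 0 1_0001_0220_0321_0414_0506_0809_1011_2223_2634_3031_3233_3536 2 9 8 7 93 (1_01_01 ∷ []) 1_01_06 false 15 27 ∷
  entry 10 17 4 0 1_0203_0431_0506_0715_0809_1737_2526_2730_3233_3435 2 30 27 28 9 (1_00_00 ∷ 1_10_00 ∷ 1_01_01 ∷ []) 1_01_01 true 18 20 ∷
  entry 11 14 2 6 1_0315_0517_0824_0923_1022_1226_1327_2125 2 9 23 0 13 (1_00_00 ∷ 1_01_01 ∷ []) 1_03_06 true 2 18 ∷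
  entry 11 15 3 0 1_0028_0102_0304_0517_0623_0710_0829_0927_1131_2232 2 32 22 13 3 (1_00_00 ∷ []) 1_01_01 false 18 12 ∷
  entry 11 16 4 0 1_0001_0233_0304_0616_0910_1112_1425_1819_2021_2232_2324_2829_3142_3536_3738_3940 2 19 18 8 5 (1_01_01 ∷ []) 1_03_06 false 15 43 ∷
  entry 11 17 4 0 1_0015_0236_0506_0934_1121_1213_1718_1920_2535_2728_2930_3343_3940_4142 2 28 27 37 9 (1_01_01 ∷ []) 1_01_01 false 1 22 ∷
  entry 11 18 4 0 1_0417_0607_0809_1042_1213_1525_1819_2223_2728_2930_3139_4041 2 39 31 32 1 (1_00_00 ∷ 1_10_00 ∷ 1_01_01 ∷ []) 1_01_01 true 3 34 ∷
  entry 12 16 4 0 1_0011_0102_0437_0619_0809_1028_1213_1415_1718_2021_2223_2425_2627_2945_3031_3233_3435_3647_3839_4041 2 18 17 16 73 (1_01_01 ∷ []) 1_01_08 true 44 5 ∷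
  entry 12 17 4 0 1_0020_0102_0339_0405_0607_0809_1024_1223_1314_2122_2526_2728_2930_3233_3441_3647_3738_4546 2 33 32 31 5 (1_01_01 ∷ []) 1_01_08 true 17 42 ∷
  entry 12 18 4 0 1_0034_0102_0304_0521_0607_0809_1038_1133_1314_1617_2332_2435_2526_2728_2930_3145_4344_4647 2 17 16 15 23 (1_01_01 ∷ []) 1_02_08 false 22 39 ∷
  entry 12 19 4 0 1_0203_0506_0821_1213_1415_1732_1833_1920_2425_2829_3038_3435_3637_3940 2 6 5 4 5 (1_01_01 ∷ []) 1_02_08 true 9 43 ∷
  entry 13 18 4 0 1_0001_0203_0719_0946_1112_1314_1516_1718_2030_2223_2425_2638_2844_3132_3334_3536_3940_4142_4849_5051 2 26 38 37 9 (1_01_01 ∷ []) 1_01_09 true 45 8 ∷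
  entry 13 19 4 0 1_0102_0313_0405_0607_0834_1448_1516_1718_1940_2122_2324_2527_2829_3031_3233_3841_3951_4243_4546_4950 2 46 45 44 93 (1_01_01 ∷ []) 1_01_10 false 11 37 ∷
  entry 13 20 4 0 1_0102_0320_0506_0708_1238_1346_1617_1819_2223_2728_2930_3141_3334_3940_4243_4748 2 47 48 15 9 (1_00_00 ∷ []) 1_01_01 false 37 11 ∷
  entry 13 27 4 4 1_0203_0553_0925_1152_1326_1429_1732_2341_3351_4243_4454_5055 2 50 55 39 13 (1_00_00 ∷ 1_01_01 ∷ []) 1_01_01 true 6 18 ∷
  entry 14 20 4 0 1_0001_0249_0304_0506_0716_1011_1213_1415_2238_2324_2627_2829_3031_3233_3435_3940_4151_4243_4647_5455 2 27 26 25 13 (1_01_01 ∷ []) 1_01_10 false 50 19 ∷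
  entry 14 21 4 0 1_0001_0217_0304_0506_0809_1040_1213_1427_2122_2653_2841_3233_3446_3536_3738_4255_4344_4849 2 9 8 7 93 (1_01_01 ∷ []) 1_01_10 true 18 52 ∷
  entry 14 29 4 6 1_0001_0356_0725_0936_1357_1628_2021_2758_3359_3460_3751_4243_4961_5455 2 33 59 35 9 (1_00_00 ∷ 1_01_01 ∷ []) 1_01_01 true 4 8 ∷
  entry 15 22 4 0 1_0001_0253_0456_0506_0708_1021_1213_1529_1617_1819_2223_3044_3249_3334_3536_3738_4748_5152_5455_5859 2 1 0 14 5 (1_01_01 ∷ []) 1_01_12 true 26 41 ∷
  entry 15 31 4 2 1_0760_1024_2140_2934_3661_4349 2 7 60 9 1 (1_00_00 ∷ 1_01_01 ∷ []) 1_01_12 true 0 15 ∷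
  entry 15 32 4 4 1_0061_0142_0622_1746_2347_2460_2732_3050_4463_5262 2 0 61 2 13 (1_00_00 ∷ 1_01_01 ∷ []) 1_01_01 true 51 5 ∷
  entry 16 33 4 2 1_0864_0930_1350_2557_4553_5265 2 8 64 10 1 (1_00_00 ∷ 1_01_01 ∷ []) 1_01_01 true 0 12 ∷
  entry 16 34 4 4 1_0038_0148_0451_0965_1164_1430_1653_2041_2255_2745_2862_4458_5667_5966 2 59 66 61 13 (1_00_00 ∷ 1_01_01 ∷ []) 1_01_01 false 21 5 ∷
  entry 17 35 4 2 1_0231_1368_2435_2940_4156_4269 2 13 68 15 3 (1_00_00 ∷ 1_01_01 ∷ []) 1_04_11 true 1 25 ∷
  entry 17 36 4 6 1_0766_0823_1170_1369_1568_2526_3258_4172_4259_4373_5571_5657 2 26 25 10 93 (1_01_01 ∷ []) 1_01_01 false 1 29 ∷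
  entry 18 37 4 2 1_0020_0565_2347_2872_3955_4973 2 28 72 30 1 (1_00_00 ∷ 1_01_01 ∷ []) 1_03_13 false 48 1 ∷
  entry 19 39 4 2 1_1823_3362_3476_3642_4165_6977 2 69 77 71 1 (1_00_00 ∷ 1_01_01 ∷ []) 1_02_15 false 0 45 ∷
  []

closedᵇ triangleᵇ squareᵇ polygonᵇ : Datum → Bool
closedᵇ d = and (Closed.closedᵇ d)
triangleᵇ d = and (Ported.triStateᵇ d)
squareᵇ d = (Datum.j d ≡ᵇ 1) ∧ and (Ported.isoStateᵇ d)
polygonᵇ d = (Datum.j d ≡ᵇ 2) ∧ and (Ported.isoStateᵇ d)

-- As a record type this is compared by its parameters; comparing two types True (all p ds) would repeat the evaluation.
record Checked (p : Datum → Bool) (ds : List Datum) : Set where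
  constructor checked
  field
    passed : True (all p ds)

closed-checked : Checked closedᵇ closedData
closed-checked = checked tt
triangle-checked : Checked triangleᵇ triangleData
triangle-checked = checked tt
square-checked : Checked squareᵇ squareData
square-checked = checked tt
polygon-checked : Checked polygonᵇ polygonData
polygon-checked = checked tt

listed : ℕ → ℕ → List Datum → Bool
listed m n = any (λ d → (Datum.m d ≡ᵇ m) ∧ (Datum.n d ≡ᵇ n))

listed-sound : ∀ {a} {Q : ℕ → ℕ → Set a} (p : Datum → Bool) → (∀ d → True (p d) → Q (Datum.m d) (Datum.n d)) →
  ∀ ds → Checked p ds → ∀ m n → True (listed m n ds) → Q m n
listed-sound {Q = Q} p sound ds (checked c) m n = go ds c
  where
  go : ∀ ds → True (all p ds) → True (listed m n ds) → Q m n
  go (d ∷ ds) c h with Equivalence.to (T-∨ {(Datum.m d ≡ᵇ m) ∧ (Datum.n d ≡ᵇ n)}) h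
  ... | inj₁ h₁ = subst₂ Q (≡ᵇ⇒≡ _ m (∧₁ h₁)) (≡ᵇ⇒≡ _ n (∧₂ {Datum.m d ≡ᵇ m} h₁)) (sound d (∧₁ c))
  ... | inj₂ h₂ = go ds (∧₂ {p d} c) h₂

closed-sound : ∀ m n → True (listed m n closedData) → Core m n
closed-sound = listed-sound closedᵇ (λ d h → Closed.core d (and-sound (Closed.closedᵇ d) h)) closedData closed-checked

triangle-sound : ∀ m n → True (listed m n triangleData) → TriState m n
triangle-sound = listed-sound triangleᵇ (λ d h → Ported.toTriState d (and-sound (Ported.triStateᵇ d) h)) triangleData triangle-checked

square-sound : ∀ m n → True (listed m n squareData) → IsoState m n 1
square-sound = listed-sound squareᵇ (λ d h → subst (IsoState (Datum.m d) (Datum.n d)) (≡ᵇ⇒≡ _ 1 (∧₁ h))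
  (Ported.toIsoState d (and-sound (Ported.isoStateᵇ d) (∧₂ {Datum.j d ≡ᵇ 1} h)))) squareData square-checked

polygon-sound : ∀ m n → True (listed m n polygonData) → IsoState m n 2
polygon-sound = listed-sound polygonᵇ (λ d h → subst (IsoState (Datum.m d) (Datum.n d)) (≡ᵇ⇒≡ _ 2 (∧₁ h))
  (Ported.toIsoState d (and-sound (Ported.isoStateᵇ d) (∧₂ {Datum.j d ≡ᵇ 2} h)))) polygonData polygon-checked

startᵇ tileᵇ : ℕ → ℕ → Bool
startᵇ m n = ((n ≤ᵇ m) ∧ (9 + m ≤ᵇ n + n)) ∨ listed m n polygonData
tileᵇ m c = ((5 ≤ᵇ m) ∧ (c ≡ᵇ m)) ∨ ((c ≤ᵇ m) ∧ (6 + m ≤ᵇ c + c))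

-- At most f tiles on top of a base state or of a listed one.
reachable : ℕ → ℕ → ℕ → Bool
reachable zero    m n = startᵇ m n
-- The candidates are the numbers up to m, since no polygonal tile has c > m; the full polygon is
-- tried first.
reachable (suc f) m n = startᵇ m n ∨ any (λ c → (c ≤ᵇ n) ∧ (tileᵇ m c ∧ reachable f m (n ∸ c))) (downFrom (suc m))

start-sound : ∀ m n → True (startᵇ m n) → IsoState m n 2
start-sound m n h = [ (λ p → polygonState (≤ᵇ⇒≤ n m (∧₁ p)) (≤ᵇ⇒≤ (9 + m) (n + n) (∧₂ {n ≤ᵇ m} p))) , polygon-sound m n ]′
  (Equivalence.to (T-∨ {(n ≤ᵇ m) ∧ (9 + m ≤ᵇ n + n)}) h)

tile-sound : ∀ m c → True (tileᵇ m c) → IsoTile m c 2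
tile-sound m c h = [ (λ p → subst (λ c → IsoTile m c 2) (sym (≡ᵇ⇒≡ c m (∧₂ {5 ≤ᵇ m} p))) (fullTile (≤ᵇ⇒≤ 5 m (∧₁ p)))) ,
                     (λ p → polygonTile (≤ᵇ⇒≤ c m (∧₁ p)) (≤ᵇ⇒≤ (6 + m) (c + c) (∧₂ {c ≤ᵇ m} p))) ]′
  (Equivalence.to (T-∨ {(5 ≤ᵇ m) ∧ (c ≡ᵇ m)}) h)

reachable-sound : ∀ f m n → True (reachable f m n) → IsoState m n 2
reachable-sound zero    m n h = start-sound m n h
reachable-sound (suc f) m n h = [ start-sound m n , (λ p → append (satisfied (any⁻ appendᵇ (downFrom (suc m)) p))) ]′
    (Equivalence.to (T-∨ {startᵇ m n}) h)
  where
  appendᵇ : ℕ → Bool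
  appendᵇ c = (c ≤ᵇ n) ∧ (tileᵇ m c ∧ reachable f m (n ∸ c))
  append : ∃[ c ] True (appendᵇ c) → IsoState m n 2
  append (c , p) = subst (λ n → IsoState m n 2) (m∸n+n≡m (≤ᵇ⇒≤ c n (∧₁ p)))
    (appendTile (tile-sound m c (∧₁ (∧₂ {c ≤ᵇ n} p))) (reachable-sound f m (n ∸ c) (∧₂ {tileᵇ m c} (∧₂ {c ≤ᵇ n} p))))

-- For n < small m there may be no state to extend; the interval of length m starting at small m consists of states only.
small : ℕ → ℕ
small 3 = 16
small 4 = 11
small m = suc (m + m)

-- Covering all hyperbolic types

hyperbolicᵇ smallᵇ : ℕ → ℕ → Bool
hyperbolicᵇ m n = 2 * (m + n) <ᵇ m * n
smallᵇ m n = not ((m ≤ᵇ n) ∧ hyperbolicᵇ m n) ∨ ((9 + n ≤ᵇ m + m) ∨ (listed m n closedData ∨ reachable 2 m n))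

small-checked : True (all< 20 (λ m → all< (small m) (smallᵇ m)))
small-checked = tt

-- The m values from 2 m + 1 to 3 m represent all residues modulo m, and gluing full m-gons raises n
-- by m.
window-checked : True (all< 20 (λ m → not (5 ≤ᵇ m) ∨ all< m (λ i → reachable 2 m (suc (m + m) + i))))
window-checked = tt

triangle-window : True (all< 9 (λ i → listed 3 (16 + i) triangleData))
triangle-window = tt

square-window : True (all< 4 (λ i → listed 4 (11 + i) squareData))
square-window = tt

Hyperbolic : ℕ → ℕ → Set
Hyperbolic m n = 2 * (m + n) < m * n

Map : ℕ → ℕ → Set
Map m n = ∃[ k ] ChiralAltMap k m n

Map-sym : ∀ {m n} → Map m n → Map n m
Map-sym (k , M) = k , ChiralAltMap-sym M

coreMap : ∀ {m n} → Core m n → Map m n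
coreMap C = Core.k C , FromCore.chiralAltMap C

isoMap : ∀ {m n j} → IsoState m n j → Map m n
isoMap I = coreMap (IsoState.toCore I)

-- Reaches the types with n only moderately larger than m, for which the base is built from n-gons
-- and then dualised.
dualMap : ∀ {m n} → m ≤ n → 9 + n ≤ m + m → Map m n
dualMap p q = Map-sym (isoMap (polygonState p q))

private
  implied : ∀ b {p} → True (not b ∨ p) → True b → True p
  implied true h _ = h

  T-∧⁺ : ∀ {a b} → True a → True b → True (a ∧ b)
  T-∧⁺ {true} _ q = q

smallMap : ∀ {m n} → m < 20 → n < small m → m ≤ n → Hyperbolic m n → Map m n
smallMap {m} {n} m<20 n<small m≤n hyp = [ (λ p → dualMap m≤n (≤ᵇ⇒≤ (9 + n) (m + m) p)) , (λ p → found (Equivalence.to (T-∨ {listed m n closedData}) p)) ]′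
    (Equivalence.to (T-∨ {9 + n ≤ᵇ m + m}) (implied ((m ≤ᵇ n) ∧ hyperbolicᵇ m n)
      (all<-sound (small m) (smallᵇ m) (all<-sound 20 (λ m → all< (small m) (smallᵇ m)) small-checked m m<20) n n<small)
      (T-∧⁺ (≤⇒≤ᵇ m≤n) (<⇒<ᵇ hyp))))
  where
  found : True (listed m n closedData) ⊎ True (reachable 2 m n) → Map m n
  found (inj₁ p) = coreMap (closed-sound m n p)
  found (inj₂ p) = isoMap (reachable-sound 2 m n p)

windowMap : ∀ {m} → 5 ≤ m → (∀ i → i < m → IsoState m (suc (m + m) + i) 2) → ∀ n → suc (m + m) ≤ n → Map m n
windowMap {m} 5≤m window n p = isoMap (fromWindow {Q = λ n → IsoState m n 2} m {{>-nonZero (≤-trans (s≤s z≤n) 5≤m)}} (appendTile (fullTile 5≤m)) (suc (m + m)) window n p)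

triangleMap : ∀ n → 16 ≤ n → Map 3 n
triangleMap n p = coreMap (TriState.toCore (fromWindow {Q = TriState 3} 9 TriGlue.triGlue 16
  (λ i h → triangle-sound 3 (16 + i) (all<-sound 9 (λ i → listed 3 (16 + i) triangleData) triangle-window i h)) n p))

squareMap : ∀ n → 11 ≤ n → Map 4 n
squareMap n p = isoMap (fromWindow {Q = λ n → IsoState 4 n 1} 4 (appendTile squareTile) 11
  (λ i h → square-sound 4 (11 + i) (all<-sound 4 (λ i → listed 4 (11 + i) squareData) square-window i h)) n p)

hyperbolic-bound : ∀ {m n} → m ≤ 2 → ¬ Hyperbolic m n
hyperbolic-bound {m} {n} p h = <⇒≱ h (≤-trans (*-monoˡ-≤ n p) (*-monoʳ-≤ 2 (m≤n+m n m)))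

boundedMap : ∀ m n → m < 20 → m ≤ n → Hyperbolic m n → Map m n
boundedMap m n m<20 m≤n hyp with n <? small m
... | yes p = smallMap m<20 p m≤n hyp
boundedMap 0 n _ _ hyp | no p = ⊥-elim (hyperbolic-bound {n = n} z≤n hyp)
boundedMap 1 n _ _ hyp | no p = ⊥-elim (hyperbolic-bound {n = n} (s≤s z≤n) hyp)
boundedMap 2 n _ _ hyp | no p = ⊥-elim (hyperbolic-bound {n = n} (s≤s (s≤s z≤n)) hyp)
boundedMap 3 n _ _ hyp | no p = triangleMap n (≮⇒≥ p)
boundedMap 4 n _ _ hyp | no p = squareMap n (≮⇒≥ p)
boundedMap m@(suc (suc (suc (suc (suc l))))) n m<20 _ hyp | no p = windowMap 5≤m
    (λ i h → reachable-sound 2 m _ (all<-sound m (λ i → reachable 2 m (suc (m + m) + i))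
      (implied (5 ≤ᵇ m) (all<-sound 20 (λ m → not (5 ≤ᵇ m) ∨ all< m (λ i → reachable 2 m (suc (m + m) + i))) window-checked m m<20)
        (≤⇒≤ᵇ 5≤m)) i h))
    n (≮⇒≥ p)
  where
  5≤m : 5 ≤ m
  5≤m = s≤s (s≤s (s≤s (s≤s (s≤s z≤n))))

largeMap : ∀ m n → 20 ≤ m → m ≤ n → Map m n
largeMap m n 20≤m m≤n with 8 + m ≤? n
-- From n ≤ 7 + m it follows that 9 + n ≤ 16 + m ≤ 2 m.
... | no p = dualMap m≤n (≤-trans (+-monoʳ-≤ 9 (s≤s⁻¹ (≰⇒> p))) (+-monoˡ-≤ m (≤-trans (≤ᵇ⇒≤ 16 20 _) 20≤m)))
... | yes p with n ≤? m + m
...   | yes q = isoMap (twoPolygons (≤-trans (≤ᵇ⇒≤ 9 20 _) 20≤m) p q)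
...   | no q = windowMap (≤-trans (≤ᵇ⇒≤ 5 20 _) 20≤m) (λ i h → threePolygons 20≤m (m≤m+n _ i)
          (subst (_≤ m + m + m) (+-suc (m + m) i) (+-monoʳ-≤ (m + m) h))) n (≰⇒> q)

orderedMap : ∀ m n → m ≤ n → Hyperbolic m n → Map m n
orderedMap m n m≤n hyp with 20 ≤? m
... | yes p = largeMap m n p m≤n
... | no p = boundedMap m n (≰⇒> p) m≤n hyp

theorem1p1 : ∀ (m n : ℕ) → 2 ≤ m → 2 ≤ n → 2 * (m + n) < m * n →
  ∃[ k ] ChiralAltMap k m n
theorem1p1 m n _ _ hyp with ≤-total m n
... | inj₁ p = orderedMap m n p hyp
... | inj₂ p = Map-sym (orderedMap n m p (subst₂ _<_ (cong (2 *_) (+-comm m n)) (*-comm m n) hyp))
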